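{- Let $G=(L\cup R,E)$ be a bipartite graph with $n=|L|+|R|$ vertices and $m=|E|$ edges. The time complexity of enumerating all maximal bicliques of $G$ by the algorithm IPS used within the inclusion-exclusion (IE) framework (both described in the context) is $$O(n\cdot\gamma^2\cdot\alpha^{\gamma}+\gamma\cdot\beta),$$ where $\alpha$ ($\approx 1.3954$) is the largest positive real root of $x^4-2x-1=0$, $\beta$ is the number of maximal bicliques in $G$, and $$\gamma=\max_{v\in L}\bigl(|N_1(v)|+|N_2(v)|-1\bigr),$$ with $N_1(v)$ and $N_2(v)$ the sets of 1-hop and 2-hop neighbors of $v$ in $G$.
   Context: Graphs. $G=(L\cup R,E)$ is an unweighted undirected bipartite graph with disjoint vertex sides $L,R$ and $E\subseteq L\times R$. All subgraphs are induced; for $V_L\subseteq L$, $V_R\subseteq R$, $G[V_L\cup V_R]$ is the induced subgraph. For an induced subgraph $H$, $L(H)$ and $R(H)$ are its left and right sides. A biclique is an induced subgraph $G[V_L\cup V_R]$ in which every $u\in V_L$ is adjacent to every $v\in V_R$; it is maximal if no other biclique of $G$ contains it. A bipartite graph is a 2-biplex if every vertex (on either side) has at most 2 non-neighbors on the opposite side. Problem. Given $G$ and integers $\tau_L,\tau_R\ge 1$, output all maximal bicliques $H$ of $G$ with $|L(H)|\ge\tau_L$ and $|R(H)|\ge\tau_R$. Enumerating all maximal bicliques means $\tau_L=\tau_R=1$ (so bicliques have both sides non-empty), and $\beta$ counts these. Notation. For a vertex set $Z$, $Z_L=Z\cap L$ and $Z_R=Z\cap R$. For a vertex $v$ and a set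 $Y$ of vertices on the side opposite to $v$, $\overline d(v,Y)$ is the number of vertices of $Y$ not adjacent to $v$. For $v\in L$, $N_1(v)\subseteq R$ is the set of neighbors of $v$, and $N_2(v)\subseteq L$ is the set of 2-hop neighbors of $v$, i.e. the vertices of $L$ having a common neighbor with $v$, with $v$ itself counted as a member of $N_2(v)$. IE framework. Fix an arbitrary ordering $v_1,\dots,v_{|L|}$ of $L$. For each $i=1,\dots,|L|$, run the recursive procedure IPS (below) on the induced subgraph $G[N_1(v_i)\cup N_2(v_i)]$ starting from the branch $$S_i=\{v_i\},\quad C_i=(N_1(v_i)\cup N_2(v_i))\setminus\{v_1,\dots,v_i\},\quad X_i=N_2(v_i)\cap\{v_1,\dots,v_{i-1}\}.$$ Thus $\gamma=\max_i(|C_i|+|X_i|)$. Procedure IPS. It works recursively on branches $(S,C,X)$ (partial biclique, candidate set, exclusion set). At a branch $(S,C,X)$: 1. Termination: if $G[S\cup C]$ is a 2-biplex and $X=\emptyset$, output all maximal bicliques of $G[S\cup C]$ (satisfying the size constraints) and return. This is done by a dedicated procedure for 2-biplexes: each connected component of the bipartite complement is an isolated vertex, a simple path or a simple cycle, and the maximal bicliques are obtained as maximal independent sets of the complement, by combining maximal independent sets of its components; the cost on a 2-biplex with $n'$ vertices, $m'$ edges and $\beta'$ maximal bicliques is $O(m'+n'\beta')$. 2. Pruning: return if (P1) $|S_L|+|C_L|<\tau_L$ or $|S_R|+|C_R|<\tau_R$; or (P2) some $v\in X_L$ is adjacent to all of $C_R$, or some $v\in X_R$ is adjacent to all of $C_L$.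 3. Pivot selection: let $C'=C_L'\cup C_R'$ with $$C_L'=\{v\in C_L: \overline d(v,X_R)=0\ \wedge\ \overline d(v,C_R)\le 2\},\qquad C_R'=\{v\in C_R: \overline d(v,X_L)=0\ \wedge\ \overline d(v,C_L)\le 2\}.$$ A vertex $v\in C\cup X$ is a candidate pivot if (C1) $v\in (C\setminus C')\cup X$; or (C2) $v\in C_L'$ has at least one non-neighbor in $C_R\setminus C_R'$, or $v\in C_R'$ has at least one non-neighbor in $C_L\setminus C_L'$. The pivot $v^*$ is a candidate pivot with the minimum number of non-neighbors in $C$ on its opposite side; ties are broken in favour of vertices of $X$, and otherwise arbitrarily. 4. Branching: let $w_1,w_2,\dots$ be the list consisting of $v^*$ (if $v^*\in C$) followed by the non-neighbors of $v^*$ in $C$ on the side opposite to $v^*$ (in an order chosen by the algorithm). For each $j$, recurse on $$S\cup\{w_j\},\quad C\setminus\{w_1,\dots,w_j\},\quad X\cup\{w_1,\dots,w_{j-1}\},$$ after removing from the last two sets all vertices on the side opposite to $w_j$ that are not adjacent to $w_j$. Running time is worst-case time, including the time to output the bicliques. -}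

module Defs where

import Algebra.Definitions.RawSemiring
open import Data.Bool using (Bool; true; false; T; not; _∧_; _∨_; if_then_else_)
open import Data.Bool.Properties using (T?) renaming (_≟_ to _≟ᵇ_)
open import Data.Fin using (Fin; toℕ)
import Data.Fin.Properties as Fin
open import Data.Fin.Permutation using (Permutation′; _⟨$⟩ʳ_; _⟨$⟩ˡ_)
open import Data.Fin.Subset
  using (Subset; inside; outside; _∈_; _⊆_; _∩_; _∪_; ∣_∣; ⁅_⁆; ⊥; ⊤)
open import Data.Fin.Subset.Properties
  using (_∈?_; _⊆?_; nonempty?; anySubset?)
open import Data.List
  using (List; []; _∷_; _++_; map; length; filter; foldr; null; allFin;
         cartesianProduct)
import Data.List.Extrema.Nat as Extrema
import Data.List.Membership.Propositional as List
open import Data.List.Relation.Binary.Permutation.Propositional using (_↭_)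
open import Data.Nat
  using (ℕ; zero; suc; _+_; _*_; _∸_; _≤_; _≤?_; _≤ᵇ_; _<ᵇ_; _≡ᵇ_)
open import Data.Integer using (+_)
open import Data.Product using (Σ; ∃; ∃₂; _×_; _,_; proj₁; proj₂)
open import Data.Product.Properties using () renaming (≡-dec to ×-≡-dec)
open import Data.Rational as ℚ using (ℚ; 0ℚ; 1ℚ)
open import Data.Unit using (tt) renaming (⊤ to 𝟙)
open import Data.Vec as Vec using (tabulate)
import Data.Vec.Properties as Vec
open import Relation.Binary.PropositionalEquality using (_≡_; _≢_)
open import Relation.Nullary using (Dec; does; ¬_)
open import Relation.Nullary.Decidable using (¬?; _×-dec_; _→-dec_)

------------------------------------------------------------------------
-- Bipartite graphs

data Side : Set where
  left right : Side

opp : Side → Side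
opp left  = right
opp right = left

record BipartiteGraph : Set where
  field
    size : Side → ℕ
    edge : Fin (size left) → Fin (size right) → Bool

module _ (G : BipartiteGraph) where
  open BipartiteGraph G

  V : Side → Set
  V s = Fin (size s)

  order : ℕ
  order = size left + size right

  adj : (s : Side) → V s → V (opp s) → Bool
  adj left  u v = edge u v
  adj right v u = edge u v

  N₁ : (s : Side) → V s → Subset (size (opp s))
  N₁ s v = tabulate (adj s v)

  -- The disjunct u = v matters only for an isolated v: a vertex always
  -- belongs to its own 2-hop neighbourhood.
  N₂ : V left → Subset (size left)
  N₂ v = tabulate λ u →
    does (u Fin.≟ v) ∨ does (nonempty? (N₁ left u ∩ N₁ left v))

  γ : ℕ
  γ = Extrema.max 0
        (map (λ v → ∣ N₁ left v ∣ + ∣ N₂ v ∣ ∸ 1) (allFin (size left)))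

  ----------------------------------------------------------------------
  -- Induced subgraphs, identified with their vertex sets

  Sub : Set
  Sub = Subset (size left) × Subset (size right)

  whole : Sub
  whole = ⊤ , ⊤

  side : Sub → (s : Side) → Subset (size s)
  side (A , B) left  = A
  side (A , B) right = B

  infix 4 _⊑_ _⊑?_
  _⊑_ : Sub → Sub → Set
  (A , B) ⊑ (A′ , B′) = A ⊆ A′ × B ⊆ B′

  _⊑?_ : (H H′ : Sub) → Dec (H ⊑ H′)
  (A , B) ⊑? (A′ , B′) = (A ⊆? A′) ×-dec (B ⊆? B′)

  #vertices : Sub → ℕ
  #vertices (A , B) = ∣ A ∣ + ∣ B ∣

  #edges : Sub → ℕ
  #edges (A , B) = length (filter
    (λ (u , v) → (u ∈? A) ×-dec (v ∈? B) ×-dec T? (edge u v))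
    (cartesianProduct (allFin (size left)) (allFin (size right))))

  Is2Biplex : Sub → Set
  Is2Biplex H = ∀ s v → v ∈ side H s →
    ∣ tabulate (λ u → not (adj s v u)) ∩ side H (opp s) ∣ ≤ 2

  IsBiclique : Sub → Set
  IsBiclique (A , B) = ∀ u → u ∈ A → ∀ v → v ∈ B → T (edge u v)

  isBiclique? : ∀ H → Dec (IsBiclique H)
  isBiclique? (A , B) =
    Fin.all? λ u → (u ∈? A) →-dec
    Fin.all? λ v → (v ∈? B) →-dec T? (edge u v)

  -- IsMaximalBiclique W H : H is a maximal biclique of the subgraph
  -- induced by W.  Either side of H may be empty here.
  IsMaximalBiclique : Sub → Sub → Set
  IsMaximalBiclique W H =
    H ⊑ W × IsBiclique H ×
    ¬ (∃₂ λ A B → (A , B) ⊑ W × IsBiclique (A , B) ×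
                  H ⊑ (A , B) × (A , B) ≢ H)

  isMaximalBiclique? : ∀ W H → Dec (IsMaximalBiclique W H)
  isMaximalBiclique? W H =
    (H ⊑? W) ×-dec isBiclique? H ×-dec
    ¬? (anySubset? λ A → anySubset? λ B →
         ((A , B) ⊑? W) ×-dec isBiclique? (A , B) ×-dec
         (H ⊑? (A , B)) ×-dec
         ¬? (×-≡-dec (Vec.≡-dec _≟ᵇ_) (Vec.≡-dec _≟ᵇ_) (A , B) H))

  subsets : ∀ n → List (Subset n)
  subsets zero    = Vec.[] ∷ []
  subsets (suc n) =
    map (inside Vec.∷_) (subsets n) ++ map (outside Vec.∷_) (subsets n)

  maximalBicliques : (τ : Side → ℕ) → Sub → List Sub
  maximalBicliques τ W = filter
    (λ (A , B) → isMaximalBiclique? W (A , B) ×-dec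
                 (τ left ≤? ∣ A ∣) ×-dec (τ right ≤? ∣ B ∣))
    (cartesianProduct (subsets (size left)) (subsets (size right)))

  β : ℕ
  β = length (maximalBicliques (λ _ → 1) whole)

------------------------------------------------------------------------
-- Programs with unit-cost time and an output stream

record Prog (O A : Set) : Set where
  constructor prog
  field
    value  : A
    time   : ℕ
    output : List O

open Prog public

module _ {O : Set} where

  return : {A : Set} → A → Prog O A
  return x = prog x 0 []

  infixl 1 _>>=_ _>>_
  _>>=_ : {A B : Set} → Prog O A → (A → Prog O B) → Prog O B
  prog x t o >>= f = let prog y t′ o′ = f x in prog y (t + t′) (o ++ o′)

  _>>_ : {A B : Set} → Prog O A → Prog O B → Prog O B
  p >> p′ = p >>= λ _ → p′

  spend : ℕ → Prog O 𝟙
  spend t = prog tt t []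

  -- Every step of a list traversal costs 1, in addition to the cost of
  -- the test or body run at that step.

  foldᵖ : {A B : Set} → (B → A → Prog O B) → B → List A → Prog O B
  foldᵖ f b []       = spend 1 >> return b
  foldᵖ f b (x ∷ xs) = spend 1 >> f b x >>= λ b′ → foldᵖ f b′ xs

  filterᵖ : {A : Set} → (A → Prog O Bool) → List A → Prog O (List A)
  filterᵖ p []       = spend 1 >> return []
  filterᵖ p (x ∷ xs) = do
    spend 1
    b  ← p x
    ys ← filterᵖ p xs
    return (if b then x ∷ ys else ys)

  mapᵖ : {A B : Set} → (A → Prog O B) → List A → Prog O (List B)
  mapᵖ f []       = spend 1 >> return []
  mapᵖ f (x ∷ xs) = do
    spend 1
    y  ← f x
    ys ← mapᵖ f xs
    return (y ∷ ys)

  lengthᵖ : {A : Set} → List A → Prog O ℕ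
  lengthᵖ = foldᵖ (λ k _ → return (suc k)) 0

  infixr 5 _++ᵖ_
  _++ᵖ_ : {A : Set} → List A → List A → Prog O (List A)
  xs ++ᵖ ys = spend (suc (length xs)) >> return (xs ++ ys)

  notᵖ : Prog O Bool → Prog O Bool
  notᵖ p = p >>= λ b → return (not b)

  anyᵖ allᵖ : {A : Set} → (A → Prog O Bool) → List A → Prog O Bool
  anyᵖ p xs = filterᵖ p xs >>= λ ys → return (not (null ys))
  allᵖ p xs = notᵖ (anyᵖ (λ x → notᵖ (p x)) xs)

------------------------------------------------------------------------
-- The algorithm

module _ (G : BipartiteGraph) where
  open BipartiteGraph G

  Vertex : Set
  Vertex = Σ Side (V G)

  VSet : Set
  VSet = (s : Side) → List (V G s)

  ⟦_⟧ : VSet → Sub G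
  ⟦ Z ⟧ = toSubset (Z left) , toSubset (Z right)
    where
    toSubset : ∀ {n} → List (Fin n) → Subset n
    toSubset = foldr (λ i p → ⁅ i ⁆ ∪ p) ⊥

  assemble : (s : Side) → List (V G s) → List (V G (opp s)) → VSet
  assemble left  xs ys left  = xs
  assemble left  xs ys right = ys
  assemble right xs ys left  = ys
  assemble right xs ys right = xs

  record Branch : Set where
    constructor branch
    field
      S C X : VSet

  Run : Set → Set
  Run = Prog (Sub G)

  -- The dedicated procedure for 2-biplexes, with the constant K₀ hidden
  -- in its running time O(m' + n'β').
  record BiplexProcedure (K₀ : ℕ) : Set where
    field
      run      : (τ : Side → ℕ) → VSet → Run 𝟙
      correct  : ∀ τ W → Is2Biplex G ⟦ W ⟧ →
                 output (run τ W) ↭ maximalBicliques G τ ⟦ W ⟧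
      time-≤   : ∀ τ W → Is2Biplex G ⟦ W ⟧ →
                 time (run τ W) ≤
                 K₀ * (#edges G ⟦ W ⟧ +
                       #vertices G ⟦ W ⟧ *
                       length (maximalBicliques G (λ _ → 0) ⟦ W ⟧))

  record Candidate : Set where
    constructor candidate
    field
      {s}    : Side
      vertex : V G s
      inX    : Bool
      degree : ℕ   -- number of non-neighbours in C on the opposite side

  -- What the description of the algorithm leaves open.  Different
  -- branches of one run have different S, so letting the choices depend
  -- on the branch loses no generality.
  record Choices : Set where
    field
      tieBreak    : Branch → (c : Candidate) (cs : List Candidate) →
                    ∃ λ p → p List.∈ (c ∷ cs)
      branchOrder : Branch → ∀ {s} (ws : List (V G s)) → ∃ λ ws′ → ws′ ↭ ws

  -- Elementary operations on vertices.  The graph is available through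
  -- constant-time adjacency queries and through adjacency lists; reading
  -- an adjacency list is paid for when it is traversed.

  adjacent nonadjacent : (s : Side) → V G s → V G (opp s) → Run Bool
  adjacent    s v u = spend 1 >> return (adj G s v u)
  nonadjacent s v u = notᵖ (adjacent s v u)

  same : ∀ {s} → V G s → V G s → Run Bool
  same u v = spend 1 >> return (does (u Fin.≟ v))

  neighbours : (s : Side) → V G s → List (V G (opp s))
  neighbours s v = filter (λ u → T? (adj G s v u)) (allFin (size (opp s)))

  d̄ : (s : Side) → V G s → List (V G (opp s)) → Run ℕ
  d̄ s v Y = filterᵖ (nonadjacent s v) Y >>= lengthᵖ

  module IPS (τ : Side → ℕ) {K₀ : ℕ}
             (biplex : BiplexProcedure K₀) (choices : Choices) where
    open BiplexProcedure biplex
    open Choices choices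

    union : VSet → VSet → Run VSet
    union Y Z = do
      l ← Y left  ++ᵖ Z left
      r ← Y right ++ᵖ Z right
      return (assemble left l r)

    2biplexᵖ : VSet → Run Bool
    2biplexᵖ W = do
      l ← ok left
      r ← ok right
      return (l ∧ r)
      where
      ok : Side → Run Bool
      ok s = allᵖ (λ v → do
                     k ← d̄ s v (W (opp s))
                     spend 1
                     return (k ≤ᵇ 2))
                  (W s)

    -- The first argument is S ∪ C.
    prunedᵖ : VSet → Branch → Run Bool
    prunedᵖ W (branch S C X) = do
      l  ← tooSmall left
      r  ← tooSmall right
      l′ ← dominated left
      r′ ← dominated right
      return ((l ∨ r) ∨ (l′ ∨ r′))
      where
      tooSmall dominated : Side → Run Bool
      tooSmall s = do
        k ← lengthᵖ (W s)
        spend 1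
        return (k <ᵇ τ s)
      dominated s = anyᵖ (λ v → allᵖ (adjacent s v) (C (opp s))) (X s)

    candidates : Branch → Run (List Candidate)
    candidates (branch S C X) = do
      C′l ← filterᵖ (C′? left) (C left)
      C′r ← filterᵖ (C′? right) (C right)
      Dl  ← filterᵖ (λ v → notᵖ (C′? left v)) (C left)
      Dr  ← filterᵖ (λ v → notᵖ (C′? right v)) (C right)
      c2l ← filterᵖ (λ v → anyᵖ (nonadjacent left v) Dr) C′l
      c2r ← filterᵖ (λ v → anyᵖ (nonadjacent right v) Dl) C′r
      xs  ← mapᵖ (rate left true) (X left)
      xs′ ← mapᵖ (rate right true) (X right)
      ds  ← mapᵖ (rate left false) Dl
      ds′ ← mapᵖ (rate right false) Dr
      cs  ← mapᵖ (rate left false) c2l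
      cs′ ← mapᵖ (rate right false) c2r
      a   ← xs ++ᵖ xs′
      b   ← ds ++ᵖ ds′
      c   ← cs ++ᵖ cs′
      bc  ← b ++ᵖ c
      a ++ᵖ bc
      where
      C′? : (s : Side) → V G s → Run Bool
      C′? s v = do
        x ← d̄ s v (X (opp s))
        c ← d̄ s v (C (opp s))
        spend 1
        return ((x ≡ᵇ 0) ∧ (c ≤ᵇ 2))
      rate : (s : Side) → Bool → V G s → Run Candidate
      rate s x v = do
        k ← d̄ s v (C (opp s))
        return (candidate v x k)

    -- Comparing keys compares degrees first and, for equal degrees,
    -- prefers vertices of X.
    key : Candidate → ℕ
    key c = 2 * Candidate.degree c + (if Candidate.inX c then 0 else 1)

    bestCandidates : List Candidate → Run (List Candidate)
    bestCandidates cs =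
      filterᵖ (λ c → allᵖ (λ c′ → spend 1 >> return (key c ≤ᵇ key c′)) cs) cs

    -- The list w₁, w₂, … for a given pivot.  Arranging the non-neighbours
    -- in the chosen order is charged as a quadratic sort.
    branchingVertices : Branch → Candidate → Run (List Vertex)
    branchingVertices b@(branch S C X) (candidate {s} v inX _) = do
      ws ← filterᵖ (nonadjacent s v) (C (opp s))
      let ws′ = proj₁ (branchOrder b ws)
      spend (length ws * length ws)
      ws″ ← mapᵖ (λ w → return (opp s , w)) ws′
      return (if inX then ws″ else (s , v) ∷ ws″)

    -- The first argument bounds the recursion depth.  Every recursive
    -- call removes a vertex from C, and no call is made when C is empty,
    -- so a bound exceeding the size of the initial C is never reached.
    ips : ℕ → Branch → Run 𝟙
    ips zero    _                = return tt
    ips (suc f) b@(branch S C X) = do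
      spend 1
      W  ← union S C
      bp ← 2biplexᵖ W
      if bp ∧ null (X left) ∧ null (X right) then run τ W else do
        p ← prunedᵖ W b
        if p then return tt else do
          cs   ← candidates b
          best ← bestCandidates cs
          branchOn best
      where
      -- The state (C , X) is the one left behind by w₁, …, wⱼ₋₁, before
      -- the removal of the vertices not adjacent to wⱼ.
      step : VSet × VSet → Vertex → Run (VSet × VSet)
      step (C , X) (s , w) = do
        Cs ← filterᵖ (λ u → notᵖ (same u w)) (C s)
        Co ← filterᵖ (adjacent s w) (C (opp s))
        Xo ← filterᵖ (adjacent s w) (X (opp s))
        ips f (branch (assemble s (w ∷ S s) (S (opp s)))
                      (assemble s Cs Co)
                      (assemble s (X s) Xo))
        return ( assemble s Cs (C (opp s))
               , assemble s (w ∷ X s) (X (opp s)) )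

      branchOn : List Candidate → Run 𝟙
      branchOn []       = return tt
      branchOn (c ∷ cs) = do
        spend (suc (length cs))
        ws ← branchingVertices b (proj₁ (tieBreak b c cs))
        foldᵖ step (C , X) ws
        return tt

    -- The inclusion-exclusion framework; the ordering of the left side is
    -- vᵢ = π ⟨$⟩ʳ i.
    module _ (π : Permutation′ (size left)) where

      twoHop : V G left → Run (List (V G left))
      twoHop v = foldᵖ (λ acc w → foldᵖ insert acc (neighbours right w))
                       (v ∷ []) (neighbours left v)
        where
        insert : List (V G left) → V G left → Run (List (V G left))
        insert acc u = do
          present ← anyᵖ (same u) acc
          return (if present then acc else u ∷ acc)

      precedes : V G left → V G left → Run Bool
      precedes u v =
        spend 1 >> return (toℕ (π ⟨$⟩ˡ u) <ᵇ toℕ (π ⟨$⟩ˡ v))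

      ie : Run 𝟙
      ie = foldᵖ (λ _ i → start (π ⟨$⟩ʳ i)) tt (allFin (size left))
        where
        start : V G left → Run 𝟙
        start v = do
          n₂ ← twoHop v
          Cl ← filterᵖ (λ u → precedes v u) n₂
          Xl ← filterᵖ (λ u → precedes u v) n₂
          let Cr = neighbours left v
          ips (suc (length Cl + length Cr))
              (branch (assemble left (v ∷ []) [])
                      (assemble left Cl Cr)
                      (assemble left Xl []))

  -- Enumerating all maximal bicliques: both size thresholds are 1.
  runningTime : ∀ {K₀} → BiplexProcedure K₀ → Choices →
                Permutation′ (size left) → ℕ
  runningTime biplex choices π =
    time (IPS.ie (λ _ → 1) biplex choices π)

------------------------------------------------------------------------
-- The bound

infixr 8 _^_
_^_ : ℚ → ℕ → ℚ
_^_ = Algebra.Definitions.RawSemiring._^_ ℚ.+-*-rawSemiring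

fromℕ : ℕ → ℚ
fromℕ k = + k ℚ./ 1

-- The real number α, the largest positive root of x⁴ - 2x - 1, given by
-- its upper cut: α< q holds when q is positive and the polynomial, whose
-- leading coefficient is positive, is positive from q onwards.
α<_ : ℚ → Set
α< q = 0ℚ ℚ.< q ×
       (∀ r → q ℚ.≤ r → 0ℚ ℚ.< r ^ 4 ℚ.- fromℕ 2 ℚ.* r ℚ.- 1ℚ)

-- t ≤[ c · αᵏ + d ], for c, d ≥ 0.  By continuity and monotonicity of
-- c · xᵏ + d on x ≥ 0 this says exactly that the real inequality holds
-- at x = α.
_≤[_·α^_+_] : ℕ → ℕ → ℕ → ℕ → Set
t ≤[ c ·α^ k + d ] = ∀ q → α< q →
  fromℕ t ℚ.≤ fromℕ c ℚ.* q ^ k ℚ.+ fromℕ d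

{-# OPTIONS --safe #-}

-- Degrees count non-neighbours, as in the bipartite complement.  A branch
-- (S, C, X) gets the potential Φ = 2|C| + |X|: since a branching vertex that
-- moves from C to X already loses half of its weight, even the four children
-- of a pivot of degree 3 are cheap, although 4 α⁻⁴ > 1.  A vertex of X of
-- degree at most 2 is worth an extra decrease of Φ by one or two; this settles
-- the case of a pivot satisfying (C2) which has a non-neighbour of degree 1
-- that is branched on last.  In every case the potentials of the children,
-- lowered for example by (6, 6, 8), (6, 7, 7), (6, 10, 5) or (5, 4), respect
-- a function F with F (m + 8) = 2 F (m + 2) + F m + 1, whose growth rate per
-- unit of Φ is √α; the drops (6, 6, 8) give x⁴ = 2x + 1.  As Φ ≤ 2γ at the
-- roots, each search tree has O(α^γ) nodes of cost O(γ²), up to the term n′β′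
-- of the leaves.
--
-- A maximal biclique of a leaf with both sides non-empty is maximal in G,
-- because X is empty there, and it belongs to no other leaf, since it contains
-- S and is contained in S ∪ C.  A leaf has at most two further ones, whose
-- left or right side is empty.  So the terms n′β′ add up to O(γ) times β plus
-- the number of leaves.
module Submission where

open import Defs
open import Data.Bool using (Bool; true; false; T; not; if_then_else_; _∧_; _∨_)
open import Data.Bool.Properties using (T?; T-∧; T-∨) renaming (_≟_ to _≟ᵇ_)
open import Data.Empty using (⊥-elim)
open import Data.Fin using (Fin; zero; suc; toℕ)
import Data.Fin.Properties as Fin
open import Data.Fin.Permutation
  using (Permutation′; _⟨$⟩ʳ_; _⟨$⟩ˡ_; inverseʳ; inverseˡ)
open import Data.Fin.Subset as Subset
  using (Subset; ∣_∣; ⊥; ⁅_⁆; _∪_; _∩_; _⊆_; Nonempty)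
import Data.Fin.Subset.Properties as Subset
open import Data.Integer as ℤ using ()
import Data.Integer.Properties as ℤ
open import Data.List
  using (List; []; _∷_; _++_; map; length; filter; filterᵇ; null; foldr; allFin;
         cartesianProduct)
import Data.List.Extrema.Nat as Extrema
open import Data.List.Membership.Propositional using (_∈_; _∉_; lose)
open import Data.List.Membership.Propositional.Properties
  using (∈-filter⁺; ∈-filter⁻; ∈-length; ∈-map⁺; ∈-map⁻; ∈-++⁻; ∈-++⁺ˡ; ∈-++⁺ʳ;
         ∈-cartesianProduct⁺; ∈-allFin)
open import Data.List.Properties
  using (length-map; length-++; length-filter; length-tabulate; filter-notAll;
         filter-all; filter-accept)
open import Data.List.Relation.Binary.Permutation.Propositional
  using (_↭_; ↭-sym; ↭⇒↭ₛ)
import Data.List.Relation.Binary.Permutation.Propositional.Properties as ↭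
import Data.List.Relation.Binary.Permutation.Setoid.Properties as ↭ₛ
open import Data.List.Relation.Unary.All as All using (All; []; _∷_)
open import Data.List.Relation.Unary.All.Properties using (map⁺; map⁻)
open import Data.List.Relation.Unary.AllPairs using ([]; _∷_)
open import Data.List.Relation.Unary.Any as Any using (Any; here; there)
open import Data.List.Relation.Unary.Unique.Propositional using (Unique)
import Data.List.Relation.Unary.Unique.Propositional.Properties as Unique
open import Data.Nat renaming (_^_ to _^ⁿ_)
open import Data.Nat.ListAction using (sum)
open import Data.Nat.Properties
open import Data.Nat.Tactic.RingSolver using (solve-∀)
open import Data.Product using (∃; ∃₂; _×_; _,_; proj₁; proj₂)
open import Data.Product.Properties using () renaming (≡-dec to ×-≡-dec)
open import Data.Rational as ℚ using (ℚ; 0ℚ; 1ℚ)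
import Data.Rational.Properties as ℚ
import Data.Rational.Solver as ℚ-Solver
import Data.Rational.Unnormalised as ℚᵘ
import Data.Rational.Unnormalised.Properties as ℚᵘ
open import Data.Sum using (_⊎_; inj₁; inj₂; [_,_]′)
open import Data.Unit using (tt) renaming (⊤ to 𝟙)
open import Data.Vec as Vec using ([]; _∷_; tabulate)
import Data.Vec.Properties as Vec
open import Function using (_∘_; id; flip; Equivalence)
open import Level using (0ℓ)
open import Relation.Binary.Definitions
  using (DecidableEquality; tri<; tri≈; tri>)
open import Relation.Binary.PropositionalEquality
open import Relation.Nullary using (Dec; ¬_; yes; no; does; contradiction)
open import Relation.Nullary.Decidable
  using (True; toWitness; ¬?; _×-dec_; _⊎-dec_)
open import Relation.Unary using (Pred; Decidable)

-- Growth of the potential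

-- A bonus can be drawn because the pivot has minimum degree. A pivot of X of degree d has d
-- children, each losing 2d + 3, two units more than `F` requires. A pivot of C has degree strictly
-- below that of every vertex of X, as ties go to X; so a bonus e leaves d ≤ 2 - e, and only for d ≤
-- 1 must it be reconciled with the branching. For d = 1 its carrier either stays in X in both
-- children, or it makes one child cheaper and enlarges the bonus in the other. The order of the
-- branching vertices is arbitrary. For d = 2 both positions of the non-neighbour outside C′ are
-- therefore treated; the other non-neighbour may have degree as low as 1, which is why a vertex
-- just excluded has to supply a bonus or kill the next child. All of this takes place in the
-- integers: the summand 1 in the inequalities for `F` is the node itself, so a single induction
-- bounds the time by (cost per node) · `F` plus a term for the maximal bicliques still reachable.
-- The number α enters only at the end, when `F` is compared with the powers of every rational above
-- α.

linear : ∀ {x y a b} k → a ≤ b → x + b + k ≡ y + a → x ≤ y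
linear {x} {y} {a} {b} k a≤b eq = +-cancelʳ-≤ b x y (begin
  x + b      ≤⟨ m≤m+n (x + b) k ⟩
  x + b + k  ≡⟨ eq ⟩
  y + a      ≤⟨ +-monoʳ-≤ y a≤b ⟩
  y + b      ∎)
  where open ≤-Reasoning

-- The first values are 10000 · α^(m/2), rounded.
F : ℕ → ℕ
F 0 = 10000
F 1 = 11812
F 2 = 13953
F 3 = 16482
F 4 = 19470
F 5 = 22998
F 6 = 27167
F 7 = 32091
F (suc (suc (suc (suc (suc (suc (suc (suc m)))))))) =
  suc (F m + 2 * F (suc (suc m)))

ΣF : List ℕ → ℕ → ℕ
ΣF as n = sum (map (λ a → F (a + n)) as)

ΣF-rec : ∀ as n → ΣF as (8 + n) ≡ length as + ΣF as n + 2 * ΣF as (2 + n)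
ΣF-rec []       n = refl
ΣF-rec (a ∷ as) n = begin
  F (a + (8 + n)) + ΣF as (8 + n)
    ≡⟨ cong₂ _+_ (trans (cong F (shift₈ a n))
         (cong (λ i → suc (F (a + n) + 2 * F i)) (sym (shift₂ a n))))
         (ΣF-rec as n) ⟩
  suc (F (a + n) + 2 * F (a + (2 + n))) + (length as + ΣF as n + 2 * ΣF as (2 + n))
    ≡⟨ regroup (F (a + n)) (F (a + (2 + n))) (length as) (ΣF as n) (ΣF as (2 + n)) ⟩
  suc (length as) + (F (a + n) + ΣF as n) + 2 * (F (a + (2 + n)) + ΣF as (2 + n)) ∎
  where
  open ≡-Reasoning
  shift₈ : ∀ a n → a + (8 + n) ≡ 8 + (a + n)
  shift₈ = solve-∀
  shift₂ : ∀ a n → a + (2 + n) ≡ 2 + (a + n)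
  shift₂ = solve-∀
  regroup : ∀ x y l u v →
    suc (x + 2 * y) + (l + u + 2 * v) ≡ suc l + (x + u) + 2 * (y + v)
  regroup = solve-∀

-- Both sides obey the recurrence of F up to constants, so the first eight
-- instances of such an inequality imply all of them.
F-inequality : ∀ as b k → length as ≤ suc (2 * k) →
  All (λ n → k + ΣF as n ≤ F (b + n)) (0 ∷ 1 ∷ 2 ∷ 3 ∷ 4 ∷ 5 ∷ 6 ∷ 7 ∷ []) →
  ∀ n → k + ΣF as n ≤ F (b + n)
F-inequality as b k short (p₀ ∷ p₁ ∷ p₂ ∷ p₃ ∷ p₄ ∷ p₅ ∷ p₆ ∷ p₇ ∷ []) = go
  where
  shift₈ : ∀ b n → 8 + (b + n) ≡ b + (8 + n)
  shift₈ = solve-∀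
  shift₂ : ∀ b n → b + (2 + n) ≡ 2 + (b + n)
  shift₂ = solve-∀
  regroup : ∀ k l u v → l + 2 * (k + v) + (k + u) + suc k ≡
    (k + (l + u + 2 * v) + k) + suc (2 * k)
  regroup = solve-∀
  regroup′ : ∀ k l a c u v →
    k + (l + u + 2 * v) + (l + (k + u) + 2 * (k + v)) + 0 + (suc (2 * k) + a + 2 * c) ≡
    suc (a + 2 * c) + (l + (k + u) + 2 * (k + v)) + (k + (l + u + 2 * v) + 2 * k)
  regroup′ = solve-∀
  move : ∀ k l u v → k + (l + u + 2 * v) + suc (2 * k) + 0 ≡
         suc ((k + u) + 2 * (k + v)) + l
  move = solve-∀
  go : ∀ n → k + ΣF as n ≤ F (b + n)
  go 0 = p₀
  go 1 = p₁
  go 2 = p₂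
  go 3 = p₃
  go 4 = p₄
  go 5 = p₅
  go 6 = p₆
  go 7 = p₇
  go (suc (suc (suc (suc (suc (suc (suc (suc n)))))))) = begin
    k + ΣF as (8 + n)
      ≡⟨ cong (k +_) (ΣF-rec as n) ⟩
    k + (length as + ΣF as n + 2 * ΣF as (2 + n))
      -- The right side contains k three times and the left side once. The surplus 2k + 1 has to
      -- cover one unit per summand of `as`, which is what `short` provides.
      ≤⟨ linear 0 short (move k (length as) (ΣF as n) (ΣF as (2 + n))) ⟩
    suc ((k + ΣF as n) + 2 * (k + ΣF as (2 + n)))
      ≤⟨ s≤s (+-mono-≤ (go n) (*-monoʳ-≤ 2 (go (suc (suc n))))) ⟩
    suc (F (b + n) + 2 * F (b + (2 + n)))
      ≡⟨ cong (λ i → suc (F (b + n) + 2 * F i)) (shift₂ b n) ⟩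
    F (8 + (b + n))
      ≡⟨ cong F (shift₈ b n) ⟩
    F (b + (8 + n)) ∎
    where open ≤-Reasoning

F-check : ∀ as b k
  {short : True (length as ≤? suc (2 * k))}
  {base  : True (All.all? (λ n → k + ΣF as n ≤? F (b + n))
                          (0 ∷ 1 ∷ 2 ∷ 3 ∷ 4 ∷ 5 ∷ 6 ∷ 7 ∷ []))} →
  ∀ n → k + ΣF as n ≤ F (b + n)
F-check as b k {short} {base} = F-inequality as b k (toWitness short) (toWitness base)

-- The subscripts list the drops of the potentials of the children.

F₁ : ∀ n → 1 + (F n + 0) ≤ F (1 + n)
F₁ = F-check (0 ∷ []) 1 1

F₄₅ : ∀ n → 1 + (F (1 + n) + (F n + 0)) ≤ F (5 + n)
F₄₅ = F-check (1 ∷ 0 ∷ []) 5 1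

F₅₄ : ∀ n → 1 + (F n + (F (1 + n) + 0)) ≤ F (5 + n)
F₅₄ = F-check (0 ∷ 1 ∷ []) 5 1

F₇₆₇ : ∀ n → 1 + (F n + (F (1 + n) + (F n + 0))) ≤ F (7 + n)
F₇₆₇ = F-check (0 ∷ 1 ∷ 0 ∷ []) 7 1

F₆₇₇ : ∀ n → 1 + (F (1 + n) + (F n + (F n + 0))) ≤ F (7 + n)
F₆₇₇ = F-check (1 ∷ 0 ∷ 0 ∷ []) 7 1

-- An equality, namely the recurrence of `F`: these are the drops that fix the growth rate.
F₆₆₈ : ∀ n → 1 + (F (2 + n) + (F (2 + n) + (F n + 0))) ≤ F (8 + n)
F₆₆₈ = F-check (2 ∷ 2 ∷ 0 ∷ []) 8 1

F₆₈₆ : ∀ n → 1 + (F (2 + n) + (F n + (F (2 + n) + 0))) ≤ F (8 + n)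
F₆₈₆ = F-check (2 ∷ 0 ∷ 2 ∷ []) 8 1

F₆,₁₀,₅ : ∀ n → 1 + (F (4 + n) + (F n + (F (5 + n) + 0))) ≤ F (10 + n)
F₆,₁₀,₅ = F-check (4 ∷ 0 ∷ 5 ∷ []) 10 1

-- Of the two units one is the node and one a third child that is pruned at once.
F₆₄ : ∀ n → 2 + (F n + (F (2 + n) + 0)) ≤ F (6 + n)
F₆₄ = F-check (0 ∷ 2 ∷ []) 6 2

-- The subscripts are arguments here: raising the degree by one, that is Φ by two, pays for one more
-- child. It drives the inductions on the degree below. It is checked with one unit to spare, since
-- `F-check` admits two summands only for k ≥ 1.
F₇₉ : ∀ n → 0 + (F (7 + n) + (F n + 0)) ≤ F (9 + n)
F₇₉ n = ≤-trans (n≤1+n _) (F-check (7 ∷ 0 ∷ []) 9 1 n)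

F-mono : ∀ {m n} → m ≤ n → F m ≤ F n
F-mono {m} m≤n = go (≤⇒≤′ m≤n)
  where
  go : ∀ {n} → m ≤′ n → F m ≤ F n
  go ≤′-refl       = ≤-refl
  go (≤′-step {n} p) = ≤-trans (go p)
    (≤-trans (m≤n⇒m≤1+n (m≤m+n (F n) 0)) (F₁ n))

F≥ : ∀ n → suc n ≤ F n
F≥ zero    = s≤s z≤n
F≥ (suc n) = ≤-trans (s≤s (F≥ n)) (≤-trans (s≤s (m≤m+n (F n) 0)) (F₁ n))

F-multiple : ∀ d n → 1 + suc d * F n ≤ F (suc (2 * suc d) + n)
F-multiple 0 = F-check (0 ∷ []) 3 1
F-multiple 1 = F-check (0 ∷ 0 ∷ []) 5 1
F-multiple 2 = F-check (0 ∷ 0 ∷ 0 ∷ []) 7 1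
F-multiple (suc d@(suc (suc _))) n = begin
  1 + (F n + suc d * F n)        ≡⟨ swap (F n) (suc d * F n) ⟩
  (1 + suc d * F n) + F n        ≤⟨ +-mono-≤ (F-multiple d n) (F-mono (m≤n+m n k)) ⟩
  F (suc (2 * suc d) + n) + F (k + n)   ≡⟨ eq₁ ⟩
  F (7 + (k + n)) + (F (k + n) + 0) ≤⟨ F₇₉ (k + n) ⟩
  F (9 + (k + n))     ≡⟨ eq₂ ⟩
  F (suc (2 * suc (suc d)) + n) ∎
  where
  open ≤-Reasoning
  k = 2 * pred (pred d)
  swap : ∀ x y → 1 + (x + y) ≡ (1 + y) + x
  swap = solve-∀
  idx₁ : ∀ e n → suc (2 * suc (2 + e)) + n ≡ 7 + (2 * e + n)
  idx₁ = solve-∀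
  idx₂ : ∀ e n → 9 + (2 * e + n) ≡ suc (2 * suc (suc (2 + e))) + n
  idx₂ = solve-∀
  eq₁ = cong₂ _+_ (cong F (idx₁ (pred (pred d)) n)) (sym (+-identityʳ _))
  eq₂ = cong F (idx₂ (pred (pred d)) n)

-- For a pivot of C of degree d′ = 3 + d: the pivot and its first non-neighbour lose 2d′ + 2, the
-- remaining d′ - 1 non-neighbours one unit more, due to an exclusion before them.
F-branching : ∀ d n →
  1 + (F (1 + n) + (F (1 + n) + (2 + d) * F n)) ≤ F (2 * (3 + d) + 3 + n)
-- Four summands call for k = 2 in `F-check`; one unit is then given up.
F-branching 0 n = ≤-trans (n≤1+n _) (F-check (1 ∷ 1 ∷ 0 ∷ 0 ∷ []) 9 2 n)
F-branching (suc d) n = begin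
  1 + (x + (x + (F n + y)))      ≡⟨ swap x (F n) y ⟩
  1 + (x + (x + y)) + F n        ≤⟨ +-mono-≤ (F-branching d n) (F-mono (m≤n+m n k)) ⟩
  F (2 * (3 + d) + 3 + n) + F (k + n)   ≡⟨ eq₁ ⟩
  F (7 + (k + n)) + (F (k + n) + 0) ≤⟨ F₇₉ (k + n) ⟩
  F (9 + (k + n))     ≡⟨ eq₂ ⟩
  F (2 * (3 + suc d) + 3 + n) ∎
  where
  open ≤-Reasoning
  x = F (1 + n)
  y = (2 + d) * F n
  k = 2 * d + 2
  swap : ∀ x z y → 1 + (x + (x + (z + y))) ≡ 1 + (x + (x + y)) + z
  swap = solve-∀
  idx₁ : ∀ d n → 2 * (3 + d) + 3 + n ≡ 7 + (2 * d + 2 + n)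
  idx₁ = solve-∀
  idx₂ : ∀ d n → 9 + (2 * d + 2 + n) ≡ 2 * (3 + suc d) + 3 + n
  idx₂ = solve-∀
  eq₁ = cong₂ _+_ (cong F (idx₁ d n)) (sym (+-identityʳ _))
  eq₂ = cong F (idx₂ d n)

-- Comparing `F` with powers of rationals above α

fromℕ≃ : ∀ k → ℚ.toℚᵘ (fromℕ k) ℚᵘ.≃ ℚᵘ.mkℚᵘ (ℤ.+ k) 0
fromℕ≃ k = ℚ.toℚᵘ-fromℚᵘ (ℚᵘ.mkℚᵘ (ℤ.+ k) 0)

fromℕ-+ : ∀ m n → fromℕ (m + n) ≡ fromℕ m ℚ.+ fromℕ n
fromℕ-+ m n = ℚ.toℚᵘ-injective (begin-equality
  ℚ.toℚᵘ (fromℕ (m + n))                         ≃⟨ fromℕ≃ (m + n) ⟩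
  ℚᵘ.mkℚᵘ (ℤ.+ (m + n)) 0
    ≃⟨ ℚᵘ.*≡* (cong (ℤ._* ℤ.+ 1)
         (sym (cong₂ ℤ._+_ (ℤ.*-identityʳ (ℤ.+ m)) (ℤ.*-identityʳ (ℤ.+ n))))) ⟩
  ℚᵘ.mkℚᵘ (ℤ.+ m) 0 ℚᵘ.+ ℚᵘ.mkℚᵘ (ℤ.+ n) 0        ≃⟨ ℚᵘ.+-cong (fromℕ≃ m) (fromℕ≃ n) ⟨
  ℚ.toℚᵘ (fromℕ m) ℚᵘ.+ ℚ.toℚᵘ (fromℕ n)          ≃⟨ ℚ.toℚᵘ-homo-+ (fromℕ m) (fromℕ n) ⟨
  ℚ.toℚᵘ (fromℕ m ℚ.+ fromℕ n)                    ∎)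
  where open ℚᵘ.≤-Reasoning

fromℕ-* : ∀ m n → fromℕ (m * n) ≡ fromℕ m ℚ.* fromℕ n
fromℕ-* zero    n = sym (ℚ.*-zeroˡ (fromℕ n))
fromℕ-* (suc m) n = begin
  fromℕ (n + m * n)                ≡⟨ fromℕ-+ n (m * n) ⟩
  fromℕ n ℚ.+ fromℕ (m * n)        ≡⟨ cong₂ ℚ._+_ (sym (ℚ.*-identityˡ (fromℕ n))) (fromℕ-* m n) ⟩
  1ℚ ℚ.* fromℕ n ℚ.+ fromℕ m ℚ.* fromℕ n ≡⟨ ℚ.*-distribʳ-+ (fromℕ n) 1ℚ (fromℕ m) ⟨
  (1ℚ ℚ.+ fromℕ m) ℚ.* fromℕ n     ≡⟨ cong (ℚ._* fromℕ n) (fromℕ-+ 1 m) ⟨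
  fromℕ (suc m) ℚ.* fromℕ n        ∎
  where open ≡-Reasoning

fromℕ-mono : ∀ {m n} → m ≤ n → fromℕ m ℚ.≤ fromℕ n
fromℕ-mono {m} {n} m≤n = ℚ.toℚᵘ-cancel-≤ (begin
  ℚ.toℚᵘ (fromℕ m)  ≃⟨ fromℕ≃ m ⟩
  ℚᵘ.mkℚᵘ (ℤ.+ m) 0 ≤⟨ ℚᵘ.*≤* (ℤ.*-monoʳ-≤-nonNeg (ℤ.+ 1) (ℤ.+≤+ m≤n)) ⟩
  ℚᵘ.mkℚᵘ (ℤ.+ n) 0 ≃⟨ fromℕ≃ n ⟨
  ℚ.toℚᵘ (fromℕ n)  ∎)
  where open ℚᵘ.≤-Reasoning

fromℕ-nonNeg : ∀ n → ℚ.NonNegative (fromℕ n)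
fromℕ-nonNeg n = ℚ.nonNegative (fromℕ-mono {0} {n} z≤n)

-- The polynomial has the value -2 at 1, so it is not positive from any `q` up to 1 onwards.
α<⇒1≤ : ∀ {q} → α< q → 1ℚ ℚ.≤ q
α<⇒1≤ {q} (_ , above) with ℚ.≤-total 1ℚ q
... | inj₁ 1≤q = 1≤q
... | inj₂ q≤1 = contradiction (above 1ℚ q≤1) λ { (ℚ.*<* ()) }

α<⇒recurrence : ∀ {q} → α< q → fromℕ 2 ℚ.* q ℚ.+ 1ℚ ℚ.≤ q ^ 4
α<⇒recurrence {q} (_ , above) = begin
  fromℕ 2 ℚ.* q ℚ.+ 1ℚ ≡⟨ ℚ.+-identityʳ _ ⟨
  fromℕ 2 ℚ.* q ℚ.+ 1ℚ ℚ.+ 0ℚ ≤⟨ ℚ.+-monoʳ-≤ (fromℕ 2 ℚ.* q ℚ.+ 1ℚ) (ℚ.<⇒≤ (above q ℚ.≤-refl)) ⟩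
  fromℕ 2 ℚ.* q ℚ.+ 1ℚ ℚ.+ (q ^ 4 ℚ.- fromℕ 2 ℚ.* q ℚ.- 1ℚ) ≡⟨ cancel (fromℕ 2 ℚ.* q) 1ℚ (q ^ 4) ⟩
  q ^ 4 ∎
  where
  open ℚ.≤-Reasoning
  cancel : ∀ x y z → x ℚ.+ y ℚ.+ (z ℚ.- x ℚ.- y) ≡ z
  cancel = solve 3 (λ x y z → x :+ y :+ (z :- x :- y) := z) refl
    where open ℚ-Solver.+-*-Solver

module _ {q : ℚ} (α<q : α< q) (C : ℕ) (C≥ : suc (F 6) ≤ C) where

  private instance
    q-nonNeg : ℚ.NonNegative q
    q-nonNeg = ℚ.nonNegative (ℚ.<⇒≤ (proj₁ α<q))

  1≤^ : ∀ k → 1ℚ ℚ.≤ q ^ k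
  1≤^ zero    = ℚ.≤-refl
  1≤^ (suc k) = begin
    1ℚ         ≤⟨ α<⇒1≤ α<q ⟩
    q          ≡⟨ ℚ.*-identityʳ q ⟨
    q ℚ.* 1ℚ   ≤⟨ ℚ.*-monoˡ-≤-nonNeg q (1≤^ k) ⟩
    q ℚ.* q ^ k ∎
    where open ℚ.≤-Reasoning

  -- The successor swallows the constant of the recurrence: g k = F (2k) + 1 satisfies g (4 + k) ≤ g
  -- k + 2 g (1 + k), while powers of `q` obey the reverse inequality because q⁴ ≥ 2q + 1.
  F-growth : ∀ k → fromℕ (suc (F (2 * k))) ℚ.≤ fromℕ C ℚ.* q ^ k
  F-growth k with k <? 4
  ... | yes k<4 = begin
    -- For k ≤ 3 the argument of `F` is at most 6, so `C` alone is large enough.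
    fromℕ (suc (F (2 * k)))  ≤⟨ fromℕ-mono (≤-trans (s≤s (F-mono (*-monoʳ-≤ 2 (s≤s⁻¹ k<4)))) C≥) ⟩
    c                        ≡⟨ ℚ.*-identityʳ c ⟨
    c ℚ.* 1ℚ                 ≤⟨ ℚ.*-monoˡ-≤-nonNeg c {{fromℕ-nonNeg C}} (1≤^ k) ⟩
    c ℚ.* q ^ k              ∎
    where
    open ℚ.≤-Reasoning
    c = fromℕ C
  F-growth 0 | no 4≤k = contradiction (s≤s z≤n) 4≤k
  F-growth 1 | no 4≤k = contradiction (s≤s (s≤s z≤n)) 4≤k
  F-growth 2 | no 4≤k = contradiction (s≤s (s≤s (s≤s z≤n))) 4≤k
  F-growth 3 | no 4≤k = contradiction (s≤s (s≤s (s≤s (s≤s z≤n)))) 4≤k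
  F-growth (suc (suc (suc (suc k)))) | no _ = begin
    fromℕ (suc (F (2 * (4 + k))))
      ≤⟨ fromℕ-mono (≤-trans (≤-reflexive (cong (λ i → suc (F i)) (double k)))
           (linear 1 (≤-refl {0}) (regroup (F (2 * k)) (F (2 + 2 * k))))) ⟩
    fromℕ (suc (F (2 * k)) + 2 * suc (F (2 + 2 * k)))
      ≡⟨ trans (fromℕ-+ (suc (F (2 * k))) _)
           (cong (fromℕ (suc (F (2 * k))) ℚ.+_) (fromℕ-* 2 (suc (F (2 + 2 * k))))) ⟩
    fromℕ (suc (F (2 * k))) ℚ.+ fromℕ 2 ℚ.* fromℕ (suc (F (2 + 2 * k)))
      ≡⟨ cong (λ i → fromℕ (suc (F (2 * k))) ℚ.+ fromℕ 2 ℚ.* fromℕ (suc (F i))) (double₁ k) ⟩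
    fromℕ (suc (F (2 * k))) ℚ.+ fromℕ 2 ℚ.* fromℕ (suc (F (2 * suc k)))
      ≤⟨ ℚ.+-mono-≤ (F-growth k)
           (ℚ.*-monoˡ-≤-nonNeg (fromℕ 2) {{fromℕ-nonNeg 2}} (F-growth (suc k))) ⟩
    c ℚ.* q ^ k ℚ.+ fromℕ 2 ℚ.* (c ℚ.* (q ℚ.* q ^ k))
      ≡⟨ factor c (fromℕ 2) q (q ^ k) ⟩
    c ℚ.* (q ^ k ℚ.* (fromℕ 2 ℚ.* q ℚ.+ 1ℚ))
      ≤⟨ ℚ.*-monoˡ-≤-nonNeg c {{fromℕ-nonNeg C}}
           (ℚ.*-monoˡ-≤-nonNeg (q ^ k) {{ℚ.nonNegative (ℚ.≤-trans (ℚ.nonNegative⁻¹ 1ℚ) (1≤^ k))}}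
             (α<⇒recurrence α<q)) ⟩
    c ℚ.* (q ^ k ℚ.* q ^ 4)
      ≡⟨ collect c q (q ^ k) ⟩
    c ℚ.* q ^ (4 + k) ∎
    where
    open ℚ.≤-Reasoning
    c = fromℕ C
    double : ∀ k → 2 * (4 + k) ≡ 8 + 2 * k
    double = solve-∀
    double₁ : ∀ k → 2 + 2 * k ≡ 2 * suc k
    double₁ = solve-∀
    regroup : ∀ x y → suc (suc (x + 2 * y)) + 0 + 1 ≡ suc x + 2 * suc y + 0
    regroup = solve-∀
    open ℚ-Solver.+-*-Solver
    factor : ∀ c t q r → c ℚ.* r ℚ.+ t ℚ.* (c ℚ.* (q ℚ.* r)) ≡ c ℚ.* (r ℚ.* (t ℚ.* q ℚ.+ 1ℚ))
    factor = solve 4 (λ c t q r → c :* r :+ t :* (c :* (q :* r)) :=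
                                  c :* (r :* (t :* q :+ con 1ℚ))) refl
    collect : ∀ c q r → c ℚ.* (r ℚ.* q ^ 4) ≡ c ℚ.* (q ℚ.* (q ℚ.* (q ℚ.* (q ℚ.* r))))
    collect = solve 3 (λ c q r → c :* (r :* (q :* (q :* (q :* (q :* con 1ℚ))))) :=
                                 c :* (q :* (q :* (q :* (q :* r))))) refl

-- Filtered lists

module _ {A : Set} where

  ∈-filterᵇ⁺ : (p : A → Bool) → ∀ {x xs} → x ∈ xs → T (p x) → x ∈ filterᵇ p xs
  ∈-filterᵇ⁺ p = ∈-filter⁺ (T? ∘ p)

  ∈-filterᵇ⁻ : (p : A → Bool) → ∀ {x xs} → x ∈ filterᵇ p xs → x ∈ xs × T (p x)
  ∈-filterᵇ⁻ p = ∈-filter⁻ (T? ∘ p)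

  length-filterᵇ-split : ∀ (p : A → Bool) xs →
    length (filterᵇ p xs) + length (filterᵇ (not ∘ p) xs) ≡ length xs
  length-filterᵇ-split p [] = refl
  length-filterᵇ-split p (x ∷ xs) with p x
  ... | true  = cong suc (length-filterᵇ-split p xs)
  ... | false = trans (+-suc _ _) (cong suc (length-filterᵇ-split p xs))

  filterᵇ-comm : ∀ (p q : A → Bool) xs →
    filterᵇ p (filterᵇ q xs) ≡ filterᵇ q (filterᵇ p xs)
  filterᵇ-comm p q [] = refl
  filterᵇ-comm p q (x ∷ xs) with p x in px | q x in qx
  ... | true  | true  rewrite px | qx = cong (x ∷_) (filterᵇ-comm p q xs)
  ... | true  | false rewrite qx = filterᵇ-comm p q xs
  ... | false | true  rewrite px = filterᵇ-comm p q xs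
  ... | false | false = filterᵇ-comm p q xs

  length-filterᵇ≤ : ∀ (p : A → Bool) xs → length (filterᵇ p xs) ≤ length xs
  length-filterᵇ≤ p = length-filter (T? ∘ p)

  length-filterᵇ< : ∀ (p : A → Bool) {x xs} → x ∈ xs → ¬ T (p x) →
    length (filterᵇ p xs) < length xs
  length-filterᵇ< p x∈xs ¬px = filter-notAll (T? ∘ p) _ (lose x∈xs ¬px)

  -- For degrees: `p` selects the non-neighbours of a vertex and `q` the candidates that survive in
  -- a child. The strict version below is for a child that loses one of these non-neighbours.
  length-filterᵇ²≤ : ∀ (p q : A → Bool) xs →
    length (filterᵇ p (filterᵇ q xs)) ≤ length (filterᵇ p xs)
  length-filterᵇ²≤ p q xs rewrite filterᵇ-comm p q xs = length-filterᵇ≤ q (filterᵇ p xs)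

  length-filterᵇ²< : ∀ (p q : A → Bool) {x xs} → x ∈ xs → T (p x) → ¬ T (q x) →
    length (filterᵇ p (filterᵇ q xs)) < length (filterᵇ p xs)
  length-filterᵇ²< p q {x} {xs} x∈xs px ¬qx rewrite filterᵇ-comm p q xs =
    length-filterᵇ< q (∈-filterᵇ⁺ p x∈xs px) ¬qx

not⁻ : ∀ b → T (not b) → ¬ T b
not⁻ false _ ()

not⁺ : ∀ b → ¬ T b → T (not b)
not⁺ false _  = _
not⁺ true  ¬t = contradiction _ ¬t

module _ {n : ℕ} where

  other : Fin n → Fin n → Bool
  other v u = not (does (u Fin.≟ v))

  remove : Fin n → List (Fin n) → List (Fin n)
  remove v = filterᵇ (other v)

  other⁺ : ∀ {v u} → u ≢ v → T (other v u)
  other⁺ {v} {u} u≢v with u Fin.≟ v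
  ... | yes u≡v = contradiction u≡v u≢v
  ... | no  _   = _

  other⁻ : ∀ {v u} → T (other v u) → u ≢ v
  other⁻ {v} {u} t with u Fin.≟ v
  other⁻ () | yes _
  other⁻ t | no u≢v = u≢v

  ¬other : ∀ v → ¬ T (other v v)
  ¬other v t = other⁻ {v} t refl

  ∈-remove⁺ : ∀ {v u us} → u ∈ us → u ≢ v → u ∈ remove v us
  ∈-remove⁺ u∈us u≢v = ∈-filterᵇ⁺ (other _) u∈us (other⁺ u≢v)

  ∈-remove⁻ : ∀ {v u us} → u ∈ remove v us → u ∈ us × u ≢ v
  ∈-remove⁻ u∈ with u∈us , t ← ∈-filterᵇ⁻ (other _) u∈ = u∈us , other⁻ t

  length-remove : ∀ {v us} → v ∈ us → suc (length (remove v us)) ≤ length us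
  length-remove {v} v∈us = length-filterᵇ< (other v) v∈us (¬other v)

  length≤remove : ∀ v {us} → Unique us → length us ≤ suc (length (remove v us))
  length≤remove v [] = z≤n
  length≤remove v {u ∷ us} (u∉us ∷ us!) with u Fin.≟ v
  ... | yes refl = s≤s (≤-reflexive (cong length (sym
        (filter-all (T? ∘ other v) (All.map (λ v≢w → other⁺ (v≢w ∘ sym)) u∉us)))))
  ... | no _     = s≤s (length≤remove v us!)

  -- Removing one candidate lowers a degree by at most one, as candidate lists have no repetitions.
  length-filterᵇ≤remove : ∀ (p : Fin n → Bool) v {us} → Unique us →
    length (filterᵇ p us) ≤ suc (length (filterᵇ p (remove v us)))
  length-filterᵇ≤remove p v {us} us! rewrite filterᵇ-comm p (other v) us =
    length≤remove v (Unique.filter⁺ (T? ∘ p) us!)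

-- The branching analysis

-- C and X of a branch, with the two sides A and B interchangeable.
record State (a b : ℕ) : Set where
  constructor state
  field
    CA : List (Fin a)
    CB : List (Fin b)
    XA : List (Fin a)
    XB : List (Fin b)

open State

module _ {a b : ℕ} where

  swap : State a b → State b a
  swap st = state (CB st) (CA st) (XB st) (XA st)

  Φ : State a b → ℕ
  Φ st = 2 * (length (CA st) + length (CB st)) + (length (XA st) + length (XB st))

Φ-swap : ∀ {a b} (st : State a b) → Φ (swap st) ≡ Φ st
Φ-swap st = cong₂ (λ i j → 2 * i + j) (+-comm (length (CB st)) _) (+-comm (length (XB st)) _)

Adjacency : ℕ → ℕ → Set
Adjacency a b = Fin a → Fin b → Bool

module _ {a b : ℕ} (adj : Adjacency a b) where

  non : Fin a → List (Fin b) → List (Fin b)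
  non v = filterᵇ (not ∘ adj v)

  -- The superscript ᵒ below marks the versions for vertices of side B.
  degC degX : Fin a → State a b → ℕ
  degC v st = length (non v (CB st))
  degX v st = length (non v (XB st))

  takeA : Fin a → State a b → State a b
  takeA v st = state (remove v (CA st)) (filterᵇ (adj v) (CB st))
                     (XA st) (filterᵇ (adj v) (XB st))

  excludeA : Fin a → State a b → State a b
  excludeA v st = state (remove v (CA st)) (CB st) (v ∷ XA st) (XB st)

module _ {a b : ℕ} (adj : Adjacency a b) where

  takeB excludeB : Fin b → State a b → State a b
  takeB w st = swap (takeA (flip adj) w (swap st))
  excludeB w st = swap (excludeA (flip adj) w (swap st))

  degCᵒ degXᵒ : Fin b → State a b → ℕ
  degCᵒ w st = degC (flip adj) w (swap st)
  degXᵒ w st = degX (flip adj) w (swap st)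

  -- Bonus st e: a vertex of X has degree at most 3 − e, which is worth e units
  -- of potential.
  data Bonus (st : State a b) : ℕ → Set where
    none : Bonus st 0
    onA  : ∀ {e x} → x ∈ XA st → e + degC adj x st ≤ 3 → Bonus st e
    onB  : ∀ {e x} → x ∈ XB st → e + degCᵒ x st ≤ 3 → Bonus st e

  -- An upper bound for the size of the search tree below a state. In the dead cases a vertex of X
  -- has no non-neighbour in C, so rule (P2) stops the branch at its first node.
  data Budget (st : State a b) : ℕ → Set where
    fits  : ∀ {e n} → Bonus st e → Φ st ≤ e + n → Budget st (F n)
    deadA : ∀ {x} → x ∈ XA st → degC adj x st ≤ 0 → Budget st 1
    deadB : ∀ {x} → x ∈ XB st → degCᵒ x st ≤ 0 → Budget st 1

  -- The branching vertices are taken one after the other: those already done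
  -- have moved to X.
  data BudgetsB (st : State a b) : List (Fin b) → ℕ → Set where
    []  : BudgetsB st [] 0
    _∷_ : ∀ {w ws k t} → w ∈ CB st × Budget (takeB w st) k → BudgetsB (excludeB w st) ws t →
          BudgetsB st (w ∷ ws) (k + t)

-- `w` is the actual loss of a child, `c` the loss on which the chosen inequality for `F` counts,
-- and `k` the argument of `F` left for the child, possibly including a bonus.
fit-within : ∀ c {φ w P k} → φ + w ≤ P → P ≤ c + k → c ≤ w → φ ≤ k
fit-within c {φ} {w} {P} {k} drop P≤ c≤w = +-cancelˡ-≤ c φ k (begin
  c + φ ≡⟨ +-comm c φ ⟩
  φ + c ≤⟨ +-monoʳ-≤ φ c≤w ⟩
  φ + w ≤⟨ drop ⟩
  P     ≤⟨ P≤ ⟩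
  c + k ∎)
  where open ≤-Reasoning

module _ {a b : ℕ} (adj : Adjacency a b) where

  -- The vertex itself and each of its non-neighbours in C weigh 2, each non-neighbour in X weighs
  -- 1, and all of them leave.
  Φ-takeA : ∀ {v st} → v ∈ CA st →
    Φ (takeA adj v st) + (2 + 2 * degC adj v st + degX adj v st) ≤ Φ st
  Φ-takeA {v} {st} v∈ = linear 0 (*-monoʳ-≤ 2 (length-remove v∈))
    (subst₂ (λ cb xb → 2 * (r + ka) + (xa + kb) + (2 + 2 * d + e) + 2 * ca + 0
                       ≡ 2 * (ca + cb) + (xa + xb) + 2 * suc r)
      (length-filterᵇ-split (adj v) (CB st)) (length-filterᵇ-split (adj v) (XB st))
      (regroup r ka xa kb d e ca))
    where
    r = length (remove v (CA st))
    ca = length (CA st)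
    xa = length (XA st)
    ka = length (filterᵇ (adj v) (CB st))
    kb = length (filterᵇ (adj v) (XB st))
    d = degC adj v st
    e = degX adj v st
    regroup : ∀ r ka xa kb d e ca →
      2 * (r + ka) + (xa + kb) + (2 + 2 * d + e) + 2 * ca + 0
      ≡ 2 * (ca + (ka + d)) + (xa + (kb + e)) + 2 * suc r
    regroup = solve-∀

  Φ-excludeA : ∀ {v st} → v ∈ CA st → suc (Φ (excludeA adj v st)) ≤ Φ st
  Φ-excludeA {v} {st} v∈ = linear 0 (*-monoʳ-≤ 2 (length-remove v∈))
    (regroup (length (remove v (CA st))) (length (CB st)) (length (XA st)) (length (XB st))
             (length (CA st)))
    where
    regroup : ∀ r cb xa xb ca → suc (2 * (r + cb) + (suc xa + xb)) + 2 * ca + 0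
      ≡ 2 * (ca + cb) + (xa + xb) + 2 * suc r
    regroup = solve-∀

module _ {a b : ℕ} (adj : Adjacency a b) where

  Φ-takeB : ∀ {w st} → w ∈ CB st →
    Φ (takeB adj w st) + (2 + 2 * degCᵒ adj w st + degXᵒ adj w st) ≤ Φ st
  Φ-takeB {w} {st} w∈ = subst₂ (λ i j → i + (2 + 2 * degCᵒ adj w st + degXᵒ adj w st) ≤ j)
    (sym (Φ-swap (takeA (flip adj) w (swap st)))) (Φ-swap st) (Φ-takeA (flip adj) {w} {swap st} w∈)

  Φ-excludeB : ∀ {w st} → w ∈ CB st → suc (Φ (excludeB adj w st)) ≤ Φ st
  Φ-excludeB {w} {st} w∈ = subst₂ (λ i j → suc i ≤ j)
    (sym (Φ-swap (excludeA (flip adj) w (swap st)))) (Φ-swap st) (Φ-excludeA (flip adj) {w} {swap st} w∈)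

  -- Excluding a vertex of side B changes neither `CA` nor `XA`, on which the losses of the later
  -- vertices depend, so the assumption on the losses persists. The unit of potential gained by each
  -- exclusion is given away.
  uniform : ∀ c {n} ws {st} → Unique ws → All (_∈ CB st) ws →
    All (λ w → c ≤ 2 + 2 * degCᵒ adj w st + degXᵒ adj w st) ws →
    Φ st ≤ c + n → BudgetsB adj st ws (length ws * F n)
  uniform c []       _           _           _          _  = []
  uniform c (w ∷ ws) {st} (w∉ws ∷ ws!) (w∈ ∷ ws∈) (c≤w ∷ c≤ws) Φ≤ =
    (w∈ , fits none (fit-within c (Φ-takeB {w} {st} w∈) Φ≤ c≤w)) ∷
    uniform c ws ws!
      (All.zipWith (λ (w≢u , u∈) → ∈-remove⁺ u∈ (w≢u ∘ sym)) (w∉ws , ws∈))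
      c≤ws (≤-trans (<⇒≤ (Φ-excludeB {w} {st} w∈)) Φ≤)

  module _ {v : Fin a} {st : State a b} {ws : List (Fin b)}
           (ws↭ : ws ↭ non adj v (CB st)) (CB! : Unique (CB st)) where

    order-unique : Unique ws
    order-unique = ↭ₛ.Unique-resp-↭ (setoid (Fin b)) (↭⇒↭ₛ (↭-sym ws↭))
      (Unique.filter⁺ (T? ∘ not ∘ adj v) CB!)

    in-order : ∀ {w} → w ∈ ws → w ∈ CB st × T (not (adj v w))
    in-order w∈ = ∈-filterᵇ⁻ (not ∘ adj v) (↭.∈-resp-↭ ws↭ w∈)

    order-⊆ : All (_∈ CB st) ws
    order-⊆ = All.tabulate (proj₁ ∘ in-order)

  degXᵒ-positive : ∀ {v w st} → v ∈ XA st → T (not (adj v w)) → 1 ≤ degXᵒ adj w st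
  degXᵒ-positive {w = w} v∈ ¬vw = ∈-length (∈-filterᵇ⁺ (λ u → not (adj u w)) v∈ ¬vw)

  X-pivot : ∀ {v st ws e m} → v ∈ XA st → 1 ≤ degC adj v st →
    (∀ {x} → x ∈ XA st → degC adj v st ≤ degC adj x st) →
    (∀ {x} → x ∈ XB st → degC adj v st ≤ degCᵒ adj x st) →
    (∀ {w} → w ∈ CB st → T (not (adj v w)) → degC adj v st ≤ degCᵒ adj w st) →
    ws ↭ non adj v (CB st) → Unique (CB st) →
    Bonus adj st e → Φ st ≤ e + m →
    ∃ λ t → BudgetsB adj st ws t × 1 + t ≤ F m
  X-pivot {v} {st} {[]} v∈ 1≤d minA minB minC ws↭ CB! bonus Φ≤ =
    contradiction (≤-trans 1≤d (≤-reflexive (sym (↭.↭-length ws↭)))) λ ()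
  X-pivot {v} {st} {ws@(w ∷ ws₀)} {e} {m} v∈ 1≤d minA minB minC ws↭ CB! bonus Φ≤ =
    go (m≤n⇒∃[o]m+o≡n c≤m)
    where
    d = length ws
    d≡ : d ≡ degC adj v st
    d≡ = ↭.↭-length ws↭
    heavy : ∀ {w} → w ∈ ws → 3 + 2 * d ≤ 2 + 2 * degCᵒ adj w st + degXᵒ adj w st
    heavy {w} w∈ with w∈C , ¬vw ← in-order {st = st} ws↭ CB! w∈ = begin
      3 + 2 * d     ≡⟨ cong suc (cong (2 +_) (cong (2 *_) d≡)) ⟩
      3 + 2 * degC adj v st     ≡⟨ +-comm 1 _ ⟩
      2 + 2 * degC adj v st + 1 ≤⟨ +-mono-≤ (+-monoʳ-≤ 2 (*-monoʳ-≤ 2 (minC w∈C ¬vw)))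
                                            (degXᵒ-positive {st = st} v∈ ¬vw) ⟩
      2 + 2 * degCᵒ adj w st + degXᵒ adj w st ∎
      where open ≤-Reasoning
    e≤2 : ∀ {e} → Bonus adj st e → e ≤ 2
    e≤2 none = z≤n
    e≤2 (onA x∈ h) = +-cancelʳ-≤ 1 _ 2 (≤-trans (+-monoʳ-≤ _ (≤-trans 1≤d (minA x∈))) h)
    e≤2 (onB x∈ h) = +-cancelʳ-≤ 1 _ 2 (≤-trans (+-monoʳ-≤ _ (≤-trans 1≤d (minB x∈))) h)
    Φ≤2+m : Φ st ≤ 2 + m
    Φ≤2+m = ≤-trans Φ≤ (+-monoˡ-≤ m (e≤2 bonus))
    c≤m : suc (2 * d) ≤ m
    c≤m = +-cancelˡ-≤ 2 _ _ (begin
      3 + 2 * d ≤⟨ heavy (here refl) ⟩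
      2 + 2 * degCᵒ adj w st + degXᵒ adj w st ≤⟨ m≤n+m _ _ ⟩
      _ ≤⟨ Φ-takeB {w} {st} (All.head (order-⊆ {st = st} ws↭ CB!)) ⟩
      Φ st ≤⟨ Φ≤2+m ⟩
      2 + m ∎)
      where open ≤-Reasoning
    go : (∃ λ n → suc (2 * d) + n ≡ m) → ∃ λ t → BudgetsB adj st ws t × 1 + t ≤ F m
    go (n , refl) = d * F n ,
      uniform (3 + 2 * d) ws (order-unique {st = st} ws↭ CB!) (order-⊆ {st = st} ws↭ CB!)
        (All.tabulate heavy) Φ≤2+m ,
      F-multiple (length ws₀) n

  -- For v ∈ C, Deviant means v ∉ C′, and NearDeviant is condition (C2).

  Deviantᵒ : State a b → Fin b → Set
  Deviantᵒ st w = 1 ≤ degXᵒ adj w st ⊎ 3 ≤ degCᵒ adj w st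

  Deviant : State a b → Fin a → Set
  Deviant st v = 1 ≤ degX adj v st ⊎ 3 ≤ degC adj v st

  NearDeviant : State a b → Fin a → Set
  NearDeviant st v = degX adj v st ≤ 0 × degC adj v st ≤ 2 ×
    ∃ λ w → w ∈ CB st × T (not (adj v w)) × Deviantᵒ st w

  -- `minA` and `minB` are strict because a tie would be won by the vertex of X. `minC` covers the
  -- non-neighbours known to be candidates: those outside C′, and all of them if `v` is outside C′.
  module _ {v : Fin a} {st : State a b} {m : ℕ} (v∈ : v ∈ CA st)
    (CA! : Unique (CA st)) (CB! : Unique (CB st))
    (minA : ∀ {x} → x ∈ XA st → degC adj v st < degC adj x st)
    (minB : ∀ {x} → x ∈ XB st → degC adj v st < degCᵒ adj x st)
    (kind : Deviant st v ⊎ NearDeviant st v)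
    (minC : ∀ {w} → w ∈ CB st → T (not (adj v w)) → Deviant st v ⊎ Deviantᵒ st w →
            degC adj v st ≤ degCᵒ adj w st)
    where

    private
      d = degC adj v st
      st₁ = excludeA adj v st

      gainᵛ : ℕ
      gainᵛ = 2 + 2 * d + degX adj v st

      gain : Fin b → ℕ
      gain w = 2 + 2 * degCᵒ adj w st + degXᵒ adj w st

      Φ-v : Φ (takeA adj v st) + gainᵛ ≤ Φ st
      Φ-v = Φ-takeA adj {v} {st} v∈

      -- Excluding `v` takes a non-neighbour of `w` from C, worth 2, and puts it into X, worth 1.
      gain≤ : ∀ {w} → T (not (adj v w)) →
        gain w ≤ suc (2 + 2 * degCᵒ adj w st₁ + degXᵒ adj w st₁)
      gain≤ {w} ¬vw = begin
        2 + 2 * degCᵒ adj w st + degXᵒ adj w st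
          ≤⟨ +-monoˡ-≤ _ (+-monoʳ-≤ 2 (*-monoʳ-≤ 2
               (length-filterᵇ≤remove (λ u → not (adj u w)) v CA!))) ⟩
        2 + 2 * suc (degCᵒ adj w st₁) + degXᵒ adj w st
          ≡⟨ regroup (degCᵒ adj w st₁) (degXᵒ adj w st) ⟩
        3 + 2 * degCᵒ adj w st₁ + suc (degXᵒ adj w st)
          ≡⟨ cong (λ xs → 3 + 2 * degCᵒ adj w st₁ + length xs)
               (filter-accept (λ u → T? (not (adj u w))) ¬vw) ⟨
        3 + 2 * degCᵒ adj w st₁ + degXᵒ adj w st₁ ∎
        where
        open ≤-Reasoning
        regroup : ∀ x y → 2 + 2 * suc x + y ≡ 3 + 2 * x + suc y
        regroup = solve-∀

      Φ-next : ∀ {w st′} → Φ (takeB adj w st′) + (2 + 2 * degCᵒ adj w st₁ + degXᵒ adj w st₁) ≤ Φ st′ →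
        suc (Φ st′) ≤ Φ st → T (not (adj v w)) → Φ (takeB adj w st′) + gain w ≤ Φ st
      Φ-next {w} {st′} drop st′< ¬vw = begin
        Φ (takeB adj w st′) + gain w
          ≤⟨ +-monoʳ-≤ (Φ (takeB adj w st′)) (gain≤ ¬vw) ⟩
        Φ (takeB adj w st′) + suc (2 + 2 * degCᵒ adj w st₁ + degXᵒ adj w st₁)
          ≡⟨ +-suc (Φ (takeB adj w st′)) _ ⟩
        suc (Φ (takeB adj w st′) + (2 + 2 * degCᵒ adj w st₁ + degXᵒ adj w st₁))
          ≤⟨ s≤s drop ⟩
        suc (Φ st′) ≤⟨ st′< ⟩
        Φ st ∎
        where open ≤-Reasoning

      -- The unit by which the exclusion of `v` lowers the loss of `w` is regained from the
      -- potential, so measured from `st` the full `gain w` remains.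
      Φ-w : ∀ {w} → w ∈ CB st → T (not (adj v w)) → Φ (takeB adj w st₁) + gain w ≤ Φ st
      Φ-w {w} w∈ ¬vw = Φ-next {w} {st₁} (Φ-takeB {w} {st₁} w∈) (Φ-excludeA adj {v} {st} v∈) ¬vw

      -- `w` lies on the side of `u`, so excluding it does not affect the degree of `u`: its unit of
      -- potential is a net profit.
      Φ-w₂ : ∀ {w u} → w ∈ CB st → u ∈ CB st → u ≢ w → T (not (adj v w)) → T (not (adj v u)) →
        Φ (takeB adj u (excludeB adj w st₁)) + suc (gain u) ≤ Φ st
      Φ-w₂ {w} {u} w∈ u∈ u≢w ¬vw ¬vu = begin
        Φ (takeB adj u st₂) + suc (gain u)
          ≤⟨ +-monoʳ-≤ (Φ (takeB adj u st₂)) (s≤s (gain≤ ¬vu)) ⟩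
        Φ (takeB adj u st₂) + suc (suc g)
          ≡⟨ trans (+-suc (Φ (takeB adj u st₂)) _) (cong suc (+-suc (Φ (takeB adj u st₂)) _)) ⟩
        suc (suc (Φ (takeB adj u st₂) + g))
          ≤⟨ s≤s (s≤s (Φ-takeB {u} {st₂} (∈-remove⁺ u∈ u≢w))) ⟩
        suc (suc (Φ st₂)) ≤⟨ s≤s (Φ-excludeB {w} {st₁} w∈) ⟩
        suc (Φ st₁) ≤⟨ Φ-excludeA adj {v} {st} v∈ ⟩
        Φ st ∎
        where
        open ≤-Reasoning
        st₂ = excludeB adj w st₁
        g = 2 + 2 * degCᵒ adj u st₁ + degXᵒ adj u st₁

      degCᵒ≥1 : ∀ {w} → T (not (adj v w)) → 1 ≤ degCᵒ adj w st
      degCᵒ≥1 {w} ¬vw = ∈-length (∈-filterᵇ⁺ (λ u → not (adj u w)) v∈ ¬vw)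

      gain≥ : ∀ w {p q} → p ≤ degCᵒ adj w st → q ≤ degXᵒ adj w st → 2 + 2 * p + q ≤ gain w
      gain≥ w p≤ q≤ = +-mono-≤ (+-monoʳ-≤ 2 (*-monoʳ-≤ 2 p≤)) q≤

      gainᵛ≥ : ∀ {p q} → p ≤ d → q ≤ degX adj v st → 2 + 2 * p + q ≤ gainᵛ
      gainᵛ≥ p≤ q≤ = +-mono-≤ (+-monoʳ-≤ 2 (*-monoʳ-≤ 2 p≤)) q≤

      -- Either a non-neighbour in X adds one, or degree 3 yields 8, which exceeds 3 + 2p for p ≤ 2.
      deviant-gain : ∀ w p → p ≤ 2 → p ≤ degCᵒ adj w st → Deviantᵒ st w → 3 + 2 * p ≤ gain w
      deviant-gain w p p≤2 p≤ (inj₁ q≥1) =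
        ≤-trans (≤-reflexive (+-comm 1 (2 + 2 * p))) (gain≥ w p≤ q≥1)
      deviant-gain w p p≤2 p≤ (inj₂ deg≥3) =
        ≤-trans (≤-trans (+-monoʳ-≤ 3 (*-monoʳ-≤ 2 p≤2)) (n≤1+n 7)) (gain≥ w deg≥3 z≤n)

      OutcomeAt : List (Fin b) → ℕ → Set
      OutcomeAt ws m = ∃₂ λ k t → Budget adj (takeA adj v st) k × BudgetsB adj st₁ ws t ×
                                  1 + (k + t) ≤ F m

      Outcome : List (Fin b) → Set
      Outcome ws = OutcomeAt ws m

      -- A child of potential φ ≥ 0 leaves room for its gain below m.
      enough : ∀ c {φ g ws} → φ + g ≤ Φ st → c ≤ g → Φ st ≤ m →
        (∀ n → Φ st ≤ c + n → OutcomeAt ws (c + n)) → Outcome ws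
      enough c {φ} {g} {ws} drop c≤g Φ≤ build = subst (OutcomeAt ws) c+n≡m
        (build n (≤-trans Φ≤ (≤-reflexive (sym c+n≡m))))
        where
        room : ∃ λ n → c + n ≡ m
        room = m≤n⇒∃[o]m+o≡n (≤-trans c≤g (≤-trans (m≤n+m g φ) (≤-trans drop Φ≤)))
        n = proj₁ room
        c+n≡m = proj₂ room

      -- The vertex carrying a bonus has degree at least d + 1; `none` has no carrier and leaves d
      -- unrestricted.
      bonus-limit : ∀ {e} → Bonus adj st e → e ≡ 0 ⊎ e + suc d ≤ 3
      bonus-limit none = inj₁ refl
      bonus-limit (onA x∈ h) = inj₂ (≤-trans (+-monoʳ-≤ _ (minA x∈)) h)
      bonus-limit (onB x∈ h) = inj₂ (≤-trans (+-monoʳ-≤ _ (minB x∈)) h)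

      bonus≤2 : ∀ {e} → Bonus adj st e → e ≤ 2
      bonus≤2 bonus with bonus-limit bonus
      ... | inj₁ refl = z≤n
      ... | inj₂ h    = +-cancelʳ-≤ 1 _ 2 (≤-trans (+-monoʳ-≤ _ (s≤s z≤n)) h)

      no-bonus : ∀ {e} → Bonus adj st e → 2 ≤ d → Φ st ≤ e + m → Φ st ≤ m
      no-bonus bonus 2≤d Φ≤ with bonus-limit bonus
      ... | inj₁ refl = Φ≤
      no-bonus {e} bonus 2≤d Φ≤ | inj₂ h
        with n≤0⇒n≡0 {e} (+-cancelʳ-≤ 3 e 0 (≤-trans (+-monoʳ-≤ e (s≤s 2≤d)) h))
      ... | refl = Φ≤

      -- In the names of the following cases, w and u are the non-neighbours of the
      -- pivot v in their branching order.

      -- Without non-neighbours in C the pivot is a candidate only through a non-neighbour in X. Its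
      -- single child loses at least 3: at most two units go to the bonus, one to the node.
      isolated-pivot : ∀ {e} → Bonus adj st e → Φ st ≤ e + m → d ≡ 0 → Outcome []
      isolated-pivot bonus Φ≤ d≡0 = go kind
        where
        Φ≤2+m : Φ st ≤ 2 + m
        Φ≤2+m = ≤-trans Φ≤ (+-monoˡ-≤ m (bonus≤2 bonus))
        go : Deviant st v ⊎ NearDeviant st v → Outcome []
        go (inj₁ (inj₂ d≥3)) = contradiction (≤-trans d≥3 (≤-reflexive d≡0)) λ ()
        go (inj₂ (_ , _ , w , w∈ , ¬vw , _)) = contradiction
          (≤-trans (∈-length (∈-filterᵇ⁺ (not ∘ adj v) w∈ ¬vw)) (≤-reflexive d≡0)) λ ()
        go (inj₁ (inj₁ x≥1)) = subst (OutcomeAt []) (proj₂ room)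
          (F n , 0 , fits none (fit-within 3 Φ-v Φ≤3+n gain₃) , [] , F₁ n)
          where
          gain₃ : 3 ≤ gainᵛ
          gain₃ = gainᵛ≥ {0} z≤n x≥1
          room : ∃ λ n → 1 + n ≡ m
          room = m≤n⇒∃[o]m+o≡n (+-cancelˡ-≤ 2 1 m
            (≤-trans gain₃ (≤-trans (m≤n+m _ _) (≤-trans Φ-v Φ≤2+m))))
          n = proj₁ room
          Φ≤3+n : Φ st ≤ 3 + n
          Φ≤3+n = ≤-trans Φ≤2+m (≤-reflexive (cong (2 +_) (sym (proj₂ room))))

      -- This and the next five lemmas hand a bonus down to a child. The carrier x stays in X if it
      -- lies on the side of the taken vertex or is adjacent to it. Where the name ends in ⁺, x also
      -- loses a non-neighbour from C, and the bonus grows by one.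
      bonus-xb-v : ∀ {x e} → x ∈ XB st → T (adj v x) → e + degCᵒ adj x st ≤ 3 →
        Bonus adj (takeA adj v st) e
      bonus-xb-v {x} x∈ vx h = onB (∈-filterᵇ⁺ (adj v) x∈ vx)
        (≤-trans (+-monoʳ-≤ _ (length-filterᵇ²≤ (λ u → not (adj u x)) (other v) (CA st))) h)

      bonus-xb-w : ∀ {x e w} → x ∈ XB st → e + degCᵒ adj x st ≤ 3 → Bonus adj (takeB adj w st₁) e
      bonus-xb-w {x} {e} {w} x∈ h = onB x∈
        (≤-trans (+-monoʳ-≤ e (≤-trans
          (length-filterᵇ²≤ (λ u → not (adj u x)) (λ u → adj u w) (remove v (CA st)))
          (length-filterᵇ²≤ (λ u → not (adj u x)) (other v) (CA st)))) h)

      bonus-xb-w⁺ : ∀ {x e w} → x ∈ XB st → ¬ T (adj v x) → e + degCᵒ adj x st ≤ 3 →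
        Bonus adj (takeB adj w st₁) (suc e)
      bonus-xb-w⁺ {x} {e} {w} x∈ ¬vx h = onB x∈ (begin
        suc e + degCᵒ adj x (takeB adj w st₁) ≡⟨ +-suc e _ ⟨
        e + suc (degCᵒ adj x (takeB adj w st₁))
          ≤⟨ +-monoʳ-≤ e (≤-trans
               (s≤s (length-filterᵇ²≤ (λ u → not (adj u x)) (λ u → adj u w) (remove v (CA st))))
               (length-filterᵇ²< (λ u → not (adj u x)) (other v) v∈ (not⁺ _ ¬vx) (¬other v))) ⟩
        e + degCᵒ adj x st ≤⟨ h ⟩
        3 ∎)
        where open ≤-Reasoning

      bonus-xa-v : ∀ {x e} → x ∈ XA st → e + degC adj x st ≤ 3 → Bonus adj (takeA adj v st) e
      bonus-xa-v {x} {e} x∈ h = onA x∈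
        (≤-trans (+-monoʳ-≤ e (length-filterᵇ²≤ (not ∘ adj x) (adj v) (CB st))) h)

      bonus-xa-v⁺ : ∀ {x e w} → x ∈ XA st → w ∈ CB st → T (not (adj v w)) → ¬ T (adj x w) →
        e + degC adj x st ≤ 3 → Bonus adj (takeA adj v st) (suc e)
      bonus-xa-v⁺ {x} {e} {w} x∈ w∈ ¬vw ¬xw h = onA x∈ (begin
        suc e + degC adj x (takeA adj v st) ≡⟨ +-suc e _ ⟨
        e + suc (degC adj x (takeA adj v st))
          ≤⟨ +-monoʳ-≤ e (length-filterᵇ²< (not ∘ adj x) (adj v) w∈ (not⁺ _ ¬xw) (not⁻ _ ¬vw)) ⟩
        e + degC adj x st ≤⟨ h ⟩
        3 ∎)
        where open ≤-Reasoning

      bonus-xa-w : ∀ {x e w} → x ∈ XA st → T (adj x w) → e + degC adj x st ≤ 3 →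
        Bonus adj (takeB adj w st₁) e
      bonus-xa-w {x} {e} {w} x∈ xw h = onA (∈-filterᵇ⁺ (λ u → adj u w) (there x∈) xw)
        (≤-trans (+-monoʳ-≤ e (length-filterᵇ²≤ (not ∘ adj x) (other w) (CB st))) h)

      module _ {w : Fin b} (w∈ : w ∈ CB st) (¬vw : T (not (adj v w))) where

        Pair : ℕ → Set
        Pair n = Budget adj (takeA adj v st) (F n) × Budget adj (takeB adj w st₁) (F (1 + n)) ⊎
                 Budget adj (takeA adj v st) (F (1 + n)) × Budget adj (takeB adj w st₁) (F n)

        from-pair : ∀ {n} → Pair n → OutcomeAt (w ∷ []) (5 + n)
        from-pair {n} (inj₁ (bv , bw)) = _ , _ , bv , (w∈ , bw) ∷ [] , F₅₄ n
        from-pair {n} (inj₂ (bv , bw)) = _ , _ , bv , (w∈ , bw) ∷ [] , F₄₅ n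

        -- In the second alternative `v` has no non-neighbour in X; this rules out a case of
        -- `bonus-B-pair`.
        Gains : Set
        Gains = 5 ≤ gainᵛ × 4 ≤ gain w ⊎ degX adj v st ≤ 0 × 4 ≤ gainᵛ × 5 ≤ gain w

        gains : d ≡ 1 → (∀ {u} → u ∈ CB st → T (not (adj v u)) → u ≡ w) → Gains
        gains d≡1 only = go kind
          where
          1≤d = ≤-reflexive (sym d≡1)
          go : Deviant st v ⊎ NearDeviant st v → Gains
          go (inj₁ (inj₁ x≥1)) = inj₁ (gainᵛ≥ 1≤d x≥1 , gain≥ w (degCᵒ≥1 ¬vw) z≤n)
          go (inj₁ (inj₂ d≥3)) = contradiction (≤-trans d≥3 (≤-reflexive d≡1)) λ { (s≤s ()) }
          go (inj₂ (x≤0 , _ , u , u∈ , ¬vu , dev)) with refl ← only u∈ ¬vu =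
            inj₂ (x≤0 , gainᵛ≥ 1≤d z≤n , deviant-gain w 1 (s≤s z≤n) (degCᵒ≥1 ¬vw) dev)

        plain-pair : Gains → Φ st ≤ m → Outcome (w ∷ [])
        plain-pair (inj₁ (gv , gw)) Φ≤ = enough 5 Φ-v gv Φ≤ λ n Φ≤ →
          from-pair (inj₁ (fits none (fit-within 5 Φ-v Φ≤ gv) ,
                           fits none (fit-within 4 (Φ-w w∈ ¬vw) Φ≤ gw)))
        plain-pair (inj₂ (_ , gv , gw)) Φ≤ = enough 5 (Φ-w w∈ ¬vw) gw Φ≤ λ n Φ≤ →
          from-pair (inj₂ (fits none (fit-within 4 Φ-v Φ≤ gv) ,
                           fits none (fit-within 5 (Φ-w w∈ ¬vw) Φ≤ gw)))

        both-bonus : ∀ {n} → Gains → Φ st ≤ 6 + n →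
          Bonus adj (takeA adj v st) 1 → Bonus adj (takeB adj w st₁) 1 → Pair n
        both-bonus (inj₁ (gv , gw)) Φ≤ bv bw =
          inj₁ (fits bv (fit-within 5 Φ-v Φ≤ gv) , fits bw (fit-within 4 (Φ-w w∈ ¬vw) Φ≤ gw))
        both-bonus (inj₂ (_ , gv , gw)) Φ≤ bv bw =
          inj₂ (fits bv (fit-within 4 Φ-v Φ≤ gv) , fits bw (fit-within 5 (Φ-w w∈ ¬vw) Φ≤ gw))

        gainᵛ≥4 : Gains → 4 ≤ gainᵛ
        gainᵛ≥4 (inj₁ (gv , _)) = ≤-trans (n≤1+n 4) gv
        gainᵛ≥4 (inj₂ (_ , gv , _)) = gv

        -- If x is adjacent to `w`, both children keep the bonus. Otherwise taking `v` removes the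
        -- non-neighbour `w` of x, which makes the bonus 2 there, and x itself raises the loss of
        -- `w` to 5.
        bonus-A-pair : ∀ {n x} → x ∈ XA st → 1 + degC adj x st ≤ 3 → Gains → Φ st ≤ 6 + n → Pair n
        bonus-A-pair {n} {x} x∈ h g Φ≤ with T? (adj x w)
        ... | yes xw = both-bonus g Φ≤ (bonus-xa-v x∈ h) (bonus-xa-w x∈ xw h)
        ... | no ¬xw = inj₁
          ( fits (bonus-xa-v⁺ x∈ w∈ ¬vw ¬xw h) (fit-within 4 Φ-v Φ≤ (gainᵛ≥4 g))
          , fits none (fit-within 5 (Φ-w w∈ ¬vw) Φ≤
              (gain≥ w (degCᵒ≥1 ¬vw) (degXᵒ-positive {st = st} x∈ (not⁺ _ ¬xw)))))

        -- If x is adjacent to `v`, both children keep the bonus. Otherwise x is a non-neighbour of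
        -- `v` in X, so `v` loses 5, and x loses its non-neighbour `v` before `w` is taken, which
        -- makes the bonus 2 there.
        bonus-B-pair : ∀ {n x} → x ∈ XB st → 1 + degCᵒ adj x st ≤ 3 → Gains → Φ st ≤ 6 + n → Pair n
        bonus-B-pair {n} {x} x∈ h g Φ≤ with T? (adj v x)
        ... | yes vx = both-bonus g Φ≤ (bonus-xb-v x∈ vx h) (bonus-xb-w {w = w} x∈ h)
        bonus-B-pair {n} {x} x∈ h (inj₁ (gv , gw)) Φ≤ | no ¬vx = inj₂
          ( fits none (fit-within 5 Φ-v Φ≤ gv)
          , fits (bonus-xb-w⁺ {w = w} x∈ ¬vx h) (fit-within 4 (Φ-w w∈ ¬vw) Φ≤ gw))
        bonus-B-pair {n} {x} x∈ h (inj₂ (x≤0 , _)) Φ≤ | no ¬vx = contradiction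
          (≤-trans (∈-length (∈-filterᵇ⁺ (not ∘ adj v) x∈ (not⁺ _ ¬vx))) x≤0) λ ()

        6≤Φ : 3 ≤ length (CA st) + length (CB st) → 6 ≤ Φ st
        6≤Φ h = ≤-trans (*-monoʳ-≤ 2 h) (m≤m+n _ _)

        single : ∀ {e} → Bonus adj st e → Φ st ≤ e + m → d ≡ 1 →
          (∀ {u} → u ∈ CB st → T (not (adj v u)) → u ≡ w) → Outcome (w ∷ [])
        single {0} _ Φ≤ d≡1 only = plain-pair (gains d≡1 only) Φ≤
        -- The carrier has degree above 1, so C has two vertices opposite to it and one on its own
        -- side. Hence Φ ≥ 6 and m ≥ 5.
        single {1} (onA x∈ h) Φ≤ d≡1 only
          with n , 5+n≡m ← m≤n⇒∃[o]m+o≡n (+-cancelˡ-≤ 1 5 m (≤-trans (6≤Φ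
                 (+-mono-≤ (∈-length v∈) (≤-trans (≤-trans (s≤s (≤-reflexive (sym d≡1))) (minA x∈))
                   (length-filterᵇ≤ _ (CB st))))) Φ≤)) =
          subst (OutcomeAt _) 5+n≡m (from-pair (bonus-A-pair x∈ h (gains d≡1 only)
            (≤-trans Φ≤ (≤-reflexive (cong suc (sym 5+n≡m))))))
        single {1} (onB x∈ h) Φ≤ d≡1 only
          with n , 5+n≡m ← m≤n⇒∃[o]m+o≡n (+-cancelˡ-≤ 1 5 m (≤-trans (6≤Φ
                 (+-mono-≤ (≤-trans (≤-trans (s≤s (≤-reflexive (sym d≡1))) (minB x∈))
                   (length-filterᵇ≤ _ (CA st))) (∈-length w∈))) Φ≤)) =
          subst (OutcomeAt _) 5+n≡m (from-pair (bonus-B-pair x∈ h (gains d≡1 only)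
            (≤-trans Φ≤ (≤-reflexive (cong suc (sym 5+n≡m))))))
        single {suc (suc e)} bonus Φ≤ d≡1 only with bonus-limit bonus
        ... | inj₂ h = contradiction
              (≤-trans (m≤n+m (suc d) e) (+-cancelˡ-≤ 2 (e + suc d) 1 h))
              (λ h′ → contradiction (≤-trans (s≤s (≤-reflexive (sym d≡1))) h′) λ { (s≤s ()) })

      module _ {w u : Fin b} (w∈ : w ∈ CB st) (u∈ : u ∈ CB st) (u≢w : u ≢ w)
               (¬vw : T (not (adj v w))) (¬vu : T (not (adj v u)))
               (Φ≤ : Φ st ≤ m) (d≡2 : d ≡ 2) where

        private
          stᵤ = takeB adj u (excludeB adj w st₁)

          2≤d : 2 ≤ d
          2≤d = ≤-reflexive (sym d≡2)

          degree-drop : suc (degCᵒ adj w stᵤ) ≤ degCᵒ adj w st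
          degree-drop = ≤-trans
            (s≤s (length-filterᵇ²≤ (λ x → not (adj x w)) (λ x → adj x u) (remove v (CA st))))
            (length-filterᵇ²< (λ x → not (adj x w)) (other v) v∈ ¬vw (¬other v))

          -- When u is taken, w is in X and has lost its non-neighbour v.
          late-bonus : ∀ e → e + degCᵒ adj w st ≤ 4 → Bonus adj stᵤ e
          late-bonus e h = onB (here refl) (+-cancelˡ-≤ 1 _ 3
            (≤-trans (≤-reflexive (sym (+-suc e _))) (≤-trans (+-monoʳ-≤ e degree-drop) h)))

          u∈′ : u ∈ remove w (CB st)
          u∈′ = ∈-remove⁺ u∈ u≢w

          Φw : Φ (takeB adj w st₁) + gain w ≤ Φ st
          Φw = Φ-w w∈ ¬vw

          Φu : Φ stᵤ + suc (gain u) ≤ Φ st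
          Φu = Φ-w₂ w∈ u∈ u≢w ¬vw ¬vu

        -- Since `v` lies outside C′, both non-neighbours are candidates and have degree at least 2.
        -- A non-neighbour in X brings `v` to 7, and the exclusion of `w` brings `u` from 6 to 7.
        pair-deviant : Deviant st v → Outcome (w ∷ u ∷ [])
        pair-deviant (inj₂ d≥3) =
          contradiction (≤-trans d≥3 (≤-reflexive d≡2)) λ { (s≤s (s≤s ())) }
        pair-deviant dev@(inj₁ x≥1) = enough 7 Φ-v (gainᵛ≥ 2≤d x≥1) Φ≤ λ n Φ≤ → _ , _ ,
          fits none (fit-within 7 Φ-v Φ≤ (gainᵛ≥ 2≤d x≥1)) ,
          (w∈ , fits none (fit-within 6 Φw Φ≤ (gain≥ w (≤-trans 2≤d (minC w∈ ¬vw (inj₁ dev))) z≤n))) ∷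
          (u∈′ , fits none (fit-within 7 Φu Φ≤ (s≤s (gain≥ u (≤-trans 2≤d (minC u∈ ¬vu (inj₁ dev))) z≤n)))) ∷
          [] ,
          F₇₆₇ n

        -- Nothing is known about `u`, which may lose only 5. In that case `w`, by then in X,
        -- contributes a bonus if its degree is 2 or 3; a larger degree makes the child of `w` cheap
        -- enough instead.
        pair-first : Deviantᵒ st w → Outcome (w ∷ u ∷ [])
        pair-first dev = go (2 ≤? degCᵒ adj u st) (degCᵒ adj w st ≤? 2) (degCᵒ adj w st ≤? 3)
          where
          2≤w : 2 ≤ degCᵒ adj w st
          2≤w = ≤-trans 2≤d (minC w∈ ¬vw (inj₂ dev))
          gain-w : 7 ≤ gain w
          gain-w = deviant-gain w 2 ≤-refl 2≤w dev
          gain-v : 6 ≤ gainᵛ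
          gain-v = gainᵛ≥ 2≤d z≤n
          gain-u : 5 ≤ suc (gain u)
          gain-u = s≤s (gain≥ u (degCᵒ≥1 ¬vu) z≤n)
          go : Dec (2 ≤ degCᵒ adj u st) → Dec (degCᵒ adj w st ≤ 2) → Dec (degCᵒ adj w st ≤ 3) →
            Outcome (w ∷ u ∷ [])
          go (yes 2≤u) _ _ = enough 7 Φw gain-w Φ≤ λ n Φ≤ → _ , _ ,
            fits none (fit-within 6 Φ-v Φ≤ gain-v) ,
            (w∈ , fits none (fit-within 7 Φw Φ≤ gain-w)) ∷
            (u∈′ , fits none (fit-within 7 Φu Φ≤ (s≤s (gain≥ u 2≤u z≤n)))) ∷ [] ,
            F₆₇₇ n
          go (no _) (yes w≤2) _ = enough 7 Φw gain-w Φ≤ λ n Φ≤ → _ , _ ,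
            fits none (fit-within 6 Φ-v Φ≤ gain-v) ,
            (w∈ , fits none (fit-within 7 Φw Φ≤ gain-w)) ∷
            (u∈′ , fits (late-bonus 2 (+-monoʳ-≤ 2 w≤2)) (fit-within 5 Φu Φ≤ gain-u)) ∷ [] ,
            F₆₇₇ n
          go (no _) (no w≰2) (yes w≤3) = enough 8 Φw (gain≥ w (≰⇒> w≰2) z≤n) Φ≤ λ n Φ≤ → _ , _ ,
            fits none (fit-within 6 Φ-v Φ≤ gain-v) ,
            (w∈ , fits none (fit-within 8 Φw Φ≤ (gain≥ w (≰⇒> w≰2) z≤n))) ∷
            (u∈′ , fits (late-bonus 1 (+-monoʳ-≤ 1 w≤3)) (fit-within 5 Φu Φ≤ gain-u)) ∷ [] ,
            F₆₈₆ n
          go (no _) (no _) (no w≰3) = enough 10 Φw (gain≥ w (≰⇒> w≰3) z≤n) Φ≤ λ n Φ≤ → _ , _ ,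
            fits none (fit-within 6 Φ-v Φ≤ gain-v) ,
            (w∈ , fits none (fit-within 10 Φw Φ≤ (gain≥ w (≰⇒> w≰3) z≤n))) ∷
            (u∈′ , fits none (fit-within 5 Φu Φ≤ gain-u)) ∷ [] ,
            F₆,₁₀,₅ n

        -- The last child loses 7 and one more for the exclusion of `w`. If `w` has degree at least
        -- 2, the drops are the critical (6, 6, 8). If `v` is the only non-neighbour of `w`, then
        -- `w` has none left in C once both are in X, and the last child is pruned.
        pair-second : Deviantᵒ st u → Outcome (w ∷ u ∷ [])
        pair-second dev = go (2 ≤? degCᵒ adj w st)
          where
          gain-u : 8 ≤ suc (gain u)
          gain-u = s≤s (deviant-gain u 2 ≤-refl (≤-trans 2≤d (minC u∈ ¬vu (inj₂ dev))) dev)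
          gain-v : 6 ≤ gainᵛ
          gain-v = gainᵛ≥ 2≤d z≤n
          go : Dec (2 ≤ degCᵒ adj w st) → Outcome (w ∷ u ∷ [])
          go (yes 2≤w) = enough 8 Φu gain-u Φ≤ λ n Φ≤ → _ , _ ,
            fits none (fit-within 6 Φ-v Φ≤ gain-v) ,
            (w∈ , fits none (fit-within 6 Φw Φ≤ (gain≥ w 2≤w z≤n))) ∷
            (u∈′ , fits none (fit-within 8 Φu Φ≤ gain-u)) ∷ [] ,
            F₆₆₈ n
          go (no 2≰w) = enough 6 Φ-v gain-v Φ≤ λ n Φ≤ → _ , _ ,
            fits none (fit-within 6 Φ-v Φ≤ gain-v) ,
            (w∈ , fits none (fit-within 4 Φw Φ≤ (gain≥ w (degCᵒ≥1 ¬vw) z≤n))) ∷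
            (u∈′ , deadB (here refl) (s≤s⁻¹ (≤-trans degree-drop (s≤s⁻¹ (≰⇒> 2≰w))))) ∷ [] ,
            ≤-trans (≤-reflexive (regroup (F n) (F (2 + n)))) (F₆₄ n)
            where
            regroup : ∀ x y → 1 + (x + (y + (1 + 0))) ≡ 2 + (x + (y + 0))
            regroup = solve-∀

      -- A pivot satisfying (C2) has degree at most 2, so here `v` lies outside C′, and all its
      -- non-neighbours are candidates of degree at least d.
      many : ∀ {w u z ws} → Φ st ≤ m → let ws′ = w ∷ u ∷ z ∷ ws in
        All (λ x → x ∈ CB st × T (not (adj v x))) ws′ → Unique ws′ → d ≡ length ws′ →
        Outcome ws′
      many {w} {u} {z} {ws} Φ≤ all@((w∈ , ¬vw) ∷ us∈@((u∈ , ¬vu) ∷ _)) (w∉us ∷ us!) d≡ =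
        go (m≤n⇒∃[o]m+o≡n room)
        where
        d′ = 3 + length ws
        3≤d : 3 ≤ d
        3≤d = ≤-trans (m≤m+n 3 (length ws)) (≤-reflexive (sym d≡))
        dev : Deviant st v ⊎ NearDeviant st v → Deviant st v
        dev (inj₁ dev)          = dev
        dev (inj₂ (_ , d≤2 , _)) = contradiction (≤-trans 3≤d d≤2) λ { (s≤s (s≤s ())) }
        d′≤d : d′ ≤ d
        d′≤d = ≤-reflexive (sym d≡)
        heavy : ∀ {x} → x ∈ CB st → T (not (adj v x)) → 2 + 2 * d′ ≤ gain x
        heavy {x} x∈ ¬vx = ≤-trans (≤-reflexive (sym (+-identityʳ _)))
          (gain≥ x (≤-trans d′≤d (minC x∈ ¬vx (inj₁ (dev kind)))) z≤n)
        heavyᵛ : 2 + 2 * d′ ≤ gainᵛ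
        heavyᵛ = ≤-trans (≤-reflexive (sym (+-identityʳ _))) (gainᵛ≥ d′≤d z≤n)
        room : 2 * d′ + 3 ≤ m
        room = begin
          2 * d′ + 3     ≡⟨ +-comm (2 * d′) 3 ⟩
          3 + 2 * d′     ≤⟨ s≤s (heavy u∈ ¬vu) ⟩
          suc (gain u)   ≤⟨ m≤n+m _ _ ⟩
          _              ≤⟨ Φ-w₂ w∈ u∈ (≢-sym (All.head w∉us)) ¬vw ¬vu ⟩
          Φ st           ≤⟨ Φ≤ ⟩
          m              ∎
          where open ≤-Reasoning
        go : (∃ λ n → 2 * d′ + 3 + n ≡ m) → Outcome (w ∷ u ∷ z ∷ ws)
        go (n , m≡) = _ , _ ,
          fits none (fit-within (2 + 2 * d′) Φ-v Φ≤′ heavyᵛ) ,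
          (w∈ , fits none (fit-within (2 + 2 * d′) (Φ-w w∈ ¬vw) Φ≤′ (heavy w∈ ¬vw))) ∷
          -- After the exclusion of `v` and `w` the losses may be one smaller, but the potential is
          -- two smaller: in total these children lose 2d′ + 3.
          uniform (1 + 2 * d′) (u ∷ z ∷ ws) us!
            (All.zipWith (λ (w≢x , x∈ , _) → ∈-remove⁺ x∈ (≢-sym w≢x)) (w∉us , us∈))
            (All.map (λ (x∈ , ¬vx) → s≤s⁻¹ (≤-trans (heavy x∈ ¬vx) (gain≤ ¬vx))) us∈)
            Φ≤″ ,
          ≤-trans (F-branching (length ws) n) (≤-reflexive (cong F m≡))
          where
          shift : ∀ d n → 2 * d + 3 + n ≡ 2 + 2 * d + suc n
          shift = solve-∀
          Φ≤′ : Φ st ≤ 2 + 2 * d′ + (1 + n)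
          Φ≤′ = ≤-trans Φ≤ (≤-reflexive (trans (sym m≡) (shift d′ n)))
          Φ≤″ : Φ (excludeB adj w st₁) ≤ 1 + 2 * d′ + n
          Φ≤″ = +-cancelˡ-≤ 2 _ _ (≤-trans (s≤s (Φ-excludeB {w} {st₁} w∈))
            (≤-trans (Φ-excludeA adj {v} {st} v∈) (≤-trans Φ≤′
              (≤-reflexive (cong (2 +_) (+-suc (2 * d′) n))))))

    C-pivot : ∀ {ws e} → ws ↭ non adj v (CB st) → Bonus adj st e → Φ st ≤ e + m →
      ∃₂ λ k t → Budget adj (takeA adj v st) k × BudgetsB adj (excludeA adj v st) ws t ×
                 1 + (k + t) ≤ F m
    C-pivot {ws} {e} ws↭ bonus Φ≤ = go ws ws↭
      where
      go : ∀ ws → ws ↭ non adj v (CB st) → Outcome ws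
      go [] ws↭ = isolated-pivot bonus Φ≤ (sym (↭.↭-length ws↭))
      go (w ∷ []) ws↭ with in-order {v} {st} ws↭ CB! (here refl)
      ... | w∈ , ¬vw = single w∈ ¬vw bonus Φ≤ (sym (↭.↭-length ws↭)) only
        where
        only : ∀ {u} → u ∈ CB st → T (not (adj v u)) → u ≡ w
        only u∈ ¬vu with ↭.∈-resp-↭ (↭-sym ws↭) (∈-filterᵇ⁺ (not ∘ adj v) u∈ ¬vu)
        ... | here u≡w = u≡w
      go (w ∷ u ∷ []) ws↭
        with in-order {v} {st} ws↭ CB! (here refl)
           | in-order {v} {st} ws↭ CB! (there (here refl)) | order-unique {v} {st} ws↭ CB!
      ... | w∈ , ¬vw | u∈ , ¬vu | ((w≢u ∷ []) ∷ _) = by-kind kind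
        where
        d≡2 : degC adj v st ≡ 2
        d≡2 = sym (↭.↭-length ws↭)
        Φ≤m : Φ st ≤ m
        Φ≤m = no-bonus bonus (≤-reflexive (sym d≡2)) Φ≤
        by-kind : Deviant st v ⊎ NearDeviant st v → Outcome (w ∷ u ∷ [])
        by-kind (inj₁ dev) = pair-deviant w∈ u∈ (≢-sym w≢u) ¬vw ¬vu Φ≤m d≡2 dev
        by-kind (inj₂ (_ , _ , z , z∈ , ¬vz , dev))
          with ↭.∈-resp-↭ (↭-sym ws↭) (∈-filterᵇ⁺ (not ∘ adj v) z∈ ¬vz)
        ... | here refl         = pair-first w∈ u∈ (≢-sym w≢u) ¬vw ¬vu Φ≤m d≡2 dev
        ... | there (here refl) = pair-second w∈ u∈ (≢-sym w≢u) ¬vw ¬vu Φ≤m d≡2 dev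
      go ws@(_ ∷ _ ∷ _ ∷ ws₀) ws↭ = many
        (no-bonus bonus (≤-trans (m≤m+n 2 (suc (length ws₀))) (≤-reflexive (↭.↭-length ws↭))) Φ≤)
        (All.tabulate (in-order {v} {st} ws↭ CB!))
        (order-unique {v} {st} ws↭ CB!) (sym (↭.↭-length ws↭))

-- Running times

module _ {O A : Set} where

  value-filterᵖ : ∀ (p : A → Prog O Bool) xs →
    value (filterᵖ p xs) ≡ filterᵇ (value ∘ p) xs
  value-filterᵖ p [] = refl
  value-filterᵖ p (x ∷ xs) with value (p x)
  ... | true  = cong (x ∷_) (value-filterᵖ p xs)
  ... | false = value-filterᵖ p xs

  length-filterᵖ : ∀ (p : A → Prog O Bool) xs → length (value (filterᵖ p xs)) ≤ length xs
  length-filterᵖ p xs rewrite value-filterᵖ p xs = length-filterᵇ≤ (value ∘ p) xs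

  ∈-filterᵖ⁺ : ∀ (p : A → Prog O Bool) {x xs} → x ∈ xs → T (value (p x)) →
    x ∈ value (filterᵖ p xs)
  ∈-filterᵖ⁺ p {x} {xs} x∈ px rewrite value-filterᵖ p xs = ∈-filterᵇ⁺ (value ∘ p) x∈ px

  ∈-filterᵖ⁻ : ∀ (p : A → Prog O Bool) {x xs} → x ∈ value (filterᵖ p xs) →
    x ∈ xs × T (value (p x))
  ∈-filterᵖ⁻ p {x} {xs} x∈ rewrite value-filterᵖ p xs = ∈-filterᵇ⁻ (value ∘ p) x∈

  value-mapᵖ : ∀ {B} (f : A → Prog O B) xs → value (mapᵖ f xs) ≡ map (value ∘ f) xs
  value-mapᵖ f []       = refl
  value-mapᵖ f (x ∷ xs) = cong (value (f x) ∷_) (value-mapᵖ f xs)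

  length-mapᵖ : ∀ {B} (f : A → Prog O B) xs → length (value (mapᵖ f xs)) ≡ length xs
  length-mapᵖ f xs rewrite value-mapᵖ f xs = length-map (value ∘ f) xs

  value-lengthᵖ : ∀ (xs : List A) → value (lengthᵖ {O} xs) ≡ length xs
  value-lengthᵖ = go 0
    where
    go : ∀ k (xs : List A) →
      value (foldᵖ {O} (λ k _ → return (suc k)) k xs) ≡ k + length xs
    go k []       = sym (+-identityʳ k)
    go k (x ∷ xs) = trans (go (suc k) xs) (sym (+-suc k (length xs)))

  any⁺ : ∀ (p : A → Prog O Bool) {x xs} → x ∈ xs → T (value (p x)) → T (value (anyᵖ p xs))
  any⁺ p x∈ px = nonempty (∈-filterᵖ⁺ p x∈ px)
    where
    nonempty : ∀ {x : A} {xs} → x ∈ xs → T (not (null xs))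
    nonempty (here _)  = _
    nonempty (there _) = _

  any⁻ : ∀ (p : A → Prog O Bool) {xs} → T (value (anyᵖ p xs)) → ∃ λ x → x ∈ xs × T (value (p x))
  any⁻ p {xs} t = witness (value (filterᵖ p xs)) (∈-filterᵖ⁻ p) t
    where
    witness : ∀ {P : A → Set} ys → (∀ {y} → y ∈ ys → P y) → T (not (null ys)) → ∃ P
    witness (y ∷ _) from _ = y , from (here refl)

  all⁻ : ∀ (p : A → Prog O Bool) {xs} → T (value (allᵖ p xs)) → ∀ {x} → x ∈ xs → T (value (p x))
  all⁻ p {xs} t {x} x∈ with value (p x) in eq
  ... | true  = _
  ... | false = contradiction
    (any⁺ (λ x → notᵖ (p x)) x∈ (subst (T ∘ not) (sym eq) _))
    (not⁻ _ t)

  all⁺ : ∀ (p : A → Prog O Bool) {xs} → (∀ {x} → x ∈ xs → T (value (p x))) → T (value (allᵖ p xs))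
  all⁺ p h = not⁺ _ λ t → let x , x∈ , ¬px = any⁻ (λ x → notᵖ (p x)) t in not⁻ _ ¬px (h x∈)

-- t = O(Nᵉ), with constant k.
record Cost (N e t k : ℕ) : Set where
  constructor cost
  field bound : t ≤ k * N ^ⁿ e

open Cost public

module _ {N : ℕ} where

  infixr 5 _⊕_
  _⊕_ : ∀ {e t u j k} → Cost N e t j → Cost N e u k → Cost N e (t + u) (j + k)
  _⊕_ {e} {j = j} {k} (cost t≤) (cost u≤) =
    cost (≤-trans (+-mono-≤ t≤ u≤) (≤-reflexive (sym (*-distribʳ-+ (N ^ⁿ e) j k))))

  free : ∀ {e} → Cost N e 0 0
  free = cost z≤n

  one : Cost N 0 1 1
  one = cost (s≤s z≤n)

  raise : ∀ {e t k} → 1 ≤ N → Cost N e t k → Cost N (suc e) t k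
  raise {e} {k = k} 1≤N (cost t≤) = cost (≤-trans t≤ (*-monoʳ-≤ k
    (≤-trans (≤-reflexive (sym (*-identityˡ (N ^ⁿ e)))) (*-monoˡ-≤ (N ^ⁿ e) 1≤N))))

  within : ∀ {t} → t ≤ N → Cost N 1 t 1
  within t≤ = cost (≤-trans t≤ (≤-reflexive (sym (trans (*-identityˡ (N * 1)) (*-identityʳ N)))))

  -- The unit for the end of the list is charged as one more iteration, which is why l < N is asked
  -- for.
  loop : ∀ {e t c} l → t ≤ suc (l * suc c) → suc l ≤ N →
    ∀ {j} → c ≤ j * N ^ⁿ e → Cost N (suc e) t (suc j)
  loop {e} {t} {c} l t≤ l<N {j} c≤ = cost (begin
    t                          ≤⟨ t≤ ⟩
    suc (l * suc c)            ≤⟨ s≤s (m≤n+m (l * suc c) c) ⟩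
    suc l * suc c              ≤⟨ *-mono-≤ l<N (s≤s c≤) ⟩
    N * suc (j * N ^ⁿ e)        ≤⟨ *-monoʳ-≤ N (+-monoˡ-≤ (j * N ^ⁿ e) N^e≥1) ⟩
    N * (N ^ⁿ e + j * N ^ⁿ e)    ≡⟨ regroup N (N ^ⁿ e) j ⟩
    suc j * (N * N ^ⁿ e) ∎)
    where
    open ≤-Reasoning
    instance
      N≢0 : NonZero N
      N≢0 = >-nonZero (≤-trans (s≤s z≤n) l<N)
    N^e≥1 : 1 ≤ N ^ⁿ e
    N^e≥1 = m^n>0 N e
    regroup : ∀ n x j → n * (x + j * x) ≡ suc j * (n * x)
    regroup = solve-∀

module _ {O A : Set} {N : ℕ} where

  filterᵖ-cost : ∀ {e j} (p : A → Prog O Bool) xs → length xs < N →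
    (∀ x → Cost N e (time (p x)) j) → Cost N (suc e) (time (filterᵖ p xs)) (suc j)
  filterᵖ-cost {e} {j} p xs l<N c = loop (length xs) (go xs) l<N ≤-refl
    where
    go : ∀ xs → time (filterᵖ p xs) ≤ suc (length xs * suc (j * N ^ⁿ e))
    go []       = s≤s z≤n
    go (x ∷ xs) = s≤s (≤-trans (+-mono-≤ (bound (c x))
      (≤-trans (≤-reflexive (+-identityʳ _)) (go xs))) (≤-reflexive (+-suc (j * N ^ⁿ e) _)))

  mapᵖ-cost : ∀ {B : Set} {e j} (f : A → Prog O B) xs → length xs < N →
    (∀ x → Cost N e (time (f x)) j) → Cost N (suc e) (time (mapᵖ f xs)) (suc j)
  mapᵖ-cost {B} {e} {j} f xs l<N c = loop (length xs) (go xs) l<N ≤-refl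
    where
    go : ∀ xs → time (mapᵖ f xs) ≤ suc (length xs * suc (j * N ^ⁿ e))
    go []       = s≤s z≤n
    go (x ∷ xs) = s≤s (≤-trans (+-mono-≤ (bound (c x))
      (≤-trans (≤-reflexive (+-identityʳ _)) (go xs))) (≤-reflexive (+-suc (j * N ^ⁿ e) _)))

  lengthᵖ-cost : ∀ (xs : List A) → length xs < N → Cost N 1 (time (lengthᵖ {O} xs)) 1
  lengthᵖ-cost xs l<N = within (≤-trans (go 0 xs) l<N)
    where
    go : ∀ k (xs : List A) → time (foldᵖ {O} (λ k _ → return (suc k)) k xs) ≤ suc (length xs)
    go k []       = s≤s z≤n
    go k (x ∷ xs) = s≤s (go (suc k) xs)

does⁺ : ∀ {A : Set} (a? : Dec A) → A → T (does a?)
does⁺ (yes _) _ = _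
does⁺ (no ¬a) a = ¬a a

does⁻ : ∀ {A : Set} (a? : Dec A) → T (does a?) → A
does⁻ (yes a) _ = a

module _ {O A B : Set} where

  foldᵖ-time : ∀ (P : B → Set) {f : B → A → Prog O B} {c} xs →
    (∀ {b x} → x ∈ xs → P b → P (value (f b x))) →
    (∀ {b x} → x ∈ xs → P b → time (f b x) ≤ c) →
    ∀ {b} → P b → time (foldᵖ f b xs) ≤ suc (length xs * suc c)
  foldᵖ-time P []       pres fast p = s≤s z≤n
  foldᵖ-time P {f} {c} (x ∷ xs) pres fast p = s≤s (≤-trans
    (+-mono-≤ (fast (here refl) p) (foldᵖ-time P xs (pres ∘ there) (fast ∘ there) (pres (here refl) p)))
    (≤-reflexive (+-suc c _)))

  foldᵖ-invariant : ∀ (P : B → Set) {f : B → A → Prog O B} xs →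
    (∀ {b x} → x ∈ xs → P b → P (value (f b x))) →
    ∀ {b} → P b → P (value (foldᵖ f b xs))
  foldᵖ-invariant P []       pres p = p
  foldᵖ-invariant P (x ∷ xs) pres p = foldᵖ-invariant P xs (pres ∘ there) (pres (here refl) p)

  foldᵖ-reaches : ∀ (P : B → Set) {f : B → A → Prog O B} {x xs} → x ∈ xs →
    (∀ {b} → P (value (f b x))) → (∀ {b y} → P b → P (value (f b y))) →
    ∀ {b} → P (value (foldᵖ f b xs))
  foldᵖ-reaches P {xs = x ∷ xs} (here refl) reach keep = foldᵖ-invariant P xs (λ _ → keep) reach
  foldᵖ-reaches P {xs = y ∷ xs} (there x∈)  reach keep = foldᵖ-reaches P x∈ reach keep

-- Counting maximal bicliques

length-⊆ : ∀ {A : Set} → DecidableEquality A → ∀ {xs ys : List A} → Unique xs →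
  (∀ {x} → x ∈ xs → x ∈ ys) → length xs ≤ length ys
length-⊆ _≟_ {[]}     {ys} []           xs⊆ys = z≤n
length-⊆ _≟_ {x ∷ xs} {ys} (x∉xs ∷ xs!) xs⊆ys = ≤-trans
  (s≤s (length-⊆ _≟_ xs! λ y∈ →
    ∈-filter⁺ (λ y → ¬? (x ≟ y)) (xs⊆ys (there y∈)) (All.lookup x∉xs y∈)))
  (filter-notAll (λ y → ¬? (x ≟ y)) ys (lose (xs⊆ys (here refl)) (λ ¬refl → ¬refl refl)))

-- Subsets as lists, and counting with disjoint predicates

elements : ∀ {n} → Subset n → List (Fin n)
elements []          = []
elements (true ∷ p)  = zero ∷ map suc (elements p)
elements (false ∷ p) = map suc (elements p)

length-elements : ∀ {n} (p : Subset n) → length (elements p) ≡ ∣ p ∣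
length-elements []          = refl
length-elements (true ∷ p)  = cong suc (trans (length-map suc (elements p)) (length-elements p))
length-elements (false ∷ p) = trans (length-map suc (elements p)) (length-elements p)

∈-elements⁺ : ∀ {n} {p : Subset n} {i} → i Subset.∈ p → i ∈ elements p
∈-elements⁺ {p = true ∷ p}  Vec.here      = here refl
∈-elements⁺ {p = true ∷ p}  (Vec.there i∈) = there (∈-map⁺ suc (∈-elements⁺ i∈))
∈-elements⁺ {p = false ∷ p} (Vec.there i∈) = ∈-map⁺ suc (∈-elements⁺ i∈)

∈-elements⁻ : ∀ {n} {p : Subset n} {i} → i ∈ elements p → i Subset.∈ p
∈-elements⁻ {p = true ∷ p}  (here refl) = Vec.here
∈-elements⁻ {p = true ∷ p}  (there i∈) with j , j∈ , refl ← ∈-map⁻ suc i∈ = Vec.there (∈-elements⁻ j∈)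
∈-elements⁻ {p = false ∷ p} i∈ with j , j∈ , refl ← ∈-map⁻ suc i∈ = Vec.there (∈-elements⁻ j∈)

elements-unique : ∀ {n} (p : Subset n) → Unique (elements p)
elements-unique []          = []
elements-unique (true ∷ p)  =
  All.tabulate (λ i∈ → λ { refl → contradiction (∈-map⁻ suc i∈) λ { (_ , _ , ()) } }) ∷
  Unique.map⁺ Fin.suc-injective (elements-unique p)
elements-unique (false ∷ p) = Unique.map⁺ Fin.suc-injective (elements-unique p)

∣∣≤length : ∀ {n} {p : Subset n} {xs} → (∀ {i} → i Subset.∈ p → i ∈ xs) → ∣ p ∣ ≤ length xs
∣∣≤length {p = p} p⊆xs = ≤-trans (≤-reflexive (sym (length-elements p)))
  (length-⊆ Fin._≟_ (elements-unique p) (p⊆xs ∘ ∈-elements⁻))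

length≤∣∣ : ∀ {n} {p : Subset n} {xs} → Unique xs → (∀ {i} → i ∈ xs → i Subset.∈ p) → length xs ≤ ∣ p ∣
length≤∣∣ {p = p} xs! xs⊆p = ≤-trans (length-⊆ Fin._≟_ xs! (∈-elements⁺ ∘ xs⊆p))
  (≤-reflexive (length-elements p))

∈-tabulate⁻ : ∀ {n} (f : Fin n → Bool) {i} → i Subset.∈ tabulate f → T (f i)
∈-tabulate⁻ f {i} i∈ = subst T (trans (sym (Vec.[]=⇒lookup i∈)) (Vec.lookup∘tabulate f i)) _

∈-tabulate⁺ : ∀ {n} (f : Fin n → Bool) {i} → T (f i) → i Subset.∈ tabulate f
∈-tabulate⁺ f {i} t with f i in eq
... | true = Vec.lookup⇒[]= i (tabulate f) (trans (Vec.lookup∘tabulate f i) eq)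

-- Repeats the local function of `⟦_⟧`, so that facts about it apply there by computation.
fromList : ∀ {n} → List (Fin n) → Subset n
fromList = foldr (λ i p → ⁅ i ⁆ ∪ p) ⊥

∈-fromList⁺ : ∀ {n} {xs : List (Fin n)} {i} → i ∈ xs → i Subset.∈ fromList xs
∈-fromList⁺ {xs = x ∷ xs} (here refl) = Subset.x∈p∪q⁺ (inj₁ (Subset.x∈⁅x⁆ x))
∈-fromList⁺ {xs = x ∷ xs} (there i∈)  = Subset.x∈p∪q⁺ (inj₂ (∈-fromList⁺ i∈))

∈-fromList⁻ : ∀ {n} {xs : List (Fin n)} {i} → i Subset.∈ fromList xs → i ∈ xs
∈-fromList⁻ {xs = []}     i∈ = contradiction i∈ Subset.∉⊥
∈-fromList⁻ {xs = x ∷ xs} i∈ with Subset.x∈p∪q⁻ ⁅ x ⁆ (fromList xs) i∈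
... | inj₁ i∈x  = here (Subset.x∈⁅y⁆⇒x≡y x i∈x)
... | inj₂ i∈xs = there (∈-fromList⁻ i∈xs)

module _ {A : Set} where

  count : {P : Pred A 0ℓ} → Decidable P → List A → ℕ
  count P? xs = length (filter P? xs)

  count-cover : {P Q R : Pred A 0ℓ} (P? : Decidable P) (Q? : Decidable Q) (R? : Decidable R) →
    (∀ {x} → P x → Q x ⊎ R x) → ∀ xs → count P? xs ≤ count Q? xs + count R? xs
  count-cover P? Q? R? cover [] = z≤n
  count-cover P? Q? R? cover (x ∷ xs) with P? x | Q? x | R? x | count-cover P? Q? R? cover xs
  ... | no _  | no _  | no _  | ih = ih
  ... | no _  | no _  | yes _ | ih = ≤-trans ih (+-monoʳ-≤ _ (n≤1+n _))
  ... | no _  | yes _ | no _  | ih = m≤n⇒m≤1+n ih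
  ... | no _  | yes _ | yes _ | ih = m≤n⇒m≤1+n (≤-trans ih (+-monoʳ-≤ _ (n≤1+n _)))
  ... | yes _ | yes _ | no _  | ih = s≤s ih
  ... | yes _ | yes _ | yes _ | ih = s≤s (≤-trans ih (+-monoʳ-≤ _ (n≤1+n _)))
  ... | yes _ | no _  | yes _ | ih = ≤-trans (s≤s ih) (≤-reflexive (sym (+-suc _ _)))
  ... | yes p | no ¬q | no ¬r | ih = contradiction (cover p) λ { (inj₁ q) → ¬q q ; (inj₂ r) → ¬r r }

  count-disjoint : {P Q R : Pred A 0ℓ} (P? : Decidable P) (Q? : Decidable Q) (R? : Decidable R) →
    (∀ {x} → P x → R x) → (∀ {x} → Q x → R x) → (∀ {x} → P x → ¬ Q x) →
    ∀ xs → count P? xs + count Q? xs ≤ count R? xs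
  count-disjoint P? Q? R? P⇒R Q⇒R ¬PQ [] = z≤n
  count-disjoint P? Q? R? P⇒R Q⇒R ¬PQ (x ∷ xs)
    with P? x | Q? x | R? x | count-disjoint P? Q? R? P⇒R Q⇒R ¬PQ xs
  ... | yes p | yes q | _     | ih = contradiction q (¬PQ p)
  ... | yes p | no _  | no ¬r | ih = contradiction (P⇒R p) ¬r
  ... | no _  | yes q | no ¬r | ih = contradiction (Q⇒R q) ¬r
  ... | yes _ | no _  | yes _ | ih = s≤s ih
  ... | no _  | yes _ | yes _ | ih = ≤-trans (≤-reflexive (+-suc _ _)) (s≤s ih)
  ... | no _  | no _  | yes _ | ih = m≤n⇒m≤1+n ih
  ... | no _  | no _  | no _  | ih = ih

  count-mono : {P R : Pred A 0ℓ} (P? : Decidable P) (R? : Decidable R) →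
    (∀ {x} → P x → R x) → ∀ xs → count P? xs ≤ count R? xs
  count-mono P? R? P⇒R xs = ≤-trans (m≤m+n _ (count (λ _ → no λ ()) xs))
    (count-disjoint {Q = λ _ → Empty.⊥} P? (λ _ → no λ ()) R? P⇒R (λ ()) (λ _ ()) xs)
    where import Data.Empty as Empty

  count-≡ : (_≟_ : DecidableEquality A) → ∀ a {xs} → Unique xs → count (a ≟_) xs ≤ 1
  count-≡ _≟_ a {xs} xs! = length-⊆ _≟_ {ys = a ∷ []} (Unique.filter⁺ (a ≟_) xs!)
    λ x∈ → here (sym (proj₂ (∈-filter⁻ (a ≟_) {xs = xs} x∈)))

module _ {A I : Set} where

  sum-count-disjoint : {P : I → Pred A 0ℓ} (P? : ∀ i → Decidable (P i)) →
    (∀ {i j x} → P i x → P j x → i ≡ j) → ∀ {is} → Unique is → ∀ xs →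
    sum (map (λ i → count (P? i) xs) is) ≤ count (λ x → Any.any? (λ i → P? i x) is) xs
  sum-count-disjoint P? disjoint []           xs = z≤n
  sum-count-disjoint {P} P? disjoint {i ∷ is} (i∉is ∷ is!) xs = ≤-trans
    (+-monoʳ-≤ (count (P? i) xs) (sum-count-disjoint P? disjoint is! xs))
    (count-disjoint (P? i) (λ x → Any.any? (λ i → P? i x) is) (λ x → Any.any? (λ i → P? i x) (i ∷ is))
      here there (λ p q → clash i∉is p q) xs)
    where
    clash : ∀ {js x} → All (i ≢_) js → P i x → ¬ Any (λ j → P j x) js
    clash (i≢j ∷ _) p (here q)  = i≢j (disjoint p q)
    clash (_ ∷ i∉)  p (there q) = clash i∉ p q

length-filterᵇ-disjoint : ∀ {A : Set} (p q r : A → Bool) → (∀ x → T (p x) → T (r x)) →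
  (∀ x → T (q x) → T (r x)) → (∀ x → T (p x) → ¬ T (q x)) → ∀ xs →
  length (filterᵇ p xs) + length (filterᵇ q xs) ≤ length (filterᵇ r xs)
length-filterᵇ-disjoint p q r p⇒r q⇒r ¬pq = count-disjoint (T? ∘ p) (T? ∘ q) (T? ∘ r)
  (p⇒r _) (q⇒r _) (¬pq _)

length-cartesianProduct : ∀ {A B : Set} (xs : List A) (ys : List B) →
  length (cartesianProduct xs ys) ≡ length xs * length ys
length-cartesianProduct []       ys = refl
length-cartesianProduct (x ∷ xs) ys = trans (length-++ (map (x ,_) ys))
  (cong₂ _+_ (length-map (x ,_) ys) (length-cartesianProduct xs ys))

-- Maximal bicliques below a branch

module Counting (G : BipartiteGraph) where
  open BipartiteGraph G

  _≟ˢ_ : DecidableEquality (Sub G)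
  _≟ˢ_ = ×-≡-dec (Vec.≡-dec _≟ᵇ_) (Vec.≡-dec _≟ᵇ_)

  all-subs : List (Sub G)
  all-subs = cartesianProduct (subsets G (size left)) (subsets G (size right))

  subsets-unique : ∀ n → Unique (subsets G n)
  subsets-unique zero    = [] ∷ []
  subsets-unique (suc n) = Unique.++⁺
    (Unique.map⁺ Vec.∷-injectiveʳ (subsets-unique n))
    (Unique.map⁺ Vec.∷-injectiveʳ (subsets-unique n))
    λ (x∈ , x∈′) → contradiction
      (trans (sym (proj₂ (proj₂ (∈-map⁻ _ x∈)))) (proj₂ (proj₂ (∈-map⁻ _ x∈′)))) λ ()

  all-subs-unique : Unique all-subs
  all-subs-unique = Unique.cartesianProduct⁺ (subsets-unique _) (subsets-unique _)

  Large : (k : ℕ) → Sub G → Pred (Sub G) 0ℓ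
  Large k W H = IsMaximalBiclique G W H × k ≤ ∣ proj₁ H ∣ × k ≤ ∣ proj₂ H ∣

  large? : ∀ k W → Decidable (Large k W)
  large? k W H = isMaximalBiclique? G W H ×-dec (k ≤? ∣ proj₁ H ∣) ×-dec (k ≤? ∣ proj₂ H ∣)

  ∈-⟦⟧⁺ : ∀ Z s {v} → v ∈ Z s → v Subset.∈ side G (⟦_⟧ G Z) s
  ∈-⟦⟧⁺ Z left  = ∈-fromList⁺
  ∈-⟦⟧⁺ Z right = ∈-fromList⁺

  ∈-⟦⟧⁻ : ∀ Z s {v} → v Subset.∈ side G (⟦_⟧ G Z) s → v ∈ Z s
  ∈-⟦⟧⁻ Z left  = ∈-fromList⁻
  ∈-⟦⟧⁻ Z right = ∈-fromList⁻

  _∪ᵥ_ : VSet G → VSet G → VSet G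
  Y ∪ᵥ Z = assemble G left (Y left ++ Z left) (Y right ++ Z right)

  ∪ᵥ⁻ : ∀ Y Z s {v} → v ∈ (Y ∪ᵥ Z) s → v ∈ Y s ⊎ v ∈ Z s
  ∪ᵥ⁻ Y Z left  = ∈-++⁻ (Y left)
  ∪ᵥ⁻ Y Z right = ∈-++⁻ (Y right)

  ∪ᵥ⁺ : ∀ Y Z s {v} → v ∈ Y s ⊎ v ∈ Z s → v ∈ (Y ∪ᵥ Z) s
  ∪ᵥ⁺ Y Z left  = [ ∈-++⁺ˡ , ∈-++⁺ʳ (Y left) ]′
  ∪ᵥ⁺ Y Z right = [ ∈-++⁺ˡ , ∈-++⁺ʳ (Y right) ]′

  _⊆ᵥ_ : VSet G → Sub G → Set
  Z ⊆ᵥ H = ∀ s {v} → v ∈ Z s → v Subset.∈ side G H s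

  _⊇ᵥ_ : VSet G → Sub G → Set
  Z ⊇ᵥ H = ∀ s {v} → v Subset.∈ side G H s → v ∈ Z s

  ⊑⇒⊆ᵥ : ∀ {Z H} → _⊑_ G (⟦_⟧ G Z) H → Z ⊆ᵥ H
  ⊑⇒⊆ᵥ {Z} (l , r) left  v∈ = l (∈-⟦⟧⁺ Z left v∈)
  ⊑⇒⊆ᵥ {Z} (l , r) right v∈ = r (∈-⟦⟧⁺ Z right v∈)

  ⊆ᵥ⇒⊑ : ∀ {Z H} → Z ⊆ᵥ H → _⊑_ G (⟦_⟧ G Z) H
  ⊆ᵥ⇒⊑ {Z} {H} h = (λ v∈ → h left (∈-⟦⟧⁻ Z left v∈)) , (λ v∈ → h right (∈-⟦⟧⁻ Z right v∈))

  ⊑⇒⊇ᵥ : ∀ {Z H} → _⊑_ G H (⟦_⟧ G Z) → Z ⊇ᵥ H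
  ⊑⇒⊇ᵥ {Z} (l , r) left  v∈ = ∈-⟦⟧⁻ Z left (l v∈)
  ⊑⇒⊇ᵥ {Z} (l , r) right v∈ = ∈-⟦⟧⁻ Z right (r v∈)

  ⊇ᵥ⇒⊑ : ∀ {Z H} → Z ⊇ᵥ H → _⊑_ G H (⟦_⟧ G Z)
  ⊇ᵥ⇒⊑ {Z} h = (λ v∈ → ∈-⟦⟧⁺ Z left (h left v∈)) , (λ v∈ → ∈-⟦⟧⁺ Z right (h right v∈))

  Between : VSet G → VSet G → Pred (Sub G) 0ℓ
  Between S W H = _⊑_ G (⟦_⟧ G S) H × _⊑_ G H (⟦_⟧ G W)

  -- The maximal bicliques of G that can be output below a branch.
  Reachable : VSet G → VSet G → Pred (Sub G) 0ℓ
  Reachable S C H = Large 1 (whole G) H × Between S (S ∪ᵥ C) H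

  reachable? : ∀ S C → Decidable (Reachable S C)
  reachable? S C H = large? 1 (whole G) H ×-dec
    (_⊑?_ G (⟦_⟧ G S) H ×-dec _⊑?_ G H (⟦_⟧ G (S ∪ᵥ C)))

  #reachable : VSet G → VSet G → ℕ
  #reachable S C = count (reachable? S C) all-subs

  -- The invariant of the search. In `complete` both sides are non-empty because the left vertices
  -- of a biclique are 2-hop neighbours of the root vertex only by virtue of a common neighbour.
  record Valid (S C X : VSet G) : Set where
    field
      unique   : ∀ s → Unique (C s)
      apart    : ∀ s {v} → v ∈ S s → v ∉ C s
      joined   : ∀ {u w} → u ∈ (S ∪ᵥ C) left → w ∈ (S ∪ᵥ C) right →
                 u ∈ S left ⊎ w ∈ S right → T (edge u w)
      complete : ∀ {H} → IsBiclique G H → S ⊆ᵥ H → Nonempty (proj₁ H) → Nonempty (proj₂ H) →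
                 ∀ s {v} → v Subset.∈ side G H s → v ∈ (S ∪ᵥ C) s ⊎ v ∈ X s

  ∪-⊑ : ∀ H H′ → _⊑_ G H (proj₁ H ∪ proj₁ H′ , proj₂ H ∪ proj₂ H′)
  ∪-⊑ H H′ = Subset.p⊆p∪q (proj₁ H′) , Subset.p⊆p∪q (proj₂ H′)

  module _ {S C X : VSet G} (valid : Valid S C X) (X≡[] : ∀ s {v} → v ∉ X s) where
    open Valid valid
    private
      W = S ∪ᵥ C

    -- By `joined`, adding S to `H` gives a biclique inside W again; if it differed from `H`,
    -- maximality would fail.
    S⊑maximal : ∀ {H} → IsMaximalBiclique G (⟦_⟧ G W) H → S ⊆ᵥ H
    S⊑maximal {H@(A , B)} (H⊑W , biclique , max) with (A ∪ proj₁ (⟦_⟧ G S) , B ∪ proj₂ (⟦_⟧ G S)) ≟ˢ H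
    ... | yes eq = λ s v∈ → subst (λ K → _ Subset.∈ side G K s) eq (in-union s v∈)
      where
      in-union : ∀ s {v} → v ∈ S s →
        v Subset.∈ side G (A ∪ proj₁ (⟦_⟧ G S) , B ∪ proj₂ (⟦_⟧ G S)) s
      in-union left  v∈ = Subset.x∈p∪q⁺ {p = A} (inj₂ (∈-⟦⟧⁺ S left v∈))
      in-union right v∈ = Subset.x∈p∪q⁺ {p = B} (inj₂ (∈-⟦⟧⁺ S right v∈))
    ... | no ≢H = ⊥-elim (max
      (_ , _ , ((λ v∈ → ⊆W v∈) , (λ v∈ → ⊆W′ v∈)) , biclique′ , ∪-⊑ H (⟦_⟧ G S) , ≢H))
      where
      split : ∀ {n} {p q : Subset n} {i} → i Subset.∈ p ∪ q → i Subset.∈ p ⊎ i Subset.∈ q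
      split {p = p} {q} = Subset.x∈p∪q⁻ p q
      ⊆W : A ∪ proj₁ (⟦_⟧ G S) ⊆ proj₁ (⟦_⟧ G W)
      ⊆W v∈ with split {p = A} v∈
      ... | inj₁ v∈A = proj₁ H⊑W v∈A
      ... | inj₂ v∈S = ∈-⟦⟧⁺ W left (∪ᵥ⁺ S C left (inj₁ (∈-⟦⟧⁻ S left v∈S)))
      ⊆W′ : B ∪ proj₂ (⟦_⟧ G S) ⊆ proj₂ (⟦_⟧ G W)
      ⊆W′ v∈ with split {p = B} v∈
      ... | inj₁ v∈B = proj₂ H⊑W v∈B
      ... | inj₂ v∈S = ∈-⟦⟧⁺ W right (∪ᵥ⁺ S C right (inj₁ (∈-⟦⟧⁻ S right v∈S)))
      biclique′ : IsBiclique G (A ∪ proj₁ (⟦_⟧ G S) , B ∪ proj₂ (⟦_⟧ G S))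
      biclique′ u u∈ w w∈ with split {p = A} u∈ | split {p = B} w∈
      ... | inj₁ u∈A | inj₁ w∈B = biclique u u∈A w w∈B
      ... | inj₂ u∈S | _ = joined (∈-⟦⟧⁻ W left (⊆W u∈)) (∈-⟦⟧⁻ W right (⊆W′ w∈))
                             (inj₁ (∈-⟦⟧⁻ S left u∈S))
      ... | inj₁ _ | inj₂ w∈S = joined (∈-⟦⟧⁻ W left (⊆W u∈)) (∈-⟦⟧⁻ W right (⊆W′ w∈))
                             (inj₂ (∈-⟦⟧⁻ S right w∈S))

    left-only right-only : Sub G
    left-only  = proj₁ (⟦_⟧ G W) , ⊥
    right-only = ⊥ , proj₂ (⟦_⟧ G W)

    -- If both sides are non-empty, a biclique of G above `H` contains S, so by `complete` and the
    -- emptiness of X it lies in W and equals `H`. If one side is empty, the other must be the whole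
    -- side of W.
    maximal-cases : ∀ {H} → Large 0 (⟦_⟧ G W) H →
      left-only ≡ H ⊎ (right-only ≡ H ⊎ Reachable S C H)
    maximal-cases {A , B} (max@(H⊑W , biclique , maximal) , _)
      with Subset.nonempty? A | Subset.nonempty? B
    ... | yes (u , u∈) | yes (w , w∈) = inj₂ (inj₂
      (((((λ _ → Subset.∈⊤) , (λ _ → Subset.∈⊤)) , biclique , maximal′) ,
        nonempty-size u∈ , nonempty-size w∈) ,
       ⊆ᵥ⇒⊑ {S} {A , B} S⊆H , H⊑W))
      where
      S⊆H = S⊑maximal {A , B} max
      nonempty-size : ∀ {n} {p : Subset n} {i} → i Subset.∈ p → 1 ≤ ∣ p ∣
      nonempty-size {p = p} i∈ = ≤-trans (∈-length (∈-elements⁺ i∈)) (≤-reflexive (length-elements p))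
      maximal′ : ¬ (∃₂ λ A′ B′ → _⊑_ G (A′ , B′) (whole G) × IsBiclique G (A′ , B′) ×
                   _⊑_ G (A , B) (A′ , B′) × (A′ , B′) ≢ (A , B))
      maximal′ (A′ , B′ , _ , biclique′ , H⊑H′ , ≢H) = maximal
        (A′ , B′ , ⊇ᵥ⇒⊑ {W} {A′ , B′} H′⊆W , biclique′ , H⊑H′ , ≢H)
        where
        S⊆H′ : S ⊆ᵥ (A′ , B′)
        S⊆H′ left  v∈ = proj₁ H⊑H′ (S⊆H left v∈)
        S⊆H′ right v∈ = proj₂ H⊑H′ (S⊆H right v∈)
        H′⊆W : W ⊇ᵥ (A′ , B′)
        H′⊆W s v∈ with complete biclique′ S⊆H′ (u , proj₁ H⊑H′ u∈) (w , proj₂ H⊑H′ w∈) s v∈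
        ... | inj₁ v∈W = v∈W
        ... | inj₂ v∈X = contradiction v∈X (X≡[] s)
    ... | _ | no B-empty with left-only ≟ˢ (A , B)
    ...   | yes eq = inj₁ eq
    ...   | no ≢H = ⊥-elim (maximal
      (_ , _ , ((λ u∈ → u∈) , λ w∈ → contradiction w∈ Subset.∉⊥) ,
       (λ _ _ _ w∈ → contradiction w∈ Subset.∉⊥) ,
       (proj₁ H⊑W , λ w∈ → contradiction (_ , w∈) B-empty) , ≢H))
    maximal-cases {A , B} (max@(H⊑W , biclique , maximal) , _)
        | no A-empty | yes _ with right-only ≟ˢ (A , B)
    ...   | yes eq = inj₂ (inj₁ eq)
    ...   | no ≢H = ⊥-elim (maximal
      (_ , _ , ((λ u∈ → contradiction u∈ Subset.∉⊥) , λ w∈ → w∈) ,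
       (λ _ u∈ _ _ → contradiction u∈ Subset.∉⊥) ,
       ((λ u∈ → contradiction (_ , u∈) A-empty) , proj₂ H⊑W) , ≢H))

    leaf-count : length (maximalBicliques G (λ _ → 0) (⟦_⟧ G W)) ≤ 2 + #reachable S C
    leaf-count = begin
      count (large? 0 (⟦_⟧ G W)) all-subs
        ≤⟨ count-cover (large? 0 (⟦_⟧ G W)) (left-only ≟ˢ_)
             (λ H → (right-only ≟ˢ H) ⊎-dec reachable? S C H) maximal-cases all-subs ⟩
      count (left-only ≟ˢ_) all-subs + count (λ H → (right-only ≟ˢ H) ⊎-dec reachable? S C H) all-subs
        ≤⟨ +-mono-≤ (count-≡ _≟ˢ_ left-only all-subs-unique)
             (count-cover (λ H → (right-only ≟ˢ H) ⊎-dec reachable? S C H) (right-only ≟ˢ_)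
               (reachable? S C) id all-subs) ⟩
      1 + (count (right-only ≟ˢ_) all-subs + #reachable S C)
        ≤⟨ s≤s (+-monoˡ-≤ _ (count-≡ _≟ˢ_ right-only all-subs-unique)) ⟩
      2 + #reachable S C ∎
      where open ≤-Reasoning

  #vertices≤ : ∀ W → #vertices G (⟦_⟧ G W) ≤ length (W left) + length (W right)
  #vertices≤ W = +-mono-≤ (∣∣≤length {xs = W left} (∈-⟦⟧⁻ W left)) (∣∣≤length {xs = W right} (∈-⟦⟧⁻ W right))

  #edges≤ : ∀ W → #edges G (⟦_⟧ G W) ≤ length (W left) * length (W right)
  #edges≤ W = ≤-trans
    (length-⊆ (×-≡-dec Fin._≟_ Fin._≟_) {ys = cartesianProduct (W left) (W right)}
      (Unique.filter⁺ present? (Unique.cartesianProduct⁺ (Unique.allFin⁺ _) (Unique.allFin⁺ _)))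
      λ e∈ → let _ , u∈ , w∈ , _ = ∈-filter⁻ present? {xs = cartesianProduct (allFin _) (allFin _)} e∈ in
        ∈-cartesianProduct⁺ (∈-⟦⟧⁻ W left u∈) (∈-⟦⟧⁻ W right w∈))
    (≤-reflexive (length-cartesianProduct (W left) (W right)))
    where
    Present : Pred (V G left × V G right) 0ℓ
    Present (u , w) = u Subset.∈ proj₁ (⟦_⟧ G W) × w Subset.∈ proj₂ (⟦_⟧ G W) × T (edge u w)
    present? : Decidable Present
    present? (u , w) = (u Subset.∈? proj₁ (⟦_⟧ G W)) ×-dec (w Subset.∈? proj₂ (⟦_⟧ G W)) ×-dec T? (edge u w)

  -- Taking and excluding a vertex of a valid branch

  takeS takeC takeX dropC dropX : ∀ s → V G s → VSet G → VSet G
  takeS s w S = assemble G s (w ∷ S s) (S (opp s))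
  takeC s w C = assemble G s (remove w (C s)) (filterᵇ (adj G s w) (C (opp s)))
  takeX s w X = assemble G s (X s) (filterᵇ (adj G s w) (X (opp s)))
  dropC s w C = assemble G s (remove w (C s)) (C (opp s))
  dropX s w X = assemble G s (w ∷ X s) (X (opp s))

  module _ {S C X : VSet G} (valid : Valid S C X) where
    open Valid valid

    S⊆take : ∀ s w t {v} → v ∈ S t → v ∈ takeS s w S t
    S⊆take left  w left  = there
    S⊆take left  w right = id
    S⊆take right w left  = id
    S⊆take right w right = there

    w∈take : ∀ s w → w ∈ takeS s w S s
    w∈take left  w = here refl
    w∈take right w = here refl

    takeC⊆C : ∀ s w t {v} → v ∈ takeC s w C t → v ∈ C t
    takeC⊆C left  w left  = proj₁ ∘ ∈-remove⁻
    takeC⊆C left  w right = proj₁ ∘ ∈-filterᵇ⁻ (adj G left w)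
    takeC⊆C right w left  = proj₁ ∘ ∈-filterᵇ⁻ (adj G right w)
    takeC⊆C right w right = proj₁ ∘ ∈-remove⁻

    dropC⊆C : ∀ s w t {v} → v ∈ dropC s w C t → v ∈ C t
    dropC⊆C left  w left  = proj₁ ∘ ∈-remove⁻
    dropC⊆C left  w right = id
    dropC⊆C right w left  = id
    dropC⊆C right w right = proj₁ ∘ ∈-remove⁻

    w∉dropC : ∀ s w → w ∉ dropC s w C s
    w∉dropC left  w w∈ = proj₂ (∈-remove⁻ {v = w} {us = C left} w∈) refl
    w∉dropC right w w∈ = proj₂ (∈-remove⁻ {v = w} {us = C right} w∈) refl

    take⊆W : ∀ s w → w ∈ C s → ∀ t {v} → v ∈ (takeS s w S ∪ᵥ takeC s w C) t → v ∈ (S ∪ᵥ C) t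
    take⊆W s w w∈ t v∈ with ∪ᵥ⁻ (takeS s w S) (takeC s w C) t v∈
    ... | inj₂ v∈C = ∪ᵥ⁺ S C t (inj₂ (takeC⊆C s w t v∈C))
    take⊆W left  w w∈ left  v∈ | inj₁ (here refl)  = ∪ᵥ⁺ S C left (inj₂ w∈)
    take⊆W left  w w∈ left  v∈ | inj₁ (there v∈S) = ∪ᵥ⁺ S C left (inj₁ v∈S)
    take⊆W left  w w∈ right v∈ | inj₁ v∈S         = ∪ᵥ⁺ S C right (inj₁ v∈S)
    take⊆W right w w∈ left  v∈ | inj₁ v∈S         = ∪ᵥ⁺ S C left (inj₁ v∈S)
    take⊆W right w w∈ right v∈ | inj₁ (here refl)  = ∪ᵥ⁺ S C right (inj₂ w∈)
    take⊆W right w w∈ right v∈ | inj₁ (there v∈S) = ∪ᵥ⁺ S C right (inj₁ v∈S)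

    drop⊆W : ∀ s w t {v} → v ∈ (S ∪ᵥ dropC s w C) t → v ∈ (S ∪ᵥ C) t
    drop⊆W s w t v∈ with ∪ᵥ⁻ S (dropC s w C) t v∈
    ... | inj₁ v∈S = ∪ᵥ⁺ S C t (inj₁ v∈S)
    ... | inj₂ v∈C = ∪ᵥ⁺ S C t (inj₂ (dropC⊆C s w t v∈C))

    valid-take : ∀ s {w} → w ∈ C s → Valid (takeS s w S) (takeC s w C) (takeX s w X)
    valid-take s {w} w∈ = record
      { unique = unique′ s ; apart = apart′ s w∈ ; joined = joined′ s w∈ ; complete = complete′ s w∈ }
      where
      unique′ : ∀ s {w} t → Unique (takeC s w C t)
      unique′ left  left  = Unique.filter⁺ (T? ∘ other _) (unique left)
      unique′ left  right = Unique.filter⁺ (T? ∘ adj G left _) (unique right)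
      unique′ right left  = Unique.filter⁺ (T? ∘ adj G right _) (unique left)
      unique′ right right = Unique.filter⁺ (T? ∘ other _) (unique right)
      apart′ : ∀ s {w} → w ∈ C s → ∀ t {v} → v ∈ takeS s w S t → v ∉ takeC s w C t
      apart′ left  {w} w∈ left  (here refl)  v∈C = proj₂ (∈-remove⁻ {us = C left} v∈C) refl
      apart′ left  {w} w∈ left  (there v∈S) v∈C = apart left v∈S (takeC⊆C left w left v∈C)
      apart′ left  {w} w∈ right v∈S         v∈C = apart right v∈S (takeC⊆C left w right v∈C)
      apart′ right {w} w∈ left  v∈S         v∈C = apart left v∈S (takeC⊆C right w left v∈C)
      apart′ right {w} w∈ right (here refl)  v∈C = proj₂ (∈-remove⁻ {us = C right} v∈C) refl
      apart′ right {w} w∈ right (there v∈S) v∈C = apart right v∈S (takeC⊆C right w right v∈C)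
      joined′ : ∀ s {w} → w ∈ C s → ∀ {u z} → u ∈ (takeS s w S ∪ᵥ takeC s w C) left →
        z ∈ (takeS s w S ∪ᵥ takeC s w C) right → u ∈ takeS s w S left ⊎ z ∈ takeS s w S right →
        T (edge u z)
      joined′ left {w} w∈ u∈ z∈ (inj₁ (here refl))
        with ∪ᵥ⁻ (takeS left w S) (takeC left w C) right z∈
      ... | inj₁ z∈S = joined (∪ᵥ⁺ S C left (inj₂ w∈)) (∪ᵥ⁺ S C right (inj₁ z∈S)) (inj₂ z∈S)
      ... | inj₂ z∈C = proj₂ (∈-filterᵇ⁻ (adj G left w) {xs = C right} z∈C)
      joined′ left  {w} w∈ u∈ z∈ (inj₁ (there u∈S)) =
        joined (take⊆W left w w∈ left u∈) (take⊆W left w w∈ right z∈) (inj₁ u∈S)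
      joined′ left  {w} w∈ u∈ z∈ (inj₂ z∈S) =
        joined (take⊆W left w w∈ left u∈) (take⊆W left w w∈ right z∈) (inj₂ z∈S)
      joined′ right {w} w∈ u∈ z∈ (inj₂ (here refl))
        with ∪ᵥ⁻ (takeS right w S) (takeC right w C) left u∈
      ... | inj₁ u∈S = joined (∪ᵥ⁺ S C left (inj₁ u∈S)) (∪ᵥ⁺ S C right (inj₂ w∈)) (inj₁ u∈S)
      ... | inj₂ u∈C = proj₂ (∈-filterᵇ⁻ (adj G right w) {xs = C left} u∈C)
      joined′ right {w} w∈ u∈ z∈ (inj₂ (there z∈S)) =
        joined (take⊆W right w w∈ left u∈) (take⊆W right w w∈ right z∈) (inj₂ z∈S)
      joined′ right {w} w∈ u∈ z∈ (inj₁ u∈S) =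
        joined (take⊆W right w w∈ left u∈) (take⊆W right w w∈ right z∈) (inj₁ u∈S)
      complete′ : ∀ s {w} → w ∈ C s → ∀ {H} → IsBiclique G H → takeS s w S ⊆ᵥ H →
        Nonempty (proj₁ H) → Nonempty (proj₂ H) →
        ∀ t {v} → v Subset.∈ side G H t → v ∈ (takeS s w S ∪ᵥ takeC s w C) t ⊎ v ∈ takeX s w X t
      complete′ s {w} w∈ {H} biclique S⊆H l r t {v} v∈
        with complete {H} biclique (λ t v∈S → S⊆H t (S⊆take s w t v∈S)) l r t v∈
      ... | inj₁ v∈W with ∪ᵥ⁻ S C t v∈W
      ...   | inj₁ v∈S = inj₁ (∪ᵥ⁺ (takeS s w S) (takeC s w C) t (inj₁ (S⊆take s w t v∈S)))
      complete′ left {w} w∈ {H} biclique S⊆H l r left {v} v∈ | inj₁ _ | inj₂ v∈C with v Fin.≟ w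
      ... | yes refl = inj₁ (∪ᵥ⁺ (takeS left w S) (takeC left w C) left (inj₁ (here refl)))
      ... | no v≢w   = inj₁ (∪ᵥ⁺ (takeS left w S) (takeC left w C) left (inj₂ (∈-remove⁺ v∈C v≢w)))
      complete′ left {w} w∈ {H} biclique S⊆H l r right {v} v∈ | inj₁ _ | inj₂ v∈C =
        inj₁ (∪ᵥ⁺ (takeS left w S) (takeC left w C) right
          (inj₂ (∈-filterᵇ⁺ (adj G left w) v∈C (biclique w (S⊆H left (here refl)) v v∈))))
      complete′ right {w} w∈ {H} biclique S⊆H l r left {v} v∈ | inj₁ _ | inj₂ v∈C =
        inj₁ (∪ᵥ⁺ (takeS right w S) (takeC right w C) left
          (inj₂ (∈-filterᵇ⁺ (adj G right w) v∈C (biclique v v∈ w (S⊆H right (here refl))))))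
      complete′ right {w} w∈ {H} biclique S⊆H l r right {v} v∈ | inj₁ _ | inj₂ v∈C with v Fin.≟ w
      ... | yes refl = inj₁ (∪ᵥ⁺ (takeS right w S) (takeC right w C) right (inj₁ (here refl)))
      ... | no v≢w   = inj₁ (∪ᵥ⁺ (takeS right w S) (takeC right w C) right (inj₂ (∈-remove⁺ v∈C v≢w)))
      complete′ left  {w} w∈ {H} biclique S⊆H l r left  {v} v∈ | inj₂ v∈X = inj₂ v∈X
      complete′ left  {w} w∈ {H} biclique S⊆H l r right {v} v∈ | inj₂ v∈X =
        inj₂ (∈-filterᵇ⁺ (adj G left w) v∈X (biclique w (S⊆H left (here refl)) v v∈))
      complete′ right {w} w∈ {H} biclique S⊆H l r left  {v} v∈ | inj₂ v∈X =
        inj₂ (∈-filterᵇ⁺ (adj G right w) v∈X (biclique v v∈ w (S⊆H right (here refl))))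
      complete′ right {w} w∈ {H} biclique S⊆H l r right {v} v∈ | inj₂ v∈X = inj₂ v∈X

    valid-drop : ∀ s w → Valid S (dropC s w C) (dropX s w X)
    valid-drop s w = record
      { unique   = unique′ s
      ; apart    = λ t v∈S v∈C → apart t v∈S (dropC⊆C s w t v∈C)
      ; joined   = λ u∈ z∈ → joined (drop⊆W s w left u∈) (drop⊆W s w right z∈)
      ; complete = λ {H} biclique S⊆H l r t v∈ → complete′ s w t (complete {H} biclique S⊆H l r t v∈)
      }
      where
      unique′ : ∀ s {w} t → Unique (dropC s w C t)
      unique′ left  left  = Unique.filter⁺ (T? ∘ other _) (unique left)
      unique′ left  right = unique right
      unique′ right left  = unique left
      unique′ right right = Unique.filter⁺ (T? ∘ other _) (unique right)
      complete′ : ∀ s w t {v} → v ∈ (S ∪ᵥ C) t ⊎ v ∈ X t →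
        v ∈ (S ∪ᵥ dropC s w C) t ⊎ v ∈ dropX s w X t
      complete′ s w t (inj₁ v∈W) with ∪ᵥ⁻ S C t v∈W
      ... | inj₁ v∈S = inj₁ (∪ᵥ⁺ S (dropC s w C) t (inj₁ v∈S))
      complete′ left w left {v} (inj₁ _) | inj₂ v∈C with v Fin.≟ w
      ... | yes refl = inj₂ (here refl)
      ... | no v≢w   = inj₁ (∪ᵥ⁺ S (dropC left w C) left (inj₂ (∈-remove⁺ v∈C v≢w)))
      complete′ left  w right (inj₁ _) | inj₂ v∈C = inj₁ (∪ᵥ⁺ S (dropC left w C) right (inj₂ v∈C))
      complete′ right w left  (inj₁ _) | inj₂ v∈C = inj₁ (∪ᵥ⁺ S (dropC right w C) left (inj₂ v∈C))
      complete′ right w right {v} (inj₁ _) | inj₂ v∈C with v Fin.≟ w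
      ... | yes refl = inj₂ (here refl)
      ... | no v≢w   = inj₁ (∪ᵥ⁺ S (dropC right w C) right (inj₂ (∈-remove⁺ v∈C v≢w)))
      complete′ left  w left  (inj₂ v∈X) = inj₂ (there v∈X)
      complete′ left  w right (inj₂ v∈X) = inj₂ v∈X
      complete′ right w left  (inj₂ v∈X) = inj₂ v∈X
      complete′ right w right (inj₂ v∈X) = inj₂ (there v∈X)

    -- A biclique below the child contains `w`, while one left for the later branching vertices does
    -- not, as `w` has gone from both S and C. So each biclique is charged to at most one child.
    #reachable-split : ∀ s {w} → w ∈ C s →
      #reachable (takeS s w S) (takeC s w C) + #reachable S (dropC s w C) ≤ #reachable S C
    #reachable-split s {w} w∈ = count-disjoint
      (reachable? (takeS s w S) (takeC s w C)) (reachable? S (dropC s w C)) (reachable? S C)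
      (λ {H} (large , S⊑H , H⊑W) → large ,
        ⊆ᵥ⇒⊑ {S} {H} (λ t v∈ → ⊑⇒⊆ᵥ {takeS s w S} {H} S⊑H t (S⊆take s w t v∈)) ,
        ⊇ᵥ⇒⊑ {S ∪ᵥ C} {H} (λ t v∈ → take⊆W s w w∈ t (⊑⇒⊇ᵥ {takeS s w S ∪ᵥ takeC s w C} {H} H⊑W t v∈)))
      (λ {H} (large , S⊑H , H⊑W) → large , S⊑H ,
        ⊇ᵥ⇒⊑ {S ∪ᵥ C} {H} (λ t v∈ → drop⊆W s w t (⊑⇒⊇ᵥ {S ∪ᵥ dropC s w C} {H} H⊑W t v∈)))
      (λ {H} (_ , S⊑H , _) (_ , _ , H⊑W) → excluded {H}
        (⊑⇒⊇ᵥ {S ∪ᵥ dropC s w C} {H} H⊑W s (⊑⇒⊆ᵥ {takeS s w S} {H} S⊑H s (w∈take s w))))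
      all-subs
      where
      excluded : ∀ {H : Sub G} → w ∉ (S ∪ᵥ dropC s w C) s
      excluded w∈W with ∪ᵥ⁻ S (dropC s w C) s w∈W
      ... | inj₁ w∈S = apart s w∈S w∈
      ... | inj₂ w∈C = w∉dropC s w w∈C

-- Pivots and branches

module Algorithm (G : BipartiteGraph) {K₀ : ℕ}
                 (biplex : BiplexProcedure G K₀) (choices : Choices G) where
  open BipartiteGraph G
  open IPS G (λ _ → 1) biplex choices
  open BiplexProcedure biplex
  open Choices choices
  open Counting G

  ∣_∣ᵥ : VSet G → ℕ
  ∣ Z ∣ᵥ = length (Z left) + length (Z right)

  side≤ : ∀ Z s → length (Z s) ≤ ∣ Z ∣ᵥ
  side≤ Z left  = m≤m+n _ _
  side≤ Z right = m≤n+m _ _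

  module _ {N : ℕ} (1≤N : 1 ≤ N) where

    one¹ : Cost N 1 1 1
    one¹ = raise 1≤N one

    one² : Cost N 2 1 1
    one² = raise 1≤N one¹

    adjacent-cost : ∀ s v Y → length Y < N → Cost N 1 (time (filterᵖ (adjacent G s v) Y)) 2
    adjacent-cost s v Y Y< = filterᵖ-cost (adjacent G s v) Y Y< (λ _ → one)

    nonadjacent-cost : ∀ s v Y → length Y < N → Cost N 1 (time (filterᵖ (nonadjacent G s v) Y)) 2
    nonadjacent-cost s v Y Y< = filterᵖ-cost (nonadjacent G s v) Y Y< (λ _ → one)

    d̄-cost : ∀ s v Y → length Y < N → Cost N 1 (time (d̄ G s v Y)) 3
    d̄-cost s v Y Y< = nonadjacent-cost s v Y Y< ⊕
      lengthᵖ-cost (value (filterᵖ (nonadjacent G s v) Y)) (≤-<-trans (length-filterᵖ (nonadjacent G s v) Y) Y<)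

    2biplexᵖ-cost : ∀ W → (∀ s → length (W s) < N) → Cost N 2 (time (2biplexᵖ W)) 10
    2biplexᵖ-cost W W< = ok left ⊕ ok right ⊕ free
      where
      few : ∀ s → V G s → Run G Bool
      few s v = d̄ G s v (W (opp s)) >>= λ k → spend 1 >> return (k ≤ᵇ 2)
      ok : ∀ s → Cost N 2 (time (allᵖ (few s) (W s))) 5
      ok s = (filterᵖ-cost (notᵖ ∘ few s) (W s) (W< s)
               (λ v → (d̄-cost s v (W (opp s)) (W< (opp s)) ⊕ one¹) ⊕ free) ⊕ free) ⊕ free

    prunedᵖ-cost : ∀ W S C X → (∀ s → length (W s) < N) → (∀ s → length (C s) < N) →
      (∀ s → length (X s) < N) → Cost N 2 (time (prunedᵖ W (branch S C X))) 10
    prunedᵖ-cost W S C X W< C< X< =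
      small left ⊕ small right ⊕ dominated left ⊕ dominated right ⊕ free
      where
      small : ∀ s → Cost N 2 (time (lengthᵖ {O = Sub G} (W s)) + 1) 2
      small s = raise 1≤N (lengthᵖ-cost (W s) (W< s)) ⊕ one²
      dominated : ∀ s →
        Cost N 2 (time (anyᵖ (λ v → allᵖ (adjacent G s v) (C (opp s))) (X s))) 3
      dominated s = filterᵖ-cost (λ v → allᵖ (adjacent G s v) (C (opp s))) (X s) (X< s)
        (λ v → (nonadjacent-cost s v (C (opp s)) (C< (opp s)) ⊕ free) ⊕ free) ⊕ free

    append-cost : ∀ {A : Set} (xs ys : List A) → length xs < N →
      Cost N 2 (time (_++ᵖ_ {O = Sub G} xs ys)) 1
    append-cost xs ys xs< = raise 1≤N (within xs<) ⊕ free

  module Rated (C X : VSet G) where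

    -- Copies of local functions of the algorithm, which have no names outside it;
    -- likewise stepᵖ, branchOnᵖ and insertᵖ below.

    C′ᵖ : ∀ s → V G s → Run G Bool
    C′ᵖ s v = d̄ G s v (X (opp s)) >>= λ x → d̄ G s v (C (opp s)) >>= λ c →
              spend 1 >> return ((x ≡ᵇ 0) ∧ (c ≤ᵇ 2))

    rateᵖ : ∀ s → Bool → V G s → Run G (Candidate G)
    rateᵖ s x v = d̄ G s v (C (opp s)) >>= λ k → return (candidate v x k)

    near far near-far : ∀ s → List (V G s)
    near s = value (filterᵖ (C′ᵖ s) (C s))
    far s  = value (filterᵖ (λ v → notᵖ (C′ᵖ s v)) (C s))
    near-far s = value (filterᵖ (λ v → anyᵖ (nonadjacent G s v) (far (opp s))) (near s))

    rated : ∀ s → Bool → List (V G s) → List (Candidate G)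
    rated s x vs = value (mapᵖ (rateᵖ s x) vs)

    near≤ : ∀ s → length (near s) ≤ length (C s)
    near≤ s = length-filterᵖ (C′ᵖ s) (C s)

    far≤ : ∀ s → length (far s) ≤ length (C s)
    far≤ s = length-filterᵖ (λ v → notᵖ (C′ᵖ s v)) (C s)

    near-far≤ : ∀ s → length (near-far s) ≤ length (C s)
    near-far≤ s = ≤-trans
      (length-filterᵖ (λ v → anyᵖ (nonadjacent G s v) (far (opp s))) (near s)) (near≤ s)

    rated≤ : ∀ s x vs {n} → length vs ≤ n → length (rated s x vs) ≤ n
    rated≤ s x vs vs≤ = ≤-trans (≤-reflexive (length-mapᵖ (rateᵖ s x) vs)) vs≤

    both≤ : ∀ (xs ys : List (Candidate G)) {m n} → length xs ≤ m → length ys ≤ n →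
      length (xs ++ ys) ≤ m + n
    both≤ xs ys xs≤ ys≤ = ≤-trans (≤-reflexive (length-++ xs)) (+-mono-≤ xs≤ ys≤)

    rated-X rated-far rated-near-far : List (Candidate G)
    rated-X        = rated left true (X left) ++ rated right true (X right)
    rated-far      = rated left false (far left) ++ rated right false (far right)
    rated-near-far = rated left false (near-far left) ++ rated right false (near-far right)

    all-candidates : List (Candidate G)
    all-candidates = rated-X ++ rated-far ++ rated-near-far

    rated-X≤ : length rated-X ≤ ∣ X ∣ᵥ
    rated-X≤ = both≤ (rated left true (X left)) (rated right true (X right))
      (rated≤ left true (X left) ≤-refl) (rated≤ right true (X right) ≤-refl)

    rated-far≤ : length rated-far ≤ ∣ C ∣ᵥ
    rated-far≤ = both≤ (rated left false (far left)) (rated right false (far right))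
      (rated≤ left false (far left) (far≤ left)) (rated≤ right false (far right) (far≤ right))

    rated-near-far≤ : length rated-near-far ≤ ∣ C ∣ᵥ
    rated-near-far≤ = both≤ (rated left false (near-far left)) (rated right false (near-far right))
      (rated≤ left false (near-far left) (near-far≤ left))
      (rated≤ right false (near-far right) (near-far≤ right))

    module _ {N : ℕ} (1≤N : 1 ≤ N) (C<N : ∣ C ∣ᵥ < N) (X<N : ∣ X ∣ᵥ < N) where

      private
        C< : ∀ s → length (C s) < N
        C< s = ≤-<-trans (side≤ C s) C<N
        X< : ∀ s → length (X s) < N
        X< s = ≤-<-trans (side≤ X s) X<N

      candidates-cost : ∀ S → Cost N 2 (time (candidates (branch S C X))) 67
      candidates-cost S =
        C′ left ⊕ C′ right ⊕ D left ⊕ D right ⊕ C2 left ⊕ C2 right ⊕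
        rates left true (X left) (X< left) ⊕ rates right true (X right) (X< right) ⊕
        rates left false (far left) (≤-<-trans (far≤ left) (C< left)) ⊕
        rates right false (far right) (≤-<-trans (far≤ right) (C< right)) ⊕
        rates left false (near-far left) (≤-<-trans (near-far≤ left) (C< left)) ⊕
        rates right false (near-far right) (≤-<-trans (near-far≤ right) (C< right)) ⊕
        append-cost 1≤N (rated left true (X left)) (rated right true (X right))
          (≤-<-trans (rated≤ left true (X left) ≤-refl) (X< left)) ⊕
        append-cost 1≤N (rated left false (far left)) (rated right false (far right))
          (≤-<-trans (rated≤ left false (far left) (far≤ left)) (C< left)) ⊕
        append-cost 1≤N (rated left false (near-far left)) (rated right false (near-far right))
          (≤-<-trans (rated≤ left false (near-far left) (near-far≤ left)) (C< left)) ⊕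
        append-cost 1≤N rated-far rated-near-far (≤-<-trans rated-far≤ C<N) ⊕
        append-cost 1≤N rated-X (rated-far ++ rated-near-far) (≤-<-trans rated-X≤ X<N)
        where
        test : ∀ s v → Cost N 1 (time (C′ᵖ s v)) 7
        test s v = d̄-cost 1≤N s v (X (opp s)) (X< (opp s)) ⊕
                   d̄-cost 1≤N s v (C (opp s)) (C< (opp s)) ⊕ one¹ 1≤N
        C′ : ∀ s → Cost N 2 (time (filterᵖ (C′ᵖ s) (C s))) 8
        C′ s = filterᵖ-cost (C′ᵖ s) (C s) (C< s) (test s)
        D : ∀ s → Cost N 2 (time (filterᵖ (λ v → notᵖ (C′ᵖ s v)) (C s))) 8
        D s = filterᵖ-cost (λ v → notᵖ (C′ᵖ s v)) (C s) (C< s) (λ v → test s v ⊕ free)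
        C2 : ∀ s → Cost N 2 (time (filterᵖ (λ v → anyᵖ (nonadjacent G s v) (far (opp s))) (near s))) 3
        C2 s = filterᵖ-cost (λ v → anyᵖ (nonadjacent G s v) (far (opp s))) (near s)
          (≤-<-trans (near≤ s) (C< s))
          (λ v → nonadjacent-cost 1≤N s v (far (opp s)) (≤-<-trans (far≤ (opp s)) (C< (opp s))) ⊕ free)
        rates : ∀ s x vs → length vs < N → Cost N 2 (time (mapᵖ (rateᵖ s x) vs)) 4
        rates s x vs vs< = mapᵖ-cost (rateᵖ s x) vs vs<
          (λ v → d̄-cost 1≤N s v (C (opp s)) (C< (opp s)) ⊕ free)

      candidates≤ : length all-candidates ≤ 3 * N
      candidates≤ = ≤-trans
        (both≤ rated-X (rated-far ++ rated-near-far) rated-X≤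
          (both≤ rated-far rated-near-far rated-far≤ rated-near-far≤))
        (+-mono-≤ (<⇒≤ X<N) (+-mono-≤ (<⇒≤ C<N)
          (≤-trans (<⇒≤ C<N) (≤-reflexive (sym (+-identityʳ N))))))

    -- Degrees and candidate pivots

    degree degreeX : ∀ s → V G s → ℕ
    degree s v  = length (filterᵇ (not ∘ adj G s v) (C (opp s)))
    degreeX s v = length (filterᵇ (not ∘ adj G s v) (X (opp s)))

    Far : ∀ s → V G s → Set
    Far s v = 1 ≤ degreeX s v ⊎ 3 ≤ degree s v

    value-d̄ : ∀ s v Y → value (d̄ G s v Y) ≡ length (filterᵇ (not ∘ adj G s v) Y)
    value-d̄ s v Y = trans (value-lengthᵖ (value (filterᵖ (nonadjacent G s v) Y)))
                          (cong length (value-filterᵖ (nonadjacent G s v) Y))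

    C′⁻ : ∀ s v → T (value (C′ᵖ s v)) → degreeX s v ≤ 0 × degree s v ≤ 2
    C′⁻ s v t with t₁ , t₂ ← Equivalence.to T-∧ t =
      ≤-reflexive (trans (sym (value-d̄ s v (X (opp s)))) (≡ᵇ⇒≡ _ 0 t₁)) ,
      ≤-trans (≤-reflexive (sym (value-d̄ s v (C (opp s))))) (≤ᵇ⇒≤ _ 2 t₂)

    C′⁺ : ∀ s v → degreeX s v ≤ 0 → degree s v ≤ 2 → T (value (C′ᵖ s v))
    C′⁺ s v x≤0 c≤2 = Equivalence.from T-∧
      ( ≡⇒≡ᵇ _ 0 (trans (value-d̄ s v (X (opp s))) (n≤0⇒n≡0 x≤0))
      , ≤⇒≤ᵇ (≤-trans (≤-reflexive (value-d̄ s v (C (opp s)))) c≤2))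

    far⁺ : ∀ s {v} → v ∈ C s → Far s v → v ∈ far s
    far⁺ s {v} v∈ f = ∈-filterᵖ⁺ (λ v → notᵖ (C′ᵖ s v)) v∈ (not⁺ _ λ t → excluded f (C′⁻ s v t))
      where
      excluded : Far s v → ¬ (degreeX s v ≤ 0 × degree s v ≤ 2)
      excluded (inj₁ x≥1) (x≤0 , _) = contradiction (≤-trans x≥1 x≤0) λ ()
      excluded (inj₂ c≥3) (_ , c≤2) = contradiction (≤-trans c≥3 c≤2) λ { (s≤s (s≤s ())) }

    far⁻ : ∀ s {v} → v ∈ far s → v ∈ C s × Far s v
    far⁻ s {v} v∈ with v∈C , ¬t ← ∈-filterᵖ⁻ (λ v → notᵖ (C′ᵖ s v)) v∈ = v∈C , go
      where
      go : Far s v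
      go with 1 ≤? degreeX s v | 3 ≤? degree s v
      ... | yes x≥1 | _       = inj₁ x≥1
      ... | no _    | yes c≥3 = inj₂ c≥3
      ... | no x≱1  | no c≱3  =
        contradiction (C′⁺ s v (s≤s⁻¹ (≰⇒> x≱1)) (s≤s⁻¹ (≰⇒> c≱3))) (not⁻ _ ¬t)

    far-or-near : ∀ s {v} → v ∈ C s → v ∈ far s ⊎ v ∈ near s
    far-or-near s {v} v∈ with T? (value (C′ᵖ s v))
    ... | yes t = inj₂ (∈-filterᵖ⁺ (C′ᵖ s) v∈ t)
    ... | no ¬t = inj₁ (∈-filterᵖ⁺ (λ v → notᵖ (C′ᵖ s v)) v∈ (not⁺ _ ¬t))

    record Near (s : Side) (v : V G s) : Set where
      field
        degreeX≤0 : degreeX s v ≤ 0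
        degree≤2  : degree s v ≤ 2
        {other-end} : V G (opp s)
        in-C      : other-end ∈ C (opp s)
        non-edge  : T (not (adj G s v other-end))
        is-far    : Far (opp s) other-end

    near-far⁻ : ∀ s {v} → v ∈ near-far s → v ∈ C s × Near s v
    near-far⁻ s {v} v∈ =
      let v∈near , t     = ∈-filterᵖ⁻ (λ v → anyᵖ (nonadjacent G s v) (far (opp s))) {xs = near s} v∈
          v∈C , t′       = ∈-filterᵖ⁻ (C′ᵖ s) {xs = C s} v∈near
          w , w∈ , ¬vw   = any⁻ (nonadjacent G s v) {far (opp s)} t
          w∈C , f        = far⁻ (opp s) w∈
          x≤0 , c≤2      = C′⁻ s v t′
      in v∈C , record
        { degreeX≤0 = x≤0 ; degree≤2 = c≤2 ; in-C = w∈C ; non-edge = ¬vw ; is-far = f }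

    rating : ∀ s → Bool → V G s → Candidate G
    rating s x v = candidate v x (degree s v)

    rated⁺ : ∀ s x vs {v} → v ∈ vs → rating s x v ∈ rated s x vs
    rated⁺ s x vs {v} v∈ = subst₂ _∈_ (cong (candidate v x) (value-d̄ s v (C (opp s))))
      (sym (value-mapᵖ (rateᵖ s x) vs)) (∈-map⁺ (value ∘ rateᵖ s x) v∈)

    rated⁻ : ∀ s x vs {c} → c ∈ rated s x vs → ∃ λ v → v ∈ vs × c ≡ rating s x v
    rated⁻ s x vs {c} c∈
      with v , v∈ , refl ← ∈-map⁻ (value ∘ rateᵖ s x) (subst (_ ∈_) (value-mapᵖ (rateᵖ s x) vs) c∈)
      = v , v∈ , cong (candidate v x) (value-d̄ s v (C (opp s)))

    private
      both : ∀ (f : ∀ s → List (Candidate G)) s {c} → c ∈ f s → c ∈ f left ++ f right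
      both f left  = ∈-++⁺ˡ
      both f right = ∈-++⁺ʳ (f left)

      either : ∀ (f : ∀ s → List (Candidate G)) {c} → c ∈ f left ++ f right → ∃ λ s → c ∈ f s
      either f c∈ = [ left ,_ , right ,_ ]′ (∈-++⁻ (f left) c∈)

    X-candidate : ∀ s {x} → x ∈ X s → rating s true x ∈ all-candidates
    X-candidate s x∈ = ∈-++⁺ˡ (both (λ s → rated s true (X s)) s (rated⁺ s true (X s) x∈))

    far-candidate : ∀ s {v} → v ∈ far s → rating s false v ∈ all-candidates
    far-candidate s v∈ = ∈-++⁺ʳ rated-X
      (∈-++⁺ˡ (both (λ s → rated s false (far s)) s (rated⁺ s false (far s) v∈)))

    near-far-candidate : ∀ s {v} → v ∈ near-far s → rating s false v ∈ all-candidates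
    near-far-candidate s v∈ = ∈-++⁺ʳ rated-X
      (∈-++⁺ʳ rated-far
        (both (λ s → rated s false (near-far s)) s (rated⁺ s false (near-far s) v∈)))

    -- Outside C′ the vertex qualifies by (C1), inside C′ by (C2) with witness `w`.
    C-candidate : ∀ s {v w} → v ∈ C s → w ∈ C (opp s) → T (not (adj G s v w)) →
      Far (opp s) w → rating s false v ∈ all-candidates
    C-candidate s {v} v∈ w∈ ¬vw f with far-or-near s v∈
    ... | inj₁ v∈far  = far-candidate s v∈far
    ... | inj₂ v∈near = near-far-candidate s
      (∈-filterᵖ⁺ (λ v → anyᵖ (nonadjacent G s v) (far (opp s))) v∈near
        (any⁺ (nonadjacent G s v) (far⁺ (opp s) w∈ f) ¬vw))

    data Pivot : Candidate G → Set where
      excluded : ∀ s {v} → v ∈ X s → Pivot (rating s true v)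
      chosen   : ∀ s {v} → v ∈ C s → Far s v ⊎ Near s v → Pivot (rating s false v)

    X-pivot-of : ∀ s {c} → c ∈ rated s true (X s) → Pivot c
    X-pivot-of s c∈ = let v , v∈ , eq = rated⁻ s true (X s) c∈ in
      subst Pivot (sym eq) (excluded s v∈)

    far-pivot-of : ∀ s {c} → c ∈ rated s false (far s) → Pivot c
    far-pivot-of s c∈ = let v , v∈ , eq = rated⁻ s false (far s) c∈ ; v∈C , f = far⁻ s v∈ in
      subst Pivot (sym eq) (chosen s v∈C (inj₁ f))

    near-far-pivot-of : ∀ s {c} → c ∈ rated s false (near-far s) → Pivot c
    near-far-pivot-of s c∈ =
      let v , v∈ , eq = rated⁻ s false (near-far s) c∈ ; v∈C , n = near-far⁻ s v∈ in
      subst Pivot (sym eq) (chosen s v∈C (inj₂ n))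

    pivot : ∀ {c} → c ∈ all-candidates → Pivot c
    pivot c∈ = [ (λ c∈X → let s , c∈s = either (λ s → rated s true (X s)) c∈X in X-pivot-of s c∈s)
      , (λ c∈C → [ (λ c∈far → let s , c∈s = either (λ s → rated s false (far s)) c∈far in
                     far-pivot-of s c∈s)
                 , (λ c∈nf → let s , c∈s = either (λ s → rated s false (near-far s)) c∈nf in
                     near-far-pivot-of s c∈s)
                 ]′ (∈-++⁻ rated-far c∈C))
      ]′ (∈-++⁻ rated-X c∈)

    best⁻ : ∀ S {c} → c ∈ value (bestCandidates (value (candidates (branch S C X)))) →
      c ∈ all-candidates × (∀ {c′} → c′ ∈ all-candidates → key c ≤ key c′)
    best⁻ S {c} c∈ =
      let c∈all , t = ∈-filterᵖ⁻ (λ c → allᵖ (no-better c) all-candidates) {xs = all-candidates} c∈ in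
      c∈all , λ c′∈ → ≤ᵇ⇒≤ _ _ (all⁻ (no-better c) t c′∈)
      where
      no-better : Candidate G → Candidate G → Run G Bool
      no-better c c′ = spend 1 >> return (key c ≤ᵇ key c′)

    st : ∀ s → State (size s) (size (opp s))
    st s = state (C s) (C (opp s)) (X s) (X (opp s))

    -- The branching analysis puts the side of the pivot first, the search tree always the left
    -- side.
    Budget-st : ∀ s {k} → Budget (adj G s) (st s) k → Budget edge (st left) k
    Budget-st left  budget = budget
    Budget-st right (fits bonus Φ≤) = fits (swapped bonus) (≤-trans (≤-reflexive (Φ-swap (st right))) Φ≤)
      where
      swapped : ∀ {e} → Bonus (adj G right) (st right) e → Bonus edge (st left) e
      swapped none       = none
      swapped (onA x∈ h) = onB x∈ h
      swapped (onB x∈ h) = onA x∈ h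
    Budget-st right (deadA x∈ h) = deadB x∈ h
    Budget-st right (deadB x∈ h) = deadA x∈ h

    Bonus-st : ∀ s {e} → Bonus edge (st left) e → Bonus (adj G s) (st s) e
    Bonus-st left  bonus      = bonus
    Bonus-st right none       = none
    Bonus-st right (onA x∈ h) = onB x∈ h
    Bonus-st right (onB x∈ h) = onA x∈ h

    Φ-st : ∀ s → Φ (st s) ≡ Φ (st left)
    Φ-st left  = refl
    Φ-st right = Φ-swap (st left)

    degree-opp : ∀ s w → degCᵒ (adj G s) w (st s) ≡ degree (opp s) w
    degree-opp left  w = refl
    degree-opp right w = refl

    Far-opp : ∀ s w → Far (opp s) w ≡ Deviantᵒ (adj G s) (st s) w
    Far-opp left  w = refl
    Far-opp right w = refl

    C-candidate-opp : ∀ s {v w} → v ∈ C s → w ∈ C (opp s) → T (not (adj G s v w)) →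
      Far s v → rating (opp s) false w ∈ all-candidates
    C-candidate-opp left  v∈ w∈ ¬vw f = C-candidate right w∈ v∈ ¬vw f
    C-candidate-opp right v∈ w∈ ¬vw f = C-candidate left w∈ v∈ ¬vw f

  Node : VSet G → VSet G → State (size left) (size right)
  Node C X = Rated.st C X left

  data Budgetsᵛ (C X : VSet G) : List (Vertex G) → ℕ → Set where
    []  : Budgetsᵛ C X [] 0
    _∷_ : ∀ {s w vs k t} → w ∈ C s × Budget edge (Node (takeC s w C) (takeX s w X)) k →
          Budgetsᵛ (dropC s w C) (dropX s w X) vs t → Budgetsᵛ C X ((s , w) ∷ vs) (k + t)

  st-takeA : ∀ s v {C X} →
    takeA (adj G s) v (Rated.st C X s) ≡ Rated.st (takeC s v C) (takeX s v X) s
  st-takeA left  v = refl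
  st-takeA right v = refl

  st-excludeA : ∀ s v {C X} →
    excludeA (adj G s) v (Rated.st C X s) ≡ Rated.st (dropC s v C) (dropX s v X) s
  st-excludeA left  v = refl
  st-excludeA right v = refl

  st-takeB : ∀ s w {C X} →
    takeB (adj G s) w (Rated.st C X s) ≡ Rated.st (takeC (opp s) w C) (takeX (opp s) w X) s
  st-takeB left  w = refl
  st-takeB right w = refl

  st-excludeB : ∀ s w {C X} →
    excludeB (adj G s) w (Rated.st C X s) ≡ Rated.st (dropC (opp s) w C) (dropX (opp s) w X) s
  st-excludeB left  w = refl
  st-excludeB right w = refl

  fromB : ∀ s {C X ws t} → BudgetsB (adj G s) (Rated.st C X s) ws t →
    Budgetsᵛ C X (map (opp s ,_) ws) t
  fromB s [] = []
  fromB s {C} {X} {w ∷ ws} ((w∈ , budget) ∷ budgets) =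
    (w∈ , Rated.Budget-st (takeC (opp s) w C) (takeX (opp s) w X) s
      (subst (λ st → Budget (adj G s) st _) (st-takeB s w {C} {X}) budget)) ∷
    fromB s (subst (λ st → BudgetsB (adj G s) st ws _) (st-excludeB s w {C} {X}) budgets)

  -- Degrees are recovered from keys, whose last summand is 0 in X and 1 in C. Of the three versions
  -- `halve<` compares a pivot of C with a vertex of X, and the tie-breaking rule makes it strict.
  halve : ∀ {a b} → 2 * a + 0 ≤ 2 * b + 1 → a ≤ b
  halve {a} {b} h = ≮⇒≥ λ b<a → <-irrefl refl (begin-strict
    2 * b + 1     <⟨ ≤-reflexive (regroup b) ⟩
    2 * suc b + 0 ≤⟨ +-monoˡ-≤ 0 (*-monoʳ-≤ 2 b<a) ⟩
    2 * a + 0     ≤⟨ h ⟩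
    2 * b + 1     ∎)
    where
    open ≤-Reasoning
    regroup : ∀ b → suc (2 * b + 1) ≡ 2 * suc b + 0
    regroup = solve-∀

  halve′ : ∀ {a b} → 2 * a + 0 ≤ 2 * b + 0 → a ≤ b
  halve′ {a} {b} h = halve (≤-trans h (+-monoʳ-≤ (2 * b) z≤n))

  halve< : ∀ {a b} → 2 * a + 1 ≤ 2 * b + 0 → a < b
  halve< {a} {b} h = ≰⇒> λ b≤a → <-irrefl refl (begin-strict
    2 * b + 0 ≤⟨ +-monoˡ-≤ 0 (*-monoʳ-≤ 2 b≤a) ⟩
    2 * a + 0 <⟨ +-monoʳ-< (2 * a) (s≤s z≤n) ⟩
    2 * a + 1 ≤⟨ h ⟩
    2 * b + 0 ∎)
    where open ≤-Reasoning

  module _ {C X : VSet G} (C! : ∀ s → Unique (C s))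
    (alive : ∀ s {x} → x ∈ X s → 1 ≤ Rated.degree C X s x)
    {e m : ℕ} (bonus : Bonus edge (Node C X) e) (Φ≤ : Φ (Node C X) ≤ e + m) where
    open Rated C X

    private
      Minimal : Candidate G → Set
      Minimal c = ∀ {c′} → c′ ∈ all-candidates → key c ≤ key c′

      Φ-st≤ : ∀ s → Φ (st s) ≤ e + m
      Φ-st≤ s = ≤-trans (≤-reflexive (Φ-st s)) Φ≤

      pivot-kind : ∀ s {v} → Far s v ⊎ Near s v →
        Deviant (adj G s) (st s) v ⊎ NearDeviant (adj G s) (st s) v
      pivot-kind s (inj₁ f) = inj₁ f
      pivot-kind s (inj₂ n) = inj₂ (degreeX≤0 , degree≤2 , other-end , in-C , non-edge ,
        subst id (Far-opp s other-end) is-far)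
        where open Near n

      candidate-opp : ∀ s {v w} → v ∈ C s → w ∈ C (opp s) → T (not (adj G s v w)) →
        Far s v ⊎ Deviantᵒ (adj G s) (st s) w → rating (opp s) false w ∈ all-candidates
      candidate-opp s v∈ w∈ ¬vw (inj₁ f) = C-candidate-opp s v∈ w∈ ¬vw f
      candidate-opp s {w = w} v∈ w∈ ¬vw (inj₂ f) =
        far-candidate (opp s) (far⁺ (opp s) w∈ (subst id (sym (Far-opp s w)) f))

    excluded-budgets : ∀ s {v ws} → v ∈ X s → Minimal (rating s true v) →
      ws ↭ non (adj G s) v (C (opp s)) →
      ∃ λ t → Budgetsᵛ C X (map (opp s ,_) ws) t × 1 + t ≤ F m
    excluded-budgets s {v} v∈ min ws↭ =
      let t , budgets , h = X-pivot (adj G s) {v} {st s} v∈ (alive s v∈)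
              (λ x∈ → halve′ (min (X-candidate s x∈)))
              (λ {x} x∈ → subst (degree s v ≤_) (sym (degree-opp s x))
                (halve′ (min (X-candidate (opp s) x∈))))
              -- The pivot is a non-neighbour of `w` in X, so `w` lies outside C′ and is itself a
              -- candidate.
              (λ {w} w∈ ¬vw → subst (degree s v ≤_) (sym (degree-opp s w))
                (halve (min (far-candidate (opp s) (far⁺ (opp s) w∈
                  (subst id (sym (Far-opp s w))
                    (inj₁ (degXᵒ-positive (adj G s) {st = st s} v∈ ¬vw))))))))
              ws↭ (C! (opp s)) (Bonus-st s bonus) (Φ-st≤ s)
      in t , fromB s budgets , h

    chosen-budgets : ∀ s {v ws} → v ∈ C s → Far s v ⊎ Near s v → Minimal (rating s false v) →
      ws ↭ non (adj G s) v (C (opp s)) →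
      ∃ λ t → Budgetsᵛ C X ((s , v) ∷ map (opp s ,_) ws) t × 1 + t ≤ F m
    chosen-budgets s {v} v∈ kind min ws↭ =
      let k , t , budget , budgets , h = C-pivot (adj G s) {v} {st s} v∈ (C! s) (C! (opp s))
            (λ x∈ → halve< (min (X-candidate s x∈)))
            (λ {x} x∈ → subst (degree s v <_) (sym (degree-opp s x))
              (halve< (min (X-candidate (opp s) x∈))))
            (pivot-kind s kind)
            (λ {w} w∈ ¬vw far → subst (degree s v ≤_) (sym (degree-opp s w))
              (halve (≤-trans (+-monoʳ-≤ (2 * degree s v) z≤n)
                (min (candidate-opp s v∈ w∈ ¬vw far)))))
            ws↭ (Bonus-st s bonus) (Φ-st≤ s)
      in k + t ,
         (v∈ , Rated.Budget-st (takeC s v C) (takeX s v X) s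
           (subst (λ st → Budget (adj G s) st k) (st-takeA s v {C} {X}) budget)) ∷
         fromB s (subst (λ st → BudgetsB (adj G s) st _ t) (st-excludeA s v {C} {X}) budgets) ,
         h

    order-value : ∀ S s x v → ∃ λ ws → ws ↭ non (adj G s) v (C (opp s)) ×
      value (branchingVertices (branch S C X) (rating s x v)) ≡
      (if x then map (opp s ,_) ws else (s , v) ∷ map (opp s ,_) ws)
    order-value S s x v = ws , subst (ws ↭_) (value-filterᵖ (nonadjacent G s v) (C (opp s))) ws↭ ,
      cong (λ vs → if x then vs else (s , v) ∷ vs) (value-mapᵖ _ ws)
      where
      arranged = branchOrder (branch S C X)
                (value (filterᵖ (nonadjacent G s v) (C (opp s))))
      ws = proj₁ arranged
      ws↭ = proj₂ arranged

    pivot-budgets : ∀ S {p} → Pivot p → Minimal p →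
      ∃ λ t → Budgetsᵛ C X (value (branchingVertices (branch S C X) p)) t × 1 + t ≤ F m
    pivot-budgets S (excluded s {v} v∈) min =
      let ws , ws↭ , eq = order-value S s true v in
      subst (λ vs → ∃ λ t → Budgetsᵛ C X vs t × 1 + t ≤ F m) (sym eq)
        (excluded-budgets s v∈ min ws↭)
    pivot-budgets S (chosen s {v} v∈ kind) min =
      let ws , ws↭ , eq = order-value S s false v in
      subst (λ vs → ∃ λ t → Budgetsᵛ C X vs t × 1 + t ≤ F m) (sym eq)
        (chosen-budgets s v∈ kind min ws↭)

    node-budgets : ∀ S {p} → p ∈ value (bestCandidates (value (candidates (branch S C X)))) →
      ∃ λ t → Budgetsᵛ C X (value (branchingVertices (branch S C X) p)) t × 1 + t ≤ F m
    node-budgets S p∈ = let c∈ , min = best⁻ S p∈ in pivot-budgets S (pivot c∈) min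

  -- The search tree

  -- Never grows along a branch and bounds every list a node traverses, including S ∪ C, up to
  -- constant factors.
  total : VSet G → VSet G → VSet G → ℕ
  total S C X = ∣ S ∣ᵥ + (∣ C ∣ᵥ + ∣ X ∣ᵥ)

  take-total : ∀ s {w S C X} → w ∈ C s →
    total (takeS s w S) (takeC s w C) (takeX s w X) ≤ total S C X
  take-total left {w} {S} {C} {X} w∈ = ≤-trans
    (≤-reflexive (sym (+-suc ∣ S ∣ᵥ _)))
    (+-monoʳ-≤ ∣ S ∣ᵥ (+-mono-≤
      (+-mono-≤ (length-remove w∈) (length-filterᵇ≤ (adj G left w) (C right)))
      (+-monoʳ-≤ _ (length-filterᵇ≤ (adj G left w) (X right)))))
  take-total right {w} {S} {C} {X} w∈ = ≤-trans
    (≤-reflexive (regroup (length (S left)) (length (S right))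
      (length (filterᵇ (adj G right w) (C left))) (length (remove w (C right))) ∣ takeX right w X ∣ᵥ))
    (+-monoʳ-≤ ∣ S ∣ᵥ (+-mono-≤
      (+-mono-≤ (length-filterᵇ≤ (adj G right w) (C left)) (length-remove w∈))
      (+-monoˡ-≤ _ (length-filterᵇ≤ (adj G right w) (X left)))))
    where
    regroup : ∀ a b c d e → a + suc b + (c + d + e) ≡ a + b + (c + suc d + e)
    regroup = solve-∀

  drop-total : ∀ s {w S C X} → w ∈ C s → total S (dropC s w C) (dropX s w X) ≤ total S C X
  drop-total left {w} {S} {C} {X} w∈ = +-monoʳ-≤ ∣ S ∣ᵥ (≤-trans
    (≤-reflexive (+-suc _ _))
    (+-monoˡ-≤ ∣ X ∣ᵥ (+-monoˡ-≤ (length (C right)) (length-remove w∈))))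
  drop-total right {w} {S} {C} {X} w∈ = +-monoʳ-≤ ∣ S ∣ᵥ (≤-trans
    (≤-reflexive (regroup (length (C left)) (length (remove w (C right))) (length (X left)) (length (X right))))
    (+-monoˡ-≤ ∣ X ∣ᵥ (+-monoʳ-≤ (length (C left)) (length-remove w∈))))
    where
    regroup : ∀ a b c d → a + b + (c + suc d) ≡ a + suc b + (c + d)
    regroup = solve-∀

  stepᵖ : ℕ → VSet G → VSet G × VSet G → Vertex G → Run G (VSet G × VSet G)
  stepᵖ f S (C , X) (s , w) = do
    Cs ← filterᵖ (λ u → notᵖ (same G u w)) (C s)
    Co ← filterᵖ (adjacent G s w) (C (opp s))
    Xo ← filterᵖ (adjacent G s w) (X (opp s))
    ips f (branch (takeS s w S) (assemble G s Cs Co) (assemble G s (X s) Xo))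
    return (assemble G s Cs (C (opp s)) , dropX s w X)

  branchOnᵖ : ℕ → Branch G → List (Candidate G) → Run G 𝟙
  branchOnᵖ f b [] = return tt
  branchOnᵖ f b@(branch S C X) (c ∷ cs) = do
    spend (suc (length cs))
    ws ← branchingVertices b (proj₁ (tieBreak b c cs))
    foldᵖ (stepᵖ f S) (C , X) ws
    return tt

  searchᵖ : ℕ → VSet G → Branch G → Run G 𝟙
  searchᵖ f W b = do
    p ← prunedᵖ W b
    if p then return tt else do
      cs   ← candidates b
      best ← bestCandidates cs
      branchOnᵖ f b best

  nodeᵖ : ℕ → Branch G → Run G 𝟙
  nodeᵖ f b@(branch S C X) = do
    spend 1
    W  ← union S C
    bp ← 2biplexᵖ W
    if bp ∧ null (X left) ∧ null (X right) then run (λ _ → 1) W else searchᵖ f W b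

  -- The local function that branches matches on the list of best candidates, so the two sides agree
  -- by computation only after this list is split.
  ips-unfold : ∀ f b → time (ips (suc f) b) ≡ time (nodeᵖ f b)
  ips-unfold f b@(branch S C X) with value (bestCandidates (value (candidates b)))
  ... | []     = refl
  ... | c ∷ cs = refl

  step-value : ∀ f S C X s w →
    value (stepᵖ f S (C , X) (s , w)) ≡ (dropC s w C , dropX s w X)
  step-value f S C X s w = cong (λ Cs → assemble G s Cs (C (opp s)) , dropX s w X)
    (value-filterᵖ (λ u → notᵖ (same G u w)) (C s))

  total-S : ∀ {S C X} s → length (S s) ≤ total S C X
  total-S {S} {C} {X} s = ≤-trans (side≤ S s) (m≤m+n _ _)

  total-C : ∀ {S C X} → ∣ C ∣ᵥ ≤ total S C X
  total-C {S} {C} {X} = ≤-trans (m≤m+n ∣ C ∣ᵥ ∣ X ∣ᵥ) (m≤n+m _ ∣ S ∣ᵥ)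

  total-X : ∀ {S C X} → ∣ X ∣ᵥ ≤ total S C X
  total-X {S} {C} {X} = ≤-trans (m≤n+m ∣ X ∣ᵥ ∣ C ∣ᵥ) (m≤n+m _ ∣ S ∣ᵥ)

  total-W : ∀ {S C X} → length ((S ∪ᵥ C) left) + length ((S ∪ᵥ C) right) ≤ total S C X
  total-W {S} {C} {X} = ≤-trans
    (≤-reflexive (trans (cong₂ _+_ (length-++ (S left)) (length-++ (S right)))
      (regroup (length (S left)) (length (C left)) (length (S right)) (length (C right)))))
    (+-monoʳ-≤ ∣ S ∣ᵥ (m≤m+n ∣ C ∣ᵥ ∣ X ∣ᵥ))
    where
    regroup : ∀ a b c d → (a + b) + (c + d) ≡ (a + c) + (b + d)
    regroup = solve-∀

  step-time : ∀ {N} f {S C X} s w → total S C X < N →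
    time (stepᵖ f S (C , X) (s , w)) ≤
    6 * N ^ⁿ 1 + time (ips f (branch (takeS s w S) (takeC s w C) (takeX s w X)))
  step-time {N} f {S} {C} {X} s w total<N = begin
    t₁ + (t₂ + (t₃ + (time (ips f child) + 0)))  ≡⟨ regroup t₁ t₂ t₃ _ ⟩
    t₁ + (t₂ + t₃) + time (ips f child)          ≡⟨ cong (λ i → t₁ + (t₂ + t₃) + i) same-child ⟩
    t₁ + (t₂ + t₃) + time (ips f (branch (takeS s w S) (takeC s w C) (takeX s w X)))
      ≤⟨ +-monoˡ-≤ _ (bound
           (filterᵖ-cost {j = 1} other′ (C s) (C< s) (λ _ → one) ⊕
            adjacent-cost 1≤N s w (C (opp s)) (C< (opp s)) ⊕
            adjacent-cost 1≤N s w (X (opp s)) (X< (opp s)))) ⟩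
    6 * N ^ⁿ 1 + time (ips f (branch (takeS s w S) (takeC s w C) (takeX s w X))) ∎
    where
    open ≤-Reasoning
    1≤N : 1 ≤ N
    1≤N = ≤-trans (s≤s z≤n) total<N
    C< : ∀ s → length (C s) < N
    C< s = ≤-<-trans (≤-trans (side≤ C s) (total-C {S} {C} {X})) total<N
    X< : ∀ s → length (X s) < N
    X< s = ≤-<-trans (≤-trans (side≤ X s) (total-X {S} {C} {X})) total<N
    other′ : V G s → Run G Bool
    other′ u = notᵖ (same G u w)
    t₁ = time (filterᵖ other′ (C s))
    t₂ = time (filterᵖ (adjacent G s w) (C (opp s)))
    t₃ = time (filterᵖ (adjacent G s w) (X (opp s)))
    child = branch (takeS s w S)
      (assemble G s (value (filterᵖ other′ (C s))) (value (filterᵖ (adjacent G s w) (C (opp s)))))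
      (assemble G s (X s) (value (filterᵖ (adjacent G s w) (X (opp s)))))
    same-child : time (ips f child) ≡ time (ips f (branch (takeS s w S) (takeC s w C) (takeX s w X)))
    same-child = cong₂ (λ C′ X′ → time (ips f (branch (takeS s w S) C′ X′)))
      (cong₂ (assemble G s) (value-filterᵖ other′ (C s))
                            (value-filterᵖ (adjacent G s w) (C (opp s))))
      (cong (assemble G s (X s)) (value-filterᵖ (adjacent G s w) (X (opp s))))
    regroup : ∀ a b c d → a + (b + (c + (d + 0))) ≡ a + (b + c) + d
    regroup = solve-∀

  -- `A` is the cost of a node, of which there are at most `k`; `D` is the cost at a leaf per
  -- reachable maximal biclique.
  Bounded : (N A D f : ℕ) → Set
  Bounded N A D f = ∀ {S C X k} → Valid S C X → total S C X < N → Budget edge (Node C X) k →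
    time (ips f (branch S C X)) ≤ A * k + D * #reachable S C

  fold-time : ∀ {N A D f} → Bounded N A D f → ∀ {S C X vs t} → Valid S C X → total S C X < N →
    Budgetsᵛ C X vs t → time (foldᵖ (stepᵖ f S) (C , X) vs) ≤
    suc (length vs * suc (6 * N ^ⁿ 1)) + (A * t + D * #reachable S C)
  fold-time ih valid total<N [] = s≤s z≤n
  fold-time {N} {A} {D} {f} ih {S} {C} {X} {(s , w) ∷ vs} valid total<N
            (_∷_ {k = k} {t = t} (w∈ , budget) budgets)
    rewrite step-value f S C X s w = begin
    suc (time (stepᵖ f S (C , X) (s , w))) + time (foldᵖ (stepᵖ f S) (dropC s w C , dropX s w X) vs)
      ≤⟨ +-mono-≤
           (s≤s (≤-trans (step-time f {S} {C} {X} s w total<N) (+-monoʳ-≤ q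
             (ih (valid-take valid s w∈)
                 (≤-<-trans (take-total s {w} {S} {C} {X} w∈) total<N) budget))))
           (fold-time {N} {A} {D} {f} ih (valid-drop valid s w)
             (≤-<-trans (drop-total s {w} {S} {C} {X} w∈) total<N) budgets) ⟩
    suc (q + (A * k + D * β₁)) + (suc l + (A * t + D * β₂))
      ≡⟨ regroup q A k D β₁ l t β₂ ⟩
    suc (suc q + l) + (A * (k + t) + D * (β₁ + β₂))
      ≤⟨ +-monoʳ-≤ (suc (suc q + l)) (+-monoʳ-≤ (A * (k + t))
           (*-monoʳ-≤ D (#reachable-split valid s w∈))) ⟩
    suc (suc q + l) + (A * (k + t) + D * #reachable S C) ∎
    where
    open ≤-Reasoning
    q = 6 * N ^ⁿ 1
    l = length vs * suc q
    β₁ = #reachable (takeS s w S) (takeC s w C)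
    β₂ = #reachable S (dropC s w C)
    regroup : ∀ q A k D β₁ l t β₂ →
      suc (q + (A * k + D * β₁)) + (suc l + (A * t + D * β₂)) ≡
      suc (suc q + l) + (A * (k + t) + D * (β₁ + β₂))
    regroup = solve-∀

  module _ {N : ℕ} {S C X : VSet G} (total<N : total S C X < N) where

    private
      b : Branch G
      b = branch S C X

      1≤N : 1 ≤ N
      1≤N = ≤-trans (s≤s z≤n) total<N

      C<N : ∣ C ∣ᵥ < N
      C<N = ≤-<-trans (total-C {S} {C} {X}) total<N

      X<N : ∣ X ∣ᵥ < N
      X<N = ≤-<-trans (total-X {S} {C} {X}) total<N

      C< : ∀ s → length (C s) < N
      C< s = ≤-<-trans (side≤ C s) C<N

      X< : ∀ s → length (X s) < N
      X< s = ≤-<-trans (side≤ X s) X<N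

      W< : ∀ s → length ((S ∪ᵥ C) s) < N
      W< s = ≤-<-trans (≤-trans (side≤ (S ∪ᵥ C) s) (total-W {S} {C} {X})) total<N

    branching-cost : ∀ p → Cost N 2 (time (branchingVertices b p)) 4
    branching-cost (candidate {s} v x _) =
      raise 1≤N (nonadjacent-cost 1≤N s v (C (opp s)) (C< (opp s))) ⊕
      square ⊕ raise 1≤N (mapᵖ-cost {e = 0} {j = 0} label (proj₁ arranged) arranged< (λ _ → free)) ⊕ free
      where
      label : V G (opp s) → Run G (Vertex G)
      label w = return (opp s , w)
      ws = value (filterᵖ (nonadjacent G s v) (C (opp s)))
      ws< : length ws < N
      ws< = ≤-<-trans (length-filterᵖ (nonadjacent G s v) (C (opp s))) (C< (opp s))
      arranged = branchOrder b ws
      arranged< : length (proj₁ arranged) < N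
      arranged< = ≤-trans (s≤s (≤-reflexive (↭.↭-length (proj₂ arranged)))) ws<
      square : Cost N 2 (length ws * length ws) 1
      square = cost (≤-trans (*-mono-≤ (<⇒≤ ws<) (<⇒≤ ws<))
        (≤-reflexive (regroup N)))
        where
        regroup : ∀ n → n * n ≡ 1 * (n * (n * 1))
        regroup = solve-∀

    branching-length : ∀ p → length (value (branchingVertices b p)) ≤ N
    branching-length (candidate {s} v x _) = go x
      where
      arranged = branchOrder b (value (filterᵖ (nonadjacent G s v) (C (opp s))))
      label : V G (opp s) → Run G (Vertex G)
      label w = return (opp s , w)
      mapped< : length (value (mapᵖ label (proj₁ arranged))) < N
      mapped< = ≤-<-trans (≤-reflexive (trans (length-mapᵖ label (proj₁ arranged))
        (↭.↭-length (proj₂ arranged))))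
        (≤-<-trans (length-filterᵖ (nonadjacent G s v) (C (opp s))) (C< (opp s)))
      go : ∀ x → length (value (branchingVertices b (candidate v x 0))) ≤ N
      go true  = <⇒≤ mapped<
      go false = mapped<

    best-cost : Cost N 2 (time (bestCandidates (Rated.all-candidates C X))) 48
    best-cost = cost (≤-trans (bound
      (filterᵖ-cost {N = suc (3 * N)} (λ c → allᵖ (λ c′ → spend {O = Sub G} 1 >> return (key c ≤ᵇ key c′)) cs) cs cs<
        (λ c → (filterᵖ-cost {j = 1} (λ c′ → notᵖ (spend {O = Sub G} 1 >> return (key c ≤ᵇ key c′))) cs cs<
          (λ _ → one) ⊕ free) ⊕ free)))
      (≤-trans (*-monoʳ-≤ 3 (^-monoˡ-≤ 2 (+-monoˡ-≤ (3 * N) 1≤N))) (≤-reflexive (regroup N))))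
      where
      cs = Rated.all-candidates C X
      cs< : length cs < suc (3 * N)
      cs< = s≤s (Rated.candidates≤ C X 1≤N C<N X<N)
      regroup : ∀ n → 3 * ((n + 3 * n) * ((n + 3 * n) * 1)) ≡ 48 * (n * (n * 1))
      regroup = solve-∀

    fold-cost : ∀ p → Cost N 2 (suc (length (value (branchingVertices b p)) * suc (6 * N ^ⁿ 1))) 8
    fold-cost p = cost (begin
      suc (length (value (branchingVertices b p)) * suc (6 * N ^ⁿ 1))
        ≤⟨ s≤s (*-monoˡ-≤ (suc (6 * N ^ⁿ 1)) (branching-length p)) ⟩
      1 + N * suc (6 * N ^ⁿ 1)
        ≡⟨ regroup N ⟩
      1 + N * 1 + 6 * N ^ⁿ 2
        ≤⟨ +-monoˡ-≤ (6 * N ^ⁿ 2) (+-mono-≤ (m^n>0 N {{>-nonZero 1≤N}} 2)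
             (*-monoʳ-≤ N (m^n>0 N {{>-nonZero 1≤N}} 1))) ⟩
      N ^ⁿ 2 + N ^ⁿ 2 + 6 * N ^ⁿ 2
        ≡⟨ regroup′ (N ^ⁿ 2) ⟩
      8 * N ^ⁿ 2 ∎)
      where
      open ≤-Reasoning
      regroup : ∀ n → 1 + n * suc (6 * (n * 1)) ≡ 1 + n * 1 + 6 * (n * (n * 1))
      regroup = solve-∀
      regroup′ : ∀ x → x + x + 6 * x ≡ 8 * x
      regroup′ = solve-∀

    union-cost : Cost N 2 (time (union S C)) 2
    union-cost = append-cost 1≤N (S left) (C left) (S< left) ⊕
                 append-cost 1≤N (S right) (C right) (S< right) ⊕ free
      where
      S< : ∀ s → length (S s) < N
      S< s = ≤-<-trans (total-S {S} {C} {X} s) total<N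

    -- The two bicliques with an empty side cost O(N), and the edges O(N²); both go into the cost of
    -- the node. Only the reachable bicliques are charged separately.
    leaf-time : Valid S C X → (∀ s {v} → v ∉ X s) → Is2Biplex G (⟦_⟧ G (S ∪ᵥ C)) →
      time (run (λ _ → 1) (S ∪ᵥ C)) ≤ 3 * K₀ * N ^ⁿ 2 + K₀ * N * #reachable S C
    leaf-time valid X≡[] 2biplex = begin
      time (run (λ _ → 1) W)
        ≤⟨ time-≤ (λ _ → 1) W 2biplex ⟩
      K₀ * (#edges G (⟦_⟧ G W) + #vertices G (⟦_⟧ G W) * length (maximalBicliques G (λ _ → 0) (⟦_⟧ G W)))
        ≤⟨ *-monoʳ-≤ K₀ (+-mono-≤
             (≤-trans (#edges≤ W) (*-mono-≤ (<⇒≤ (W< left)) (<⇒≤ (W< right))))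
             (*-mono-≤ (≤-trans (#vertices≤ W) (<⇒≤ (≤-<-trans (total-W {S} {C} {X}) total<N)))
                       (leaf-count valid X≡[]))) ⟩
      K₀ * (N * N + N * (2 + β′))
        ≡⟨ regroup K₀ N β′ ⟩
      K₀ * (N * N + 2 * (N * 1)) + K₀ * N * β′
        ≤⟨ +-monoˡ-≤ _ (*-monoʳ-≤ K₀ (+-monoʳ-≤ (N * N) (*-monoʳ-≤ 2 (*-monoʳ-≤ N 1≤N)))) ⟩
      K₀ * (N * N + 2 * (N * N)) + K₀ * N * β′
        ≡⟨ cong (_+ K₀ * N * β′) (regroup′ K₀ N) ⟩
      3 * K₀ * N ^ⁿ 2 + K₀ * N * β′ ∎
      where
      open ≤-Reasoning
      W = S ∪ᵥ C
      β′ = #reachable S C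
      regroup : ∀ k n b → k * (n * n + n * (2 + b)) ≡ k * (n * n + 2 * (n * 1)) + k * n * b
      regroup = solve-∀
      regroup′ : ∀ k n → k * (n * n + 2 * (n * n)) ≡ 3 * k * (n * (n * 1))
      regroup′ = solve-∀

  2biplex-correct : ∀ W → T (value (2biplexᵖ W)) → Is2Biplex G (⟦_⟧ G W)
  2biplex-correct W t s v v∈ = begin
    _ ≤⟨ ∣∣≤length {xs = filterᵇ (not ∘ adj G s v) (W (opp s))} (λ i∈ →
           let i∈non , i∈W = Subset.x∈p∩q⁻ _ (side G (⟦_⟧ G W) (opp s)) i∈ in
           ∈-filterᵇ⁺ (not ∘ adj G s v) (∈-⟦⟧⁻ W (opp s) i∈W)
             (∈-tabulate⁻ (not ∘ adj G s v) i∈non)) ⟩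
    length (filterᵇ (not ∘ adj G s v) (W (opp s)))
      ≡⟨ Rated.value-d̄ W W s v (W (opp s)) ⟨
    value (d̄ G s v (W (opp s)))
      ≤⟨ ≤ᵇ⇒≤ _ 2 (all⁻ (few s) (ok s (Equivalence.to T-∧ t)) (∈-⟦⟧⁻ W s v∈)) ⟩
    2 ∎
    where
    open ≤-Reasoning
    few : ∀ s → V G s → Run G Bool
    few s v = d̄ G s v (W (opp s)) >>= λ k → spend 1 >> return (k ≤ᵇ 2)
    ok : ∀ s → T (value (allᵖ (few left) (W left))) × T (value (allᵖ (few right) (W right))) →
      T (value (allᵖ (few s) (W s)))
    ok left  = proj₁
    ok right = proj₂

  -- A vertex of X without non-neighbours in C would have triggered (P2).
  unpruned-alive : ∀ W {S C X} → ¬ T (value (prunedᵖ W (branch S C X))) →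
    ∀ s {x} → x ∈ X s → 1 ≤ Rated.degree C X s x
  unpruned-alive W {S} {C} {X} ¬pruned s {x} x∈ = ≰⇒> λ isolated → ¬pruned
    (Equivalence.from (T-∨ {small}) (inj₂ (dominates s
      (any⁺ (dominating s) x∈ (all⁺ (adjacent G s x) λ {u} u∈ → adjacent-all isolated u∈)))))
    where
    dominating : ∀ s → V G s → Run G Bool
    dominating s v = allᵖ (adjacent G s v) (C (opp s))
    small : Bool
    small = (value (lengthᵖ {O = Sub G} (W left)) <ᵇ 1) ∨ (value (lengthᵖ {O = Sub G} (W right)) <ᵇ 1)
    dominates : ∀ s → T (value (anyᵖ (dominating s) (X s))) →
      T (value (anyᵖ (dominating left) (X left)) ∨ value (anyᵖ (dominating right) (X right)))
    dominates left  = Equivalence.from T-∨ ∘ inj₁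
    dominates right = Equivalence.from (T-∨ {value (anyᵖ (dominating left) (X left))}) ∘ inj₂
    adjacent-all : Rated.degree C X s x ≤ 0 → ∀ {u} → u ∈ C (opp s) → T (adj G s x u)
    adjacent-all isolated {u} u∈ with T? (adj G s x u)
    ... | yes xu = xu
    ... | no ¬xu = contradiction
      (≤-trans (∈-length (∈-filterᵇ⁺ (not ∘ adj G s x) u∈ (not⁺ _ ¬xu))) isolated) λ ()

  Budget≥1 : ∀ {st k} → Budget edge st k → 1 ≤ k
  Budget≥1 (fits {n = n} _ _) = ≤-trans (s≤s z≤n) (F≥ n)
  Budget≥1 (deadA _ _)        = ≤-refl
  Budget≥1 (deadB _ _)        = ≤-refl

  time-if : ∀ {A : Set} {p q : Run G A} {t} b → (T b → time p ≤ t) → (¬ T b → time q ≤ t) →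
    time (if b then p else q) ≤ t
  time-if true  p≤ _ = p≤ _
  time-if false _ q≤ = q≤ λ ()

  -- The summand `A` on the left is the unit by which `F m` exceeds the budgets of the children. It
  -- is carried along until it pays for the node itself.
  branchOn-time : ∀ {N A D f} → Bounded N A D f → ∀ {S C X e m} → Valid S C X →
    total S C X < N → (∀ s {x} → x ∈ X s → 1 ≤ Rated.degree C X s x) →
    Bonus edge (Node C X) e → Φ (Node C X) ≤ e + m →
    ∀ best → (∀ {p} → p ∈ best → p ∈ value (bestCandidates (value (candidates (branch S C X))))) →
    length best ≤ 3 * N →
    time (branchOnᵖ f (branch S C X) best) + A ≤ 15 * N ^ⁿ 2 + (A * F m + D * #reachable S C)
  branchOn-time {N} {A} {D} {f} ih {S} {C} {X} {m = m} valid total<N alive bonus Φ≤ [] _ _ = begin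
    A                       ≡⟨ *-identityʳ A ⟨
    A * 1                   ≤⟨ *-monoʳ-≤ A (≤-trans (s≤s z≤n) (F≥ m)) ⟩
    A * F m                 ≤⟨ m≤m+n (A * F m) _ ⟩
    A * F m + D * #reachable S C ≤⟨ m≤n+m _ (15 * N ^ⁿ 2) ⟩
    15 * N ^ⁿ 2 + (A * F m + D * #reachable S C) ∎
    where open ≤-Reasoning
  branchOn-time {N} {A} {D} {f} ih {S} {C} {X} {m = m} valid total<N alive bonus Φ≤
                (c ∷ cs) best⊆ best≤ =
    children-time (node-budgets {C} {X} (Valid.unique valid) alive bonus Φ≤ S
                     (best⊆ (proj₂ (tieBreak (branch S C X) c cs))))
    where
    open ≤-Reasoning
    b = branch S C X
    p = proj₁ (tieBreak b c cs)
    tᵇ = time (branchingVertices b p)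
    tᶠ = time (foldᵖ (stepᵖ f S) (C , X) (value (branchingVertices b p)))
    3N≤ : 3 * N ≤ 3 * N ^ⁿ 2
    3N≤ = *-monoʳ-≤ 3 (≤-trans (≤-reflexive (sym (*-identityʳ N)))
      (*-monoʳ-≤ N (m^n>0 N {{>-nonZero (≤-trans (s≤s z≤n) total<N)}} 1)))
    regroup : ∀ x A t d → 3 * x + (4 * x + (8 * x + (A * t + d) + 0)) + A ≡
                          15 * x + (A * (1 + t) + d)
    regroup = solve-∀
    children-time : (∃ λ t → Budgetsᵛ C X (value (branchingVertices b p)) t × 1 + t ≤ F m) →
      suc (length cs) + (tᵇ + (tᶠ + 0)) + A ≤ 15 * N ^ⁿ 2 + (A * F m + D * #reachable S C)
    children-time (t , budgets , 1+t≤) = begin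
      suc (length cs) + (tᵇ + (tᶠ + 0)) + A
        ≤⟨ +-monoˡ-≤ A (+-mono-≤ (≤-trans best≤ 3N≤) (+-mono-≤
             (bound (branching-cost {N} {S} {C} {X} total<N p))
             (+-monoˡ-≤ 0 (≤-trans (fold-time {N} {A} {D} {f} ih valid total<N budgets)
               (+-monoˡ-≤ _ (bound (fold-cost {N} {S} {C} {X} total<N p))))))) ⟩
      3 * N ^ⁿ 2 + (4 * N ^ⁿ 2 + (8 * N ^ⁿ 2 + (A * t + D * #reachable S C) + 0)) + A
        ≡⟨ regroup (N ^ⁿ 2) A t (D * #reachable S C) ⟩
      15 * N ^ⁿ 2 + (A * (1 + t) + D * #reachable S C)
        ≤⟨ +-monoʳ-≤ (15 * N ^ⁿ 2) (+-monoˡ-≤ _ (*-monoʳ-≤ A 1+t≤)) ⟩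
      15 * N ^ⁿ 2 + (A * F m + D * #reachable S C) ∎

  search-time : ∀ {N A D f} → Bounded N A D f → ∀ {S C X k} → Valid S C X →
    total S C X < N → Budget edge (Node C X) k →
    time (searchᵖ f (S ∪ᵥ C) (branch S C X)) + A ≤ 140 * N ^ⁿ 2 + (A * k + D * #reachable S C)
  search-time {N} {A} {D} {f} ih {S} {C} {X} {k} valid total<N budget = begin
    time (prunedᵖ W b) + time (if value (prunedᵖ W b) then return tt else rest) + A
      ≡⟨ +-assoc (time (prunedᵖ W b)) _ A ⟩
    time (prunedᵖ W b) + (time (if value (prunedᵖ W b) then return tt else rest) + A)
      ≤⟨ +-mono-≤ (bound (prunedᵖ-cost 1≤N W S C X W< C< X<))
           (unpruned (value (prunedᵖ W b)) refl) ⟩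
    10 * N ^ⁿ 2 + (130 * N ^ⁿ 2 + (A * k + D * #reachable S C))
      ≡⟨ regroup (N ^ⁿ 2) _ ⟩
    140 * N ^ⁿ 2 + (A * k + D * #reachable S C) ∎
    where
    open ≤-Reasoning
    W = S ∪ᵥ C
    b = branch S C X
    rest = candidates b >>= λ cs → bestCandidates cs >>= branchOnᵖ f b
    1≤N : 1 ≤ N
    1≤N = ≤-trans (s≤s z≤n) total<N
    C<N : ∣ C ∣ᵥ < N
    C<N = ≤-<-trans (total-C {S} {C} {X}) total<N
    X<N : ∣ X ∣ᵥ < N
    X<N = ≤-<-trans (total-X {S} {C} {X}) total<N
    C< : ∀ s → length (C s) < N
    C< s = ≤-<-trans (side≤ C s) C<N
    X< : ∀ s → length (X s) < N
    X< s = ≤-<-trans (side≤ X s) X<N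
    W< : ∀ s → length (W s) < N
    W< s = ≤-<-trans (≤-trans (side≤ W s) (total-W {S} {C} {X})) total<N
    regroup : ∀ x y → 10 * x + (130 * x + y) ≡ 140 * x + y
    regroup = solve-∀
    regroup′ : ∀ a b c d → a + (b + c) + d ≡ (a + b) + (c + d)
    regroup′ = solve-∀
    regroup″ : ∀ x y → 67 * x + 48 * x + (15 * x + y) ≡ 130 * x + y
    regroup″ = solve-∀
    best₀ = value (bestCandidates (Rated.all-candidates C X))
    rest-time : (∀ s {x} → x ∈ X s → 1 ≤ Rated.degree C X s x) → Budget edge (Node C X) k →
      time rest + A ≤ 130 * N ^ⁿ 2 + (A * k + D * #reachable S C)
    -- A dead branch does not get past the pruning.
    rest-time alive (deadA x∈ isolated) = contradiction (≤-trans (alive left x∈) isolated) λ ()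
    rest-time alive (deadB x∈ isolated) = contradiction (≤-trans (alive right x∈) isolated) λ ()
    rest-time alive (fits {n = n} bonus Φ≤) = begin
      time (candidates b) + (time (bestCandidates (Rated.all-candidates C X)) + time (branchOnᵖ f b best₀)) + A
        ≡⟨ regroup′ (time (candidates b)) _ _ A ⟩
      time (candidates b) + time (bestCandidates (Rated.all-candidates C X)) + (time (branchOnᵖ f b best₀) + A)
        ≤⟨ +-mono-≤
             (+-mono-≤ (bound (Rated.candidates-cost C X 1≤N C<N X<N S))
                       (bound (best-cost {N} {S} {C} {X} total<N)))
             (branchOn-time {N} {A} {D} {f} ih valid total<N alive bonus Φ≤ best₀ id
               (≤-trans (length-filterᵖ _ (Rated.all-candidates C X))
                        (Rated.candidates≤ C X 1≤N C<N X<N))) ⟩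
      67 * N ^ⁿ 2 + 48 * N ^ⁿ 2 + (15 * N ^ⁿ 2 + (A * F n + D * #reachable S C))
        ≡⟨ regroup″ (N ^ⁿ 2) _ ⟩
      130 * N ^ⁿ 2 + (A * F n + D * #reachable S C) ∎
    unpruned : ∀ p → p ≡ value (prunedᵖ W b) →
      time (if p then return tt else rest) + A ≤ 130 * N ^ⁿ 2 + (A * k + D * #reachable S C)
    unpruned true  _  = begin
      A                       ≡⟨ *-identityʳ A ⟨
      A * 1                   ≤⟨ *-monoʳ-≤ A (Budget≥1 budget) ⟩
      A * k                   ≤⟨ m≤m+n (A * k) _ ⟩
      A * k + D * #reachable S C ≤⟨ m≤n+m _ (130 * N ^ⁿ 2) ⟩
      130 * N ^ⁿ 2 + (A * k + D * #reachable S C) ∎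
    unpruned false eq = rest-time (unpruned-alive W {S} {C} {X} (subst (¬_ ∘ T) eq λ ())) budget

  -- 153 = 13 + 140. The part 13 = 1 + 2 + 10 is for the call, the union and the test for
  -- 2-biplexes, 140 = 10 + 67 + 48 + 15 for pruning, candidates, minimisation and branching. A leaf
  -- needs 3 K₀.
  node-cost : ℕ → ℕ
  node-cost N = (153 + 3 * K₀) * N ^ⁿ 2

  ips-time : ∀ N f → Bounded N (node-cost N) (K₀ * N) f
  ips-time N zero    valid total<N budget = z≤n
  ips-time N (suc f) {S} {C} {X} {k} valid total<N budget = begin
    time (ips (suc f) b) ≡⟨ ips-unfold f b ⟩
    suc (time (union S C) + (time (2biplexᵖ W) + time continue))
      ≤⟨ s≤s (+-mono-≤ (bound (union-cost {N} {S} {C} {X} total<N))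
           (+-monoˡ-≤ _ (bound (2biplexᵖ-cost 1≤N W W<)))) ⟩
    suc (2 * N ^ⁿ 2 + (10 * N ^ⁿ 2 + time continue))
      ≤⟨ +-monoˡ-≤ _ (m^n>0 N {{>-nonZero 1≤N}} 2) ⟩
    N ^ⁿ 2 + (2 * N ^ⁿ 2 + (10 * N ^ⁿ 2 + time continue))
      ≤⟨ +-monoʳ-≤ (N ^ⁿ 2) (+-monoʳ-≤ (2 * N ^ⁿ 2) (+-monoʳ-≤ (10 * N ^ⁿ 2)
           (time-if halts leaf search))) ⟩
    N ^ⁿ 2 + (2 * N ^ⁿ 2 + (10 * N ^ⁿ 2 + (A * k + D * #reachable S C ∸ 13 * N ^ⁿ 2)))
      ≡⟨ trans (regroup (N ^ⁿ 2) _) (m+[n∸m]≡n 13N²≤) ⟩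
    A * k + D * #reachable S C ∎
    where
    open ≤-Reasoning
    b = branch S C X
    W = S ∪ᵥ C
    A = node-cost N
    D = K₀ * N
    halts = value (2biplexᵖ W) ∧ null (X left) ∧ null (X right)
    continue = if halts then run (λ _ → 1) W else searchᵖ f W b
    1≤N : 1 ≤ N
    1≤N = ≤-trans (s≤s z≤n) total<N
    W< : ∀ s → length (W s) < N
    W< s = ≤-<-trans (≤-trans (side≤ W s) (total-W {S} {C} {X})) total<N
    regroup : ∀ x y → x + (2 * x + (10 * x + y)) ≡ 13 * x + y
    regroup = solve-∀
    A≤ : A ≤ A * k
    A≤ = ≤-trans (≤-reflexive (sym (*-identityʳ A))) (*-monoʳ-≤ A (Budget≥1 budget))
    13≤ : 13 * N ^ⁿ 2 + 140 * N ^ⁿ 2 + 3 * K₀ * N ^ⁿ 2 ≤ A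
    13≤ = ≤-reflexive (split K₀ (N ^ⁿ 2))
      where
      split : ∀ k x → 13 * x + 140 * x + 3 * k * x ≡ (153 + 3 * k) * x
      split = solve-∀
    13N²≤ : 13 * N ^ⁿ 2 ≤ A * k + D * #reachable S C
    13N²≤ = ≤-trans (≤-trans (≤-trans (m≤m+n _ _) (m≤m+n _ _)) 13≤) (≤-trans A≤ (m≤m+n _ _))
    leaf : T halts → time (run (λ _ → 1) W) ≤ A * k + D * #reachable S C ∸ 13 * N ^ⁿ 2
    leaf t with t₁ , t₂ ← Equivalence.to T-∧ t with t₃ , t₄ ← Equivalence.to T-∧ t₂ =
      m+n≤o⇒n≤o∸m′ (begin
        13 * N ^ⁿ 2 + time (run (λ _ → 1) W)
          ≤⟨ +-monoʳ-≤ (13 * N ^ⁿ 2) (leaf-time {N} {S} {C} {X} total<N valid empty (2biplex-correct W t₁)) ⟩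
        13 * N ^ⁿ 2 + (3 * K₀ * N ^ⁿ 2 + D * #reachable S C)
          ≡⟨ +-assoc (13 * N ^ⁿ 2) _ _ ⟨
        13 * N ^ⁿ 2 + 3 * K₀ * N ^ⁿ 2 + D * #reachable S C
          ≤⟨ +-monoˡ-≤ (D * #reachable S C) (≤-trans (≤-trans
               (+-monoˡ-≤ (3 * K₀ * N ^ⁿ 2) (m≤m+n (13 * N ^ⁿ 2) (140 * N ^ⁿ 2))) 13≤) A≤) ⟩
        A * k + D * #reachable S C ∎)
      where
      m+n≤o⇒n≤o∸m′ : ∀ {m n o} → m + n ≤ o → n ≤ o ∸ m
      m+n≤o⇒n≤o∸m′ {m} {n} h = m+n≤o⇒m≤o∸n n (≤-trans (≤-reflexive (+-comm n m)) h)
      null⁻ : ∀ {A : Set} {xs : List A} → T (null xs) → ∀ {x} → x ∉ xs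
      null⁻ {xs = []} _ ()
      empty : ∀ s {v} → v ∉ X s
      empty left  = null⁻ t₃
      empty right = null⁻ t₄
    search : ¬ T halts → time (searchᵖ f W b) ≤ A * k + D * #reachable S C ∸ 13 * N ^ⁿ 2
    search _ = m+n≤o⇒m≤o∸n _ (+-cancelˡ-≤ (140 * N ^ⁿ 2) _ _ (begin
      140 * N ^ⁿ 2 + (time (searchᵖ f W b) + 13 * N ^ⁿ 2)
        ≡⟨ regroup″ (140 * N ^ⁿ 2) (time (searchᵖ f W b)) (13 * N ^ⁿ 2) ⟩
      time (searchᵖ f W b) + (13 * N ^ⁿ 2 + 140 * N ^ⁿ 2)
        ≤⟨ +-monoʳ-≤ (time (searchᵖ f W b)) (≤-trans (m≤m+n _ _) 13≤) ⟩
      time (searchᵖ f W b) + A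
        ≤⟨ search-time {N} {A} {D} {f} (ips-time N f) valid total<N budget ⟩
      140 * N ^ⁿ 2 + (A * k + D * #reachable S C) ∎))
      where
      regroup″ : ∀ x y z → x + (y + z) ≡ y + (z + x)
      regroup″ = solve-∀

  -- The initial branches

  module Roots (π : Permutation′ (size left)) where

    insertᵖ : List (V G left) → V G left → Run G (List (V G left))
    insertᵖ acc u = do
      present ← anyᵖ (same G {left} u) acc
      return (if present then acc else u ∷ acc)

    neighbours⁺ : ∀ s {v u} → T (adj G s v u) → u ∈ neighbours G s v
    neighbours⁺ s {v} {u} vu = ∈-filter⁺ (λ u → T? (adj G s v u)) (∈-allFin u) vu

    neighbours⁻ : ∀ s {v u} → u ∈ neighbours G s v → T (adj G s v u)
    neighbours⁻ s {v} u∈ = proj₂ (∈-filter⁻ (λ u → T? (adj G s v u)) {xs = allFin _} u∈)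

    neighbours-unique : ∀ s v → Unique (neighbours G s v)
    neighbours-unique s v = Unique.filter⁺ (λ u → T? (adj G s v u)) (Unique.allFin⁺ _)

    common⇒∈N₂ : ∀ {u v w} → T (edge u w) → T (edge v w) → u Subset.∈ N₂ G v
    common⇒∈N₂ {u} {v} {w} uw vw = ∈-tabulate⁺ _ (Equivalence.from (T-∨ {does (u Fin.≟ v)})
      (inj₂ (does⁺ (Subset.nonempty? (N₁ G left u ∩ N₁ G left v))
        (w , Subset.x∈p∩q⁺ (∈-tabulate⁺ (edge u) uw , ∈-tabulate⁺ (edge v) vw)))))

    v∈N₂ : ∀ v → v Subset.∈ N₂ G v
    v∈N₂ v = ∈-tabulate⁺ _ (Equivalence.from (T-∨ {does (v Fin.≟ v)})
      (inj₁ (does⁺ (v Fin.≟ v) refl)))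

    present⁻ : ∀ {u acc} → T (value (anyᵖ (same G {left} u) acc)) → u ∈ acc
    present⁻ {u} {acc} t with x , x∈ , eq ← any⁻ (same G {left} u) {acc} t
      with refl ← does⁻ (u Fin.≟ x) eq = x∈

    present⁺ : ∀ {u acc} → u ∈ acc → T (value (anyᵖ (same G {left} u) acc))
    present⁺ {u} u∈ = any⁺ (same G {left} u) u∈ (does⁺ (u Fin.≟ u) refl)

    insert∈ : ∀ {acc} u → u ∈ value (insertᵖ acc u)
    insert∈ {acc} u with value (anyᵖ (same G {left} u) acc) in eq
    ... | true  = present⁻ (subst T (sym eq) _)
    ... | false = here refl

    insert⊆ : ∀ {acc x} u → x ∈ acc → x ∈ value (insertᵖ acc u)
    insert⊆ {acc} u x∈ with value (anyᵖ (same G {left} u) acc)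
    ... | true  = x∈
    ... | false = there x∈

    record TwoHop (v : V G left) (acc : List (V G left)) : Set where
      field
        acc-unique : Unique acc
        v∈acc      : v ∈ acc
        acc⊆N₂     : ∀ {u} → u ∈ acc → u Subset.∈ N₂ G v

    insert-TwoHop : ∀ {v acc u} → u Subset.∈ N₂ G v → TwoHop v acc → TwoHop v (value (insertᵖ acc u))
    insert-TwoHop {v} {acc} {u} u∈N₂ th with value (anyᵖ (same G {left} u) acc) in eq
    ... | true  = th
    ... | false = record
      { acc-unique = All.tabulate (λ x∈ → λ { refl → subst T eq (present⁺ x∈) }) ∷ acc-unique
      ; v∈acc      = there v∈acc
      ; acc⊆N₂     = λ { (here refl) → u∈N₂ ; (there x∈) → acc⊆N₂ x∈ }
      }
      where open TwoHop th

    start-TwoHop : ∀ v → TwoHop v (v ∷ [])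
    start-TwoHop v = record
      { acc-unique = [] ∷ [] ; v∈acc = here refl ; acc⊆N₂ = λ { (here refl) → v∈N₂ v } }

    two-hop∈N₂ : ∀ {v w u} → w ∈ neighbours G left v → u ∈ neighbours G right w → u Subset.∈ N₂ G v
    two-hop∈N₂ w∈ u∈ = common⇒∈N₂ (neighbours⁻ right u∈) (neighbours⁻ left w∈)

    layer-TwoHop : ∀ {v w acc} → w ∈ neighbours G left v → TwoHop v acc →
      TwoHop v (value (foldᵖ insertᵖ acc (neighbours G right w)))
    layer-TwoHop {v} {w} w∈ = foldᵖ-invariant (TwoHop v) (neighbours G right w)
      (λ u∈ → insert-TwoHop (two-hop∈N₂ w∈ u∈))

    twoHop-TwoHop : ∀ v → TwoHop v (value (twoHop π v))
    twoHop-TwoHop v = foldᵖ-invariant (TwoHop v) (neighbours G left v) layer-TwoHop (start-TwoHop v)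

    twoHop-complete : ∀ {v u w} → T (edge v w) → T (edge u w) → u ∈ value (twoHop π v)
    twoHop-complete {v} {u} {w} vw uw = foldᵖ-reaches (u ∈_) (neighbours⁺ left vw)
      (foldᵖ-reaches (u ∈_) (neighbours⁺ right uw) (λ {acc} → insert∈ {acc} u) (λ {acc} {y} → insert⊆ {acc} y))
      (λ {_} {y} u∈ → foldᵖ-invariant (u ∈_) (neighbours G right y) (λ {acc} {x} _ → insert⊆ {acc} x) u∈)

    n₁ n₂ : V G left → ℕ
    n₁ v = length (neighbours G left v)
    n₂ v = ∣ N₂ G v ∣

    n₁≤ : ∀ v → n₁ v ≤ ∣ N₁ G left v ∣
    n₁≤ v = length≤∣∣ (neighbours-unique left v) (λ u∈ → ∈-tabulate⁺ (edge v) (neighbours⁻ left u∈))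

    n₁+n₂≤ : ∀ v → n₁ v + n₂ v ≤ suc (γ G)
    n₁+n₂≤ v = begin
      n₁ v + n₂ v                    ≤⟨ +-monoˡ-≤ (n₂ v) (n₁≤ v) ⟩
      a                              ≤⟨ m≤n+m∸n a 1 ⟩
      suc (a ∸ 1)                    ≤⟨ s≤s (All.lookup (map⁻ (Extrema.xs≤max 0 _)) (∈-allFin v)) ⟩
      suc (γ G)                      ∎
      where
      open ≤-Reasoning
      a = ∣ N₁ G left v ∣ + n₂ v

    -- At most γ vertices in C and X, the root vertex in S, and one more to make the bound strict.
    N : ℕ
    N = 2 + γ G

    -- The accumulator stays inside `N₂` without repetitions, and so do the neighbours of a
    -- neighbour of `v`; hence each of the three nested loops is shorter than `N`. The cubic cost is
    -- later absorbed by the exponential factor.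
    twoHop-cost : ∀ v → Cost N 3 (time (twoHop π v)) 4
    twoHop-cost v = loop (n₁ v)
      (foldᵖ-time (TwoHop v) (neighbours G left v) layer-TwoHop
        (λ {acc} {w} w∈ th → bound (layer-cost w∈ th)) (start-TwoHop v))
      (s≤s (≤-trans (m≤m+n _ _) (n₁+n₂≤ v))) ≤-refl
      where
      n₂<N : n₂ v < N
      n₂<N = s≤s (≤-trans (m≤n+m _ _) (n₁+n₂≤ v))
      insert-cost : ∀ {acc u} → TwoHop v acc → Cost N 1 (time (insertᵖ acc u)) 2
      insert-cost {acc} {u} th =
        (filterᵖ-cost {j = 1} (same G {left} u) acc
          (≤-<-trans (length≤∣∣ acc-unique acc⊆N₂) n₂<N) (λ _ → one) ⊕ free) ⊕ free
        where open TwoHop th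
      layer-cost : ∀ {acc w} → w ∈ neighbours G left v → TwoHop v acc →
        Cost N 2 (time (foldᵖ insertᵖ acc (neighbours G right w))) 3
      layer-cost {acc} {w} w∈ th = loop (length (neighbours G right w))
        (foldᵖ-time (TwoHop v) (neighbours G right w)
          (λ u∈ → insert-TwoHop (two-hop∈N₂ w∈ u∈)) (λ {acc} {u} _ th → bound (insert-cost {acc} {u} th)) th)
        (≤-trans (s≤s (length≤∣∣ (neighbours-unique right w) (two-hop∈N₂ w∈))) n₂<N) ≤-refl

    position : V G left → ℕ
    position v = toℕ (π ⟨$⟩ˡ v)

    position-injective : ∀ {u v} → position u ≡ position v → u ≡ v
    position-injective {u} {v} eq = trans (sym (inverseʳ π))
      (trans (cong (π ⟨$⟩ʳ_) (Fin.toℕ-injective eq)) (inverseʳ π))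

    later earlier : V G left → List (V G left)
    later v   = value (filterᵖ (λ u → precedes π v u) (value (twoHop π v)))
    earlier v = value (filterᵖ (λ u → precedes π u v) (value (twoHop π v)))

    later⁻ : ∀ {v u} → u ∈ later v → u ∈ value (twoHop π v) × position v < position u
    later⁻ {v} u∈ with u∈′ , t ← ∈-filterᵖ⁻ (precedes π v) u∈ = u∈′ , <ᵇ⇒< _ _ t

    S₀ C₀ X₀ : V G left → VSet G
    S₀ v = assemble G left (v ∷ []) []
    C₀ v = assemble G left (later v) (neighbours G left v)
    X₀ v = assemble G left (earlier v) []

    -- A left vertex of a biclique through `v` shares a right vertex of this biclique with `v`. So
    -- `twoHop` finds it, and its position decides between C and X.
    root-valid : ∀ v → Valid (S₀ v) (C₀ v) (X₀ v)
    root-valid v = record { unique = unique′ ; apart = apart′ ; joined = joined′ ; complete = complete′ }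
      where
      open TwoHop (twoHop-TwoHop v)
      unique′ : ∀ s → Unique (C₀ v s)
      unique′ left  = subst Unique (sym (value-filterᵖ (precedes π v) (value (twoHop π v))))
        (Unique.filter⁺ (T? ∘ value ∘ precedes π v) acc-unique)
      unique′ right = neighbours-unique left v
      apart′ : ∀ s {u} → u ∈ S₀ v s → u ∉ C₀ v s
      apart′ left  (here refl) u∈ = <-irrefl refl (proj₂ (later⁻ {v} u∈))
      apart′ right ()
      joined′ : ∀ {u w} → u ∈ (S₀ v ∪ᵥ C₀ v) left → w ∈ (S₀ v ∪ᵥ C₀ v) right →
        u ∈ S₀ v left ⊎ w ∈ S₀ v right → T (edge u w)
      joined′ _ w∈ (inj₁ (here refl)) = neighbours⁻ left w∈
      complete′ : ∀ {H} → IsBiclique G H → S₀ v ⊆ᵥ H → Nonempty (proj₁ H) → Nonempty (proj₂ H) →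
        ∀ s {u} → u Subset.∈ side G H s → u ∈ (S₀ v ∪ᵥ C₀ v) s ⊎ u ∈ X₀ v s
      complete′ biclique S⊆H _ (w , w∈) right {u} u∈ =
        inj₁ (neighbours⁺ left (biclique v (S⊆H left (here refl)) u u∈))
      complete′ biclique S⊆H _ (w , w∈) left {u} u∈ with <-cmp (position v) (position u)
      ... | tri< v<u _ _ = inj₁ (there (∈-filterᵖ⁺ (precedes π v)
        (twoHop-complete (biclique v (S⊆H left (here refl)) w w∈) (biclique u u∈ w w∈)) (<⇒<ᵇ v<u)))
      ... | tri≈ _ v≡u _ = inj₁ (here (position-injective (sym v≡u)))
      ... | tri> _ _ u<v = inj₂ (∈-filterᵖ⁺ (λ u → precedes π u v)
        (twoHop-complete (biclique v (S⊆H left (here refl)) w w∈) (biclique u u∈ w w∈)) (<⇒<ᵇ u<v))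

    -- `v` is neither earlier nor later than itself, which accounts for the subtracted 1 in the
    -- definition of γ.
    later+earlier : ∀ v → suc (length (later v) + length (earlier v)) ≤ n₂ v
    later+earlier v = begin
      suc (length (later v) + length (earlier v))
        ≡⟨ cong suc (cong₂ (λ xs ys → length xs + length ys)
             (value-filterᵖ (precedes π v) (value (twoHop π v)))
             (value-filterᵖ (λ u → precedes π u v) (value (twoHop π v)))) ⟩
      suc (length (filterᵇ (λ u → position v <ᵇ position u) (value (twoHop π v))) +
           length (filterᵇ (λ u → position u <ᵇ position v) (value (twoHop π v))))
        ≤⟨ s≤s (length-filterᵇ-disjoint _ _ (other v)
             (λ u v<u → other⁺ {v = v} {u} λ { refl → <-irrefl refl (<ᵇ⇒< (position v) _ v<u) })
             (λ u u<v → other⁺ {v = v} {u} λ { refl → <-irrefl refl (<ᵇ⇒< (position v) _ u<v) })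
             (λ u v<u u<v → <-asym (<ᵇ⇒< (position v) _ v<u) (<ᵇ⇒< (position u) _ u<v))
             (value (twoHop π v))) ⟩
      suc (length (remove v (value (twoHop π v)))) ≤⟨ length-remove v∈acc ⟩
      length (value (twoHop π v))                   ≤⟨ length≤∣∣ acc-unique acc⊆N₂ ⟩
      n₂ v                                         ∎
      where
      open ≤-Reasoning
      open TwoHop (twoHop-TwoHop v)

    root-size : ∀ v → length (later v) + length (earlier v) + n₁ v ≤ γ G
    root-size v = s≤s⁻¹ (≤-trans (+-monoˡ-≤ (n₁ v) (later+earlier v))
      (≤-trans (≤-reflexive (+-comm (n₂ v) (n₁ v))) (n₁+n₂≤ v)))

    root-total : ∀ v → total (S₀ v) (C₀ v) (X₀ v) < N
    root-total v = s≤s (s≤s (≤-trans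
      (≤-reflexive (regroup (length (later v)) (n₁ v) (length (earlier v)))) (root-size v)))
      where
      regroup : ∀ a b c → a + b + (c + 0) ≡ a + c + b
      regroup = solve-∀

    root-budget : ∀ v → Budget edge (Node (C₀ v) (X₀ v)) (F (2 * γ G))
    root-budget v = fits none (begin
      2 * (length (later v) + n₁ v) + (length (earlier v) + 0)
        ≤⟨ m≤m+n _ (length (earlier v)) ⟩
      2 * (length (later v) + n₁ v) + (length (earlier v) + 0) + length (earlier v)
        ≡⟨ regroup (length (later v)) (n₁ v) (length (earlier v)) ⟩
      2 * (length (later v) + length (earlier v) + n₁ v)
        ≤⟨ *-monoʳ-≤ 2 (root-size v) ⟩
      2 * γ G ∎)
      where
      open ≤-Reasoning
      regroup : ∀ a b c → 2 * (a + b) + (c + 0) + c ≡ 2 * (a + c + b)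
      regroup = solve-∀

    overhead : ℕ
    overhead = 8 * N ^ⁿ 3 + node-cost N * F (2 * γ G)

    start-time : ∀ v →
      time (twoHop π v) + (time (filterᵖ (λ u → precedes π v u) (value (twoHop π v))) +
        (time (filterᵖ (λ u → precedes π u v) (value (twoHop π v))) +
         time (ips (suc (length (later v) + length (neighbours G left v)))
                   (branch (S₀ v) (C₀ v) (X₀ v))))) ≤
      overhead + K₀ * N * #reachable (S₀ v) (C₀ v)
    start-time v = begin
      t₁ + (t₂ + (t₃ + t₄)) ≡⟨ regroup t₁ t₂ t₃ t₄ ⟩
      (t₁ + (t₂ + t₃)) + t₄
        ≤⟨ +-mono-≤ (bound (twoHop-cost v ⊕ filter-cost (λ u → precedes π v u) (λ _ → one) ⊕
                             filter-cost (λ u → precedes π u v) (λ _ → one)))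
             (ips-time N f (root-valid v) (root-total v) (root-budget v)) ⟩
      8 * N ^ⁿ 3 + (node-cost N * F (2 * γ G) + K₀ * N * #reachable (S₀ v) (C₀ v))
        ≡⟨ +-assoc (8 * N ^ⁿ 3) _ _ ⟨
      overhead + K₀ * N * #reachable (S₀ v) (C₀ v) ∎
      where
      open ≤-Reasoning
      open TwoHop (twoHop-TwoHop v)
      f = suc (length (later v) + length (neighbours G left v))
      t₁ = time (twoHop π v)
      t₂ = time (filterᵖ (λ u → precedes π v u) (value (twoHop π v)))
      t₃ = time (filterᵖ (λ u → precedes π u v) (value (twoHop π v)))
      t₄ = time (ips f (branch (S₀ v) (C₀ v) (X₀ v)))
      regroup : ∀ a b c d → a + (b + (c + d)) ≡ a + (b + c) + d
      regroup = solve-∀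
      filter-cost : ∀ p → (∀ u → Cost N 0 (time (p u)) 1) →
        Cost N 3 (time (filterᵖ p (value (twoHop π v)))) 2
      filter-cost p fast = raise (s≤s z≤n) (raise (s≤s z≤n) (filterᵖ-cost p (value (twoHop π v))
        (≤-<-trans (length≤∣∣ acc-unique acc⊆N₂) (s≤s (≤-trans (m≤n+m _ _) (n₁+n₂≤ v)))) fast))

    root# : Fin (size left) → ℕ
    root# i = #reachable (S₀ (π ⟨$⟩ʳ i)) (C₀ (π ⟨$⟩ʳ i))

    visits-time : ∀ {visit : 𝟙 → Fin (size left) → Run G 𝟙} →
      (∀ i → time (visit tt i) ≤ overhead + K₀ * N * root# i) →
      ∀ is → time (foldᵖ visit tt is) ≤ suc (length is * suc overhead) + K₀ * N * sum (map root# is)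
    visits-time visit≤ []       = s≤s z≤n
    visits-time {visit} visit≤ (i ∷ is) = begin
      suc (time (visit tt i)) + time (foldᵖ visit tt is)
        ≤⟨ +-mono-≤ (s≤s (visit≤ i)) (visits-time {visit} visit≤ is) ⟩
      suc (overhead + K₀ * N * root# i) + (suc (length is * suc overhead) + K₀ * N * rs)
        ≡⟨ regroup overhead (K₀ * N) (root# i) rs (length is * suc overhead) ⟩
      suc (suc overhead + length is * suc overhead) + K₀ * N * (root# i + rs) ∎
      where
      open ≤-Reasoning
      rs = sum (map root# is)
      regroup : ∀ a d r s l → suc (a + d * r) + (suc l + d * s) ≡ suc (suc a + l) + d * (r + s)
      regroup = solve-∀

    ie-time : time (ie π) ≤
      suc (length (allFin (size left)) * suc overhead) + K₀ * N * sum (map root# (allFin (size left)))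
    ie-time = visits-time (λ i → start-time (π ⟨$⟩ʳ i)) (allFin (size left))

    -- The root vertex must be the first left vertex of `H` in the ordering.
    roots-disjoint : ∀ {i j H} → Reachable (S₀ (π ⟨$⟩ʳ i)) (C₀ (π ⟨$⟩ʳ i)) H →
      Reachable (S₀ (π ⟨$⟩ʳ j)) (C₀ (π ⟨$⟩ʳ j)) H → i ≡ j
    roots-disjoint {i} {j} {H} (_ , Sᵢ⊑H , H⊑Wᵢ) (_ , Sⱼ⊑H , H⊑Wⱼ) =
      trans (sym (inverseˡ π)) (trans (cong (π ⟨$⟩ˡ_) (sym same-root)) (inverseˡ π))
      where
      vᵢ = π ⟨$⟩ʳ i
      vⱼ = π ⟨$⟩ʳ j
      after : ∀ {v u} → u ∈ (S₀ v ∪ᵥ C₀ v) left → u ≡ v ⊎ position v < position u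
      after (here u≡v) = inj₁ u≡v
      after (there u∈) = inj₂ (proj₂ (later⁻ u∈))
      same-root : vⱼ ≡ vᵢ
      same-root with after (⊑⇒⊇ᵥ {S₀ vᵢ ∪ᵥ C₀ vᵢ} {H} H⊑Wᵢ left (⊑⇒⊆ᵥ {S₀ vⱼ} {H} Sⱼ⊑H left (here refl)))
                   | after (⊑⇒⊇ᵥ {S₀ vⱼ ∪ᵥ C₀ vⱼ} {H} H⊑Wⱼ left (⊑⇒⊆ᵥ {S₀ vᵢ} {H} Sᵢ⊑H left (here refl)))
      ... | inj₁ eq  | _        = eq
      ... | inj₂ _   | inj₁ eq  = sym eq
      ... | inj₂ i<j | inj₂ j<i = contradiction j<i (<-asym i<j)

    roots-count : sum (map root# (allFin (size left))) ≤ β G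
    roots-count = ≤-trans
      (sum-count-disjoint root? (λ {i} {j} {H} → roots-disjoint {i} {j} {H}) (Unique.allFin⁺ _) all-subs)
      (count-mono (λ H → Any.any? (λ i → root? i H) (allFin (size left))) (large? 1 (whole G))
        (λ {H} any → proj₁ (proj₂ (Any.satisfied any))) all-subs)
      where
      root? : ∀ i → Decidable (Reachable (S₀ (π ⟨$⟩ʳ i)) (C₀ (π ⟨$⟩ʳ i)))
      root? i = reachable? (S₀ (π ⟨$⟩ʳ i)) (C₀ (π ⟨$⟩ʳ i))

    running-time : time (ie π) ≤ suc (size left * suc overhead) + K₀ * N * β G
    running-time = ≤-trans ie-time
      (+-mono-≤ (s≤s (*-monoˡ-≤ (suc overhead) (≤-reflexive (length-tabulate {n = size left} id))))
                (*-monoʳ-≤ (K₀ * N) roots-count))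

-- The exponential bound

empty-left-γ : ∀ G → BipartiteGraph.size G left ≤ 0 → γ G ≤ 0
empty-left-γ G empty = Extrema.max≤v⁺ z≤n
  (map⁺ {xs = allFin (BipartiteGraph.size G left)} (All.tabulate λ {v} _ → contradiction v (no-vertex empty)))
  where
  no-vertex : ∀ {n} → n ≤ 0 → ¬ Fin n
  no-vertex z≤n ()

-- From γ ≥ 1 comes N = 2 + γ ≤ 3γ, hence the factors 9 and 3. The cubic cost of the roots is
-- covered by N ≤ F (2γ); it adds 8 and the two unit summands add 2, which turns 153 into 163.
time-bound : ∀ {K₀} (G : BipartiteGraph) → 1 ≤ γ G →
  (biplex : BiplexProcedure G K₀) (choices : Choices G)
  (π : Permutation′ (BipartiteGraph.size G left)) →
  runningTime G biplex choices π ≤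
  (163 + 3 * K₀) * 9 * (order G * (γ G * γ G)) * F (2 * γ G) + 3 * K₀ * (γ G * β G)
time-bound {K₀} G 1≤γ biplex choices π = begin
  runningTime G biplex choices π
    ≤⟨ running-time ⟩
  1 + l * (1 + (8 * (N * (N * (N * 1))) + (153 + 3 * K₀) * (N * (N * 1)) * Q)) + K₀ * N * B
    ≤⟨ +-monoˡ-≤ (K₀ * N * B) (+-mono-≤ 1≤nM (*-mono-≤ l≤n
         (+-mono-≤ 1≤M (+-monoˡ-≤ ((153 + 3 * K₀) * (N * (N * 1)) * Q)
           (*-monoʳ-≤ 8 (*-monoˡ-≤ (N * (N * 1)) N≤Q)))))) ⟩
  n * (N * N * Q) + n * (N * N * Q + (8 * (Q * (N * (N * 1))) + (153 + 3 * K₀) * (N * (N * 1)) * Q)) + K₀ * N * B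
    ≡⟨ collect n N Q K₀ (K₀ * N * B) ⟩
  (163 + 3 * K₀) * (n * (N * N)) * Q + K₀ * N * B
    ≤⟨ +-mono-≤ (*-monoˡ-≤ Q (*-monoʳ-≤ (163 + 3 * K₀) (*-monoʳ-≤ n (*-mono-≤ N≤3g N≤3g))))
                (*-monoˡ-≤ B (*-monoʳ-≤ K₀ N≤3g)) ⟩
  (163 + 3 * K₀) * (n * (3 * g * (3 * g))) * Q + K₀ * (3 * g) * B
    ≡⟨ cong₂ _+_ (cong (_* Q) (regroup (163 + 3 * K₀) n g)) (regroup′ K₀ g B) ⟩
  (163 + 3 * K₀) * 9 * (n * (g * g)) * Q + 3 * K₀ * (g * B) ∎
  where
  open ≤-Reasoning
  open Algorithm G biplex choices
  open Roots π
  g = γ G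
  n = order G
  l = BipartiteGraph.size G left
  B = β G
  Q = F (2 * g)
  N≤3g : N ≤ 3 * g
  N≤3g = ≤-trans (+-monoˡ-≤ g (*-monoʳ-≤ 2 1≤γ)) (≤-reflexive (+-comm (2 * g) g))
  N≤Q : N ≤ Q
  N≤Q = ≤-trans (s≤s (≤-trans (+-monoˡ-≤ g 1≤γ) (≤-reflexive (cong (g +_) (sym (+-identityʳ g))))))
    (F≥ (2 * g))
  l≤n : l ≤ n
  l≤n = m≤m+n l _
  1≤n : 1 ≤ n
  1≤n = ≤-trans (≰⇒> λ l≤0 → contradiction (≤-trans 1≤γ (empty-left-γ G l≤0)) λ ()) l≤n
  1≤M : 1 ≤ N * N * Q
  1≤M = *-mono-≤ (*-mono-≤ {1} {N} {1} {N} (s≤s z≤n) (s≤s z≤n)) (≤-trans (s≤s z≤n) N≤Q)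
  1≤nM : 1 ≤ n * (N * N * Q)
  1≤nM = *-mono-≤ 1≤n 1≤M
  collect : ∀ n N Q k y →
    n * (N * N * Q) + n * (N * N * Q + (8 * (Q * (N * (N * 1))) + (153 + 3 * k) * (N * (N * 1)) * Q)) + y ≡
    (163 + 3 * k) * (n * (N * N)) * Q + y
  collect = solve-∀
  regroup : ∀ k n g → k * (n * (3 * g * (3 * g))) ≡ k * 9 * (n * (g * g))
  regroup = solve-∀
  regroup′ : ∀ k g b → k * (3 * g) * b ≡ 3 * k * (g * b)
  regroup′ = solve-∀

-- One constant `c * C` has to serve both summands: `F-growth` supplies it for the first, and the
-- remainder `d` is simply enlarged.
F-bound⇒α-bound : ∀ {t c d} e x k C → suc (F 6) ≤ C → t ≤ c * x * F (2 * k) + d → d ≤ c * C * e →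
  t ≤[ c * C * x ·α^ k + c * C * e ]
F-bound⇒α-bound {t} {c} {d} e x k C C≥ t≤ d≤ q α<q = begin
  fromℕ t
    ≤⟨ fromℕ-mono {t} {c * x * F (2 * k) + c * C * e} (≤-trans t≤ (+-monoʳ-≤ (c * x * F (2 * k)) d≤)) ⟩
  fromℕ (c * x * F (2 * k) + c * C * e)
    ≡⟨ fromℕ-+ (c * x * F (2 * k)) (c * C * e) ⟩
  fromℕ (c * x * F (2 * k)) ℚ.+ fromℕ (c * C * e)
    ≤⟨ ℚ.+-monoˡ-≤ (fromℕ (c * C * e)) (begin
         fromℕ (c * x * F (2 * k))           ≡⟨ fromℕ-* (c * x) (F (2 * k)) ⟩
         fromℕ (c * x) ℚ.* fromℕ (F (2 * k)) ≤⟨ ℚ.*-monoˡ-≤-nonNeg (fromℕ (c * x)) {{fromℕ-nonNeg (c * x)}}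
           (ℚ.≤-trans (fromℕ-mono {F (2 * k)} {suc (F (2 * k))} (n≤1+n _)) (F-growth α<q C C≥ k)) ⟩
         fromℕ (c * x) ℚ.* (fromℕ C ℚ.* q ^ k) ≡⟨ ℚ.*-assoc (fromℕ (c * x)) (fromℕ C) (q ^ k) ⟨
         fromℕ (c * x) ℚ.* fromℕ C ℚ.* q ^ k ≡⟨ cong (ℚ._* q ^ k) (fromℕ-* (c * x) C) ⟨
         fromℕ (c * x * C) ℚ.* q ^ k         ≡⟨ cong (λ i → fromℕ i ℚ.* q ^ k) (regroup c x C) ⟩
         fromℕ (c * C * x) ℚ.* q ^ k         ∎) ⟩
  fromℕ (c * C * x) ℚ.* q ^ k ℚ.+ fromℕ (c * C * e) ∎
  where
  open ℚ.≤-Reasoning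
  regroup : ∀ c x C → c * x * C ≡ c * C * x
  regroup = solve-∀

α-bound : ∀ C → suc (F 6) ≤ C → ∀ (K₀ : ℕ) (G : BipartiteGraph) → 1 ≤ γ G →
  ∀ (biplex : BiplexProcedure G K₀) (choices : Choices G)
    (π : Permutation′ (BipartiteGraph.size G left)) →
  runningTime G biplex choices π
    ≤[ (163 + 3 * K₀) * 9 * C * (order G * (γ G * γ G)) ·α^ γ G + (163 + 3 * K₀) * 9 * C * (γ G * β G) ]
α-bound C C≥ K₀ G 1≤γ biplex choices π =
  F-bound⇒α-bound {c = (163 + 3 * K₀) * 9} (γ G * β G) (order G * (γ G * γ G)) (γ G) C C≥
    (time-bound G 1≤γ biplex choices π) (*-monoˡ-≤ (γ G * β G) 3K₀≤)
  where
  open ≤-Reasoning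
  3K₀≤ : 3 * K₀ ≤ (163 + 3 * K₀) * 9 * C
  3K₀≤ = begin
    3 * K₀                   ≤⟨ m≤n+m (3 * K₀) 163 ⟩
    163 + 3 * K₀             ≡⟨ *-identityʳ (163 + 3 * K₀) ⟨
    (163 + 3 * K₀) * 1       ≤⟨ *-monoʳ-≤ (163 + 3 * K₀) {1} {9} (s≤s z≤n) ⟩
    (163 + 3 * K₀) * 9       ≡⟨ *-identityʳ ((163 + 3 * K₀) * 9) ⟨
    (163 + 3 * K₀) * 9 * 1   ≤⟨ *-monoʳ-≤ ((163 + 3 * K₀) * 9) {1} {C} (≤-trans (s≤s {0} {F 6} z≤n) C≥) ⟩
    (163 + 3 * K₀) * 9 * C   ∎

theorem4p1 : ∀ (K₀ : ℕ) → ∃ λ (K : ℕ) →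
    ∀ (G : BipartiteGraph) → 1 ≤ γ G →
    ∀ (biplex : BiplexProcedure G K₀) (choices : Choices G)
    (π : Permutation′ (BipartiteGraph.size G left)) →
    runningTime G biplex choices π
    ≤[ K * (order G * (γ G * γ G)) ·α^ γ G + K * (γ G * β G) ]
theorem4p1 K₀ = (163 + 3 * K₀) * 9 * suc (F 6) , α-bound (suc (F 6)) ≤-refl K₀
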